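{- For all integers $r \ge 2$ and every real $\beta > 0$, there exist an integer $D_{\beta}\ge 0$ and a real $\alpha > 0$ such that the following holds for all $D\ge D_{\beta}$. Let $G$ be an $r$-bounded multi-hypergraph whose edges are (not necessarily properly) colored, such that (G1) $\Delta(G)\le D$ and every color appears on at least $(1+D^{ -\alpha})D$ edges, and (G2) every pair of vertices of $G$ has codegree at most $D^{1-\beta}$ and, for every vertex $v$ and every color $c$, at most $D^{1-\beta}$ edges of color $c$ contain $v$. Then there exists a full rainbow matching of $G$, and indeed even a set of $D$ pairwise edge-disjoint full rainbow matchings of $G$.
   Context: A multi-hypergraph has a vertex set and a multiset of subsets (edges); $r$-bounded means all edges have size at most $r$; degrees and codegrees count multiplicity. A matching in an edge-colored hypergraph is rainbow if its edges have pairwise distinct colors, and a rainbow matching is full if every color used by the coloring appears on one of its edges. -}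

module Defs where

open import Data.Nat using (ℕ; zero; suc; _+_; _*_; _∸_; _^_; _≤_; _<_)
open import Data.Fin using (Fin; zero; suc)
open import Data.Fin.Subset using (Subset; _∈_; ∣_∣)
open import Data.Product using (Σ; ∃; _×_; _,_)
open import Relation.Nullary using (¬_; Dec; yes; no)
open import Relation.Binary.PropositionalEquality using (_≡_; _≢_)

count : ∀ {m} {P : Fin m → Set} → ((i : Fin m) → Dec (P i)) → ℕ
count {zero}  P? = 0
count {suc m} P? with P? zero
... | yes _ = suc (count (λ i → P? (suc i)))
... | no  _ = count (λ i → P? (suc i))

-- An edge-coloured multi-hypergraph on vertex set Fin n with m edges
-- (edges indexed by Fin m, so repeated subsets give multiplicity).
-- Colours are natural numbers; the colours "used" are those in the image.
record ColHyp (n m : ℕ) : Set where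
  field
    edge  : Fin m → Subset n
    color : Fin m → ℕ
open ColHyp public

RBounded : ∀ {n m} → ℕ → ColHyp n m → Set
RBounded r G = ∀ e → ∣ edge G e ∣ ≤ r

open import Data.Fin.Subset.Properties using (_∈?_)
open import Data.Nat.Properties using (_≟_)
open import Relation.Nullary.Decidable using (_×-dec_)

deg : ∀ {n m} → ColHyp n m → Fin n → ℕ
deg G v = count (λ e → v ∈? edge G e)

MaxDegLe : ∀ {n m} → ColHyp n m → ℕ → Set
MaxDegLe G D = ∀ v → deg G v ≤ D

codeg : ∀ {n m} → ColHyp n m → Fin n → Fin n → ℕ
codeg G u v = count (λ e → (u ∈? edge G e) ×-dec (v ∈? edge G e))

colCount : ∀ {n m} → ColHyp n m → ℕ → ℕ
colCount G c = count (λ e → color G e ≟ c)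

colDeg : ∀ {n m} → ColHyp n m → Fin n → ℕ → ℕ
colDeg G v c = count (λ e → (v ∈? edge G e) ×-dec (color G e ≟ c))

UsedColor : ∀ {n m} → ColHyp n m → ℕ → Set
UsedColor G c = ∃ λ e → color G e ≡ c

IsMatching : ∀ {n m} → ColHyp n m → Subset m → Set
IsMatching G M = ∀ e f → e ∈ M → f ∈ M → e ≢ f →
                 ∀ v → v ∈ edge G e → ¬ (v ∈ edge G f)

IsRainbow : ∀ {n m} → ColHyp n m → Subset m → Set
IsRainbow G M = ∀ e f → e ∈ M → f ∈ M → e ≢ f → color G e ≢ color G f

IsFull : ∀ {n m} → ColHyp n m → Subset m → Set
IsFull G M = ∀ c → UsedColor G c → ∃ λ e → e ∈ M × color G e ≡ c

IsFullRainbowMatching : ∀ {n m} → ColHyp n m → Subset m → Set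
IsFullRainbowMatching G M = IsMatching G M × IsRainbow G M × IsFull G M

-- Real-exponent comparisons, for D ≥ 1 and rational exponent p/q (q ≥ 1):
--   x ≥ D^(1 - p/q)   ⇔   D^q ≤ x^q * D^p
--   x ≤ D^(1 - p/q)   ⇔   x^q * D^p ≤ D^q
GeqPow1Minus : (x D p q : ℕ) → Set
GeqPow1Minus x D p q = D ^ q ≤ x ^ q * D ^ p

LeqPow1Minus : (x D p q : ℕ) → Set
LeqPow1Minus x D p q = x ^ q * D ^ p ≤ D ^ q

{-# OPTIONS --safe #-}
-- Passing to a D-fold product reduces D edge-disjoint full rainbow matchings to a single one. That one is built by a nibble.
-- Let every remaining colour have a edges and every vertex degree at most d. In a step every colour chooses one of its edges at
-- random, a fraction θ of the colours is activated, and an activated colour is matched by its chosen edge unless that edge meets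
-- the chosen edge of another activated colour. Edges meeting activated chosen edges are deleted, and independent coins delete
-- further edges so that every edge is hit at the same rate r d / a. Moment concentration and the local lemma show that up to
-- small errors a shrinks by the factor 1 − θ r d / a and d by the factor 1 − θ (1 + (r − 1) d / a), so the relative surplus
-- (a − d) / d grows by a factor about 1 + θ. It starts at D^(-α), hence reaches a constant while d is still a power of D close
-- to D itself, and once a ≥ 16 r d the local lemma finishes in one go.
module Submission where

-- The theorem speaks of real powers of `D`, but every estimate is made in ℚ. One integer `L`, about
-- `D` to the power `1 / Q`, serves as the unit of scale: codegrees are at most `D / L ^ j`, the
-- initial surplus is at least `D / (L + 1)`, a step activates a fraction `1 / L ^ 5` of the colours
-- and tolerates deviations of relative size `1 / L ^ 2`. Such errors are smaller than the surplus
-- by a factor of order `1 / L`, so the surplus absorbs them. The numbers of vertices and colours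
-- are not bounded in terms of `D`, so no union bound is possible. The local lemma asks only that
-- failure probabilities beat the dependency degree, which is a fixed power of `L`; hence moments of
-- one fixed order suffice and no exponential function occurs. The number of steps is never counted.
-- With `y = a - d`, the invariant `d ^ n * D ≤ ((1 + L) * y) ^ suc n` does all the bookkeeping:
-- since `d ≤ D` it keeps `y` above `d / (L + 1)`, and while `a` is at most `16 r d` it keeps `d`
-- above `D / L ^ (2 (n + 1))`. This is why all exponents can be fixed in advance.

module HypergraphNibble where

  open import Algebra.Bundles using (CommutativeRing)
  import Algebra.Properties.CommutativeSemiring.Exp as CommutativeSemiringExp
  import Algebra.Properties.Semiring.Exp as SemiringExp
  import Algebra.Properties.Semiring.Sum as SemiringSum
  open import Data.Bool using (Bool; true; false; _∧_; _∨_; not)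
  open import Data.Empty using (⊥; ⊥-elim)
  open import Data.Fin using (Fin; zero; suc; _↑ˡ_; _↑ʳ_; combine; remQuot; splitAt; join)
  open import Data.Fin.Properties using (remQuot-combine; combine-remQuot; splitAt-↑ˡ; splitAt-↑ʳ; join-splitAt) renaming (_≟_ to _≟ᶠ_)
  open import Data.Integer as ℤ using (-[1+_])
  import Data.Integer.Properties as ℤ
  open import Data.List as List using (List; []; _∷_; _++_; map; length; allFin; cartesianProduct)
  open import Data.List.Membership.Propositional using (_∈_)
  open import Data.List.Membership.Propositional.Properties using (∈-++⁺ˡ; ∈-++⁺ʳ; ∈-map⁺; ∈-allFin; ∈-cartesianProduct⁺)
  open import Data.List.Relation.Unary.Any using (here; there)
  open import Data.Maybe using (Maybe; just; nothing)
  open import Data.Nat as ℕ using (ℕ; zero; suc; z≤n; s≤s)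
  import Data.Nat.Properties as ℕ
  open import Data.Product using (Σ; ∃; _×_; _,_; proj₁; proj₂)
  open import Data.Rational using (ℚ; mkℚ; 0ℚ; 1ℚ; _+_; _*_; _-_; -_; _≤_; _<_; *<*; 1/_; _/_; NonNegative; nonNegative; positive; >-nonZero; ½; toℚᵘ; fromℚᵘ)
  open import Data.Rational.Properties
  open import Data.Rational.Unnormalised as ℚᵘ using (mkℚᵘ)
  import Data.Rational.Unnormalised.Properties as ℚᵘ
  open import Data.Sum using (_⊎_; inj₁; inj₂)
  open import Data.Vec using (Vec; []; _∷_; lookup; _[_]≔_)
  open import Data.Vec.Properties using (lookup∘update; lookup∘update′)
  open import Relation.Binary.PropositionalEquality
  open import Relation.Nullary using (¬_; Dec; yes; no; does)
  open import Tactic.RingSolver using (solve-∀)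
  open import Tactic.RingSolver.Core.AlmostCommutativeRing using (AlmostCommutativeRing; fromCommutativeRing)

  open SemiringSum (CommutativeRing.semiring +-*-commutativeRing) public
    using (∑-comm; ∑-distrib-+; *-distribˡ-sum) renaming (sum to ∑; sum-cong-≗ to ∑-cong)
  open SemiringExp (CommutativeRing.semiring +-*-commutativeRing) public using (_^_; ^-homo-*; ^-assocʳ)
  open CommutativeSemiringExp (CommutativeRing.commutativeSemiring +-*-commutativeRing) public using (^-distrib-*)

  ℚ-ring : AlmostCommutativeRing _ _
  ℚ-ring = fromCommutativeRing +-*-commutativeRing isZero?
    where
    isZero? : ∀ x → Maybe (0ℚ ≡ x)
    isZero? x with 0ℚ ≟ x
    ... | yes p = just p
    ... | no _  = nothing

  -- Ordered-field arithmetic in ℚ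

  2ℚ 3ℚ 4ℚ 5ℚ 6ℚ 7ℚ 8ℚ 9ℚ : ℚ
  2ℚ = ℤ.+ 2 / 1
  3ℚ = ℤ.+ 3 / 1
  4ℚ = ℤ.+ 4 / 1
  5ℚ = ℤ.+ 5 / 1
  6ℚ = ℤ.+ 6 / 1
  7ℚ = ℤ.+ 7 / 1
  8ℚ = ℤ.+ 8 / 1
  9ℚ = ℤ.+ 9 / 1

  0≤ : ∀ n → 0ℚ ≤ ℤ.+ n / 1
  0≤ n = nonNegative⁻¹ (ℤ.+ n / 1) {{normalize-nonNeg n 1}}

  +-nonneg : ∀ {p q} → 0ℚ ≤ p → 0ℚ ≤ q → 0ℚ ≤ p + q
  +-nonneg = +-mono-≤

  *-monoˡ : ∀ {r p q} → 0ℚ ≤ r → p ≤ q → r * p ≤ r * q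
  *-monoˡ {r} 0≤r = *-monoˡ-≤-nonNeg r {{nonNegative 0≤r}}

  *-monoʳ : ∀ {r p q} → 0ℚ ≤ r → p ≤ q → p * r ≤ q * r
  *-monoʳ {r} 0≤r = *-monoʳ-≤-nonNeg r {{nonNegative 0≤r}}

  *-nonneg : ∀ {p q} → 0ℚ ≤ p → 0ℚ ≤ q → 0ℚ ≤ p * q
  *-nonneg {p} {q} 0≤p 0≤q = subst (_≤ p * q) (*-zeroʳ p) (*-monoˡ 0≤p 0≤q)

  *-mono : ∀ {p p′ q q′} → 0ℚ ≤ p′ → 0ℚ ≤ q → p ≤ p′ → q ≤ q′ → p * q ≤ p′ * q′
  *-mono 0≤p′ 0≤q p≤p′ q≤q′ = ≤-trans (*-monoʳ 0≤q p≤p′) (*-monoˡ 0≤p′ q≤q′)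

  *-pos : ∀ {p q} → 0ℚ < p → 0ℚ < q → 0ℚ < p * q
  *-pos {p} {q} 0<p 0<q = subst (_< p * q) (*-zeroʳ p) (*-monoʳ-<-pos p {{positive 0<p}} 0<q)

  +-pos : ∀ {p q} → 0ℚ < p → 0ℚ ≤ q → 0ℚ < p + q
  +-pos = +-mono-<-≤

  *-cancelˡ-≤ : ∀ {r p q} → 0ℚ < r → r * p ≤ r * q → p ≤ q
  *-cancelˡ-≤ {r} 0<r = *-cancelˡ-≤-pos r {{positive 0<r}}

  *-cancelʳ-≤ : ∀ {r p q} → 0ℚ < r → p * r ≤ q * r → p ≤ q
  *-cancelʳ-≤ {r} 0<r = *-cancelʳ-≤-pos r {{positive 0<r}}

  p+[q-p]≡q : ∀ p q → q ≡ p + (q - p)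
  p+[q-p]≡q = solve-∀ ℚ-ring

  p≤q⇒0≤q-p : ∀ {p q} → p ≤ q → 0ℚ ≤ q - p
  p≤q⇒0≤q-p {p} {q} p≤q = subst (_≤ q - p) (+-inverseʳ p) (+-monoˡ-≤ (- p) p≤q)

  p<q⇒0<q-p : ∀ {p q} → p < q → 0ℚ < q - p
  p<q⇒0<q-p {p} {q} p<q = subst (_< q - p) (+-inverseʳ p) (+-monoˡ-< (- p) p<q)

  ≤-by : ∀ {p q} c → 0ℚ ≤ c → q ≡ p + c → p ≤ q
  ≤-by {p} c 0≤c refl = subst (_≤ p + c) (+-identityʳ p) (+-monoʳ-≤ p 0≤c)

  <-by : ∀ {p q} c → 0ℚ < c → q ≡ p + c → p < q
  <-by {p} c 0<c refl = subst (_< p + c) (+-identityʳ p) (+-monoʳ-< p 0<c)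

  0≤q-p⇒p≤q : ∀ {p q} → 0ℚ ≤ q - p → p ≤ q
  0≤q-p⇒p≤q {p} {q} h = ≤-by (q - p) h (p+[q-p]≡q p q)

  neg-sq : ∀ x → (- x) * (- x) ≡ x * x
  neg-sq = solve-∀ ℚ-ring

  sq-nonneg : ∀ x → 0ℚ ≤ x * x
  sq-nonneg x with ≤-total 0ℚ x
  ... | inj₁ 0≤x = *-nonneg 0≤x 0≤x
  ... | inj₂ x≤0 = subst (0ℚ ≤_) (neg-sq x) (*-nonneg (neg-antimono-≤ x≤0) (neg-antimono-≤ x≤0))

  0≤1 : 0ℚ ≤ 1ℚ
  0≤1 = 0≤ 1

  0<1 : 0ℚ < 1ℚ
  0<1 = positive⁻¹ 1ℚ

  ^-nonneg : ∀ {x} n → 0ℚ ≤ x → 0ℚ ≤ x ^ n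
  ^-nonneg zero    0≤x = 0≤1
  ^-nonneg (suc n) 0≤x = *-nonneg 0≤x (^-nonneg n 0≤x)

  ^-pos : ∀ {x} n → 0ℚ < x → 0ℚ < x ^ n
  ^-pos zero    0<x = 0<1
  ^-pos (suc n) 0<x = *-pos 0<x (^-pos n 0<x)

  ^-mono-≤ : ∀ {x y} n → 0ℚ ≤ x → x ≤ y → x ^ n ≤ y ^ n
  ^-mono-≤ zero    0≤x x≤y = ≤-refl
  ^-mono-≤ (suc n) 0≤x x≤y = *-mono (≤-trans 0≤x x≤y) (^-nonneg n 0≤x) x≤y (^-mono-≤ n 0≤x x≤y)

  ^-cancel-≤ : ∀ {x y} n → 0ℚ ≤ y → x ^ suc n ≤ y ^ suc n → x ≤ y
  ^-cancel-≤ {x} {y} n 0≤y xⁿ≤yⁿ with x ≤? y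
  ... | yes x≤y = x≤y
  ... | no x≰y  = ⊥-elim (<-irrefl refl (<-≤-trans (≤-<-trans yⁿ⁺¹≤yxⁿ yxⁿ<xⁿ⁺¹) xⁿ≤yⁿ))
    where
    y<x = ≰⇒> x≰y
    0<xⁿ = ^-pos n (≤-<-trans 0≤y y<x)
    yⁿ⁺¹≤yxⁿ : y ^ suc n ≤ y * x ^ n
    yⁿ⁺¹≤yxⁿ = *-monoˡ 0≤y (^-mono-≤ n 0≤y (<⇒≤ y<x))
    yxⁿ<xⁿ⁺¹ : y * x ^ n < x ^ suc n
    yxⁿ<xⁿ⁺¹ = *-monoˡ-<-pos (x ^ n) {{positive 0<xⁿ}} y<x

  1≤^ : ∀ {x} n → 1ℚ ≤ x → 1ℚ ≤ x ^ n
  1≤^ zero    1≤x = ≤-refl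
  1≤^ {x} (suc n) 1≤x = *-mono {1ℚ} {x} {1ℚ} (≤-trans 0≤1 1≤x) 0≤1 1≤x (1≤^ n 1≤x)

  -- Natural numbers as rationals

  ι : ℕ → ℚ
  ι zero    = 0ℚ
  ι (suc n) = 1ℚ + ι n

  ι-nonneg : ∀ n → 0ℚ ≤ ι n
  ι-nonneg zero    = ≤-refl
  ι-nonneg (suc n) = +-nonneg 0≤1 (ι-nonneg n)

  0<ι : ∀ n → 0ℚ < ι (suc n)
  0<ι n = +-pos 0<1 (ι-nonneg n)

  1≤ι : ∀ n → 1ℚ ≤ ι (suc n)
  1≤ι n = ≤-by (ι n) (ι-nonneg n) refl

  1≤ι-nonZero : ∀ n .{{_ : ℕ.NonZero n}} → 1ℚ ≤ ι n
  1≤ι-nonZero (suc n) = 1≤ι n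

  ι-+ : ∀ m n → ι (m ℕ.+ n) ≡ ι m + ι n
  ι-+ zero    n = sym (+-identityˡ (ι n))
  ι-+ (suc m) n = trans (cong (1ℚ +_) (ι-+ m n)) (sym (+-assoc 1ℚ (ι m) (ι n)))

  ι-* : ∀ m n → ι (m ℕ.* n) ≡ ι m * ι n
  ι-* zero    n = sym (*-zeroˡ (ι n))
  ι-* (suc m) n = trans (ι-+ n (m ℕ.* n)) (trans (cong (ι n +_) (ι-* m n)) (distrib (ι m) (ι n)))
    where
    distrib : ∀ x y → y + x * y ≡ (1ℚ + x) * y
    distrib = solve-∀ ℚ-ring

  ι-^ : ∀ m n → ι (m ℕ.^ n) ≡ ι m ^ n
  ι-^ m zero    = refl
  ι-^ m (suc n) = trans (ι-* m (m ℕ.^ n)) (cong (ι m *_) (ι-^ m n))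

  ι-mono : ∀ {m n} → m ℕ.≤ n → ι m ≤ ι n
  ι-mono {n = n} z≤n = ι-nonneg n
  ι-mono (s≤s m≤n)   = +-monoʳ-≤ 1ℚ (ι-mono m≤n)

  ι-cancel-≤ : ∀ {m n} → ι m ≤ ι n → m ℕ.≤ n
  ι-cancel-≤ {m} {n} h with m ℕ.≤? n
  ... | yes m≤n = m≤n
  ... | no m≰n  = ⊥-elim (<-irrefl refl (<-≤-trans (<-by 1ℚ 0<1 (+-comm 1ℚ (ι n))) (≤-trans (ι-mono (ℕ.≰⇒> m≰n)) h)))

  ι-cancel-< : ∀ {m n} → ι m < ι n → m ℕ.< n
  ι-cancel-< {m} {n} h with m ℕ.<? n
  ... | yes m<n = m<n
  ... | no m≮n  = ⊥-elim (<-irrefl refl (<-≤-trans h (ι-mono (ℕ.≮⇒≥ m≮n))))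

  ι≡/1 : ∀ n → ι n ≡ ℤ.+ n / 1
  ι≡/1 zero    = refl
  ι≡/1 (suc n) = trans (cong (λ q → 1ℚ + q) (ι≡/1 n)) (toℚᵘ-injective (begin-equality
    toℚᵘ (1ℚ + ℤ.+ n / 1)                         ≃⟨ toℚᵘ-homo-+ 1ℚ (ℤ.+ n / 1) ⟩
    toℚᵘ 1ℚ ℚᵘ.+ toℚᵘ (fromℚᵘ (mkℚᵘ (ℤ.+ n) 0))  ≃⟨ ℚᵘ.+-congʳ (toℚᵘ 1ℚ) (toℚᵘ-fromℚᵘ (mkℚᵘ (ℤ.+ n) 0)) ⟩
    mkℚᵘ (ℤ.+ 1) 0 ℚᵘ.+ mkℚᵘ (ℤ.+ n) 0              ≃⟨ ℚᵘ.*≡* (cong (λ k → (ℤ.+ 1 ℤ.+ k) ℤ.* ℤ.+ 1) (ℤ.*-identityʳ (ℤ.+ n))) ⟩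
    mkℚᵘ (ℤ.+ suc n) 0                            ≃⟨ ℚᵘ.≃-sym (toℚᵘ-fromℚᵘ (mkℚᵘ (ℤ.+ suc n) 0)) ⟩
    toℚᵘ (ℤ.+ suc n / 1)                          ∎))
    where open ℚᵘ.≤-Reasoning

  <ι-bound : ∀ q → ∃ λ n → q < ι n
  <ι-bound (mkℚ -[1+ m ] d c) = 1 , *<* ℤ.-<+
  <ι-bound q@(mkℚ (ℤ.+ m) d c)  = suc m , subst (q <_) (sym (ι≡/1 (suc m))) (toℚᵘ-cancel-< (ℚᵘ.<-respʳ-≃ (ℚᵘ.≃-sym (toℚᵘ-fromℚᵘ (mkℚᵘ (ℤ.+ suc m) 0))) (ℚᵘ.*<* (subst₂ ℤ._<_ (ℤ.pos-* m 1) (ℤ.pos-* (suc m) (suc d)) (ℤ.+<+ m*1<[1+m]*[1+d])))))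
    where
    m*1<[1+m]*[1+d] : m ℕ.* 1 ℕ.< suc m ℕ.* suc d
    m*1<[1+m]*[1+d] = ℕ.<-≤-trans (ℕ.≤-reflexive (cong suc (ℕ.*-identityʳ m))) (ℕ.m≤m*n (suc m) (suc d))

  floor : ∀ q → 0ℚ ≤ q → ∃ λ n → ι n ≤ q × q < ι (suc n)
  floor q 0≤q = search (proj₁ (<ι-bound q)) (proj₂ (<ι-bound q))
    where
    search : ∀ n → q < ι n → ∃ λ m → ι m ≤ q × q < ι (suc m)
    search zero    q<0 = ⊥-elim (<-irrefl refl (≤-<-trans 0≤q q<0))
    search (suc n) q<  with ι n ≤? q
    ... | yes n≤q = n , n≤q , q<
    ... | no n≰q  = search n (≰⇒> n≰q)

  inv : ∀ n .{{_ : ℕ.NonZero n}} → ℚ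
  inv (suc n) = (1/ ι (suc n)) {{>-nonZero (0<ι n)}}

  ι*inv : ∀ n .{{_ : ℕ.NonZero n}} → ι n * inv n ≡ 1ℚ
  ι*inv (suc n) = *-inverseʳ (ι (suc n)) {{>-nonZero (0<ι n)}}

  0<inv : ∀ n .{{_ : ℕ.NonZero n}} → 0ℚ < inv n
  0<inv (suc n) = positive⁻¹ (inv (suc n)) {{1/pos⇒pos (ι (suc n)) {{positive (0<ι n)}}}}

  -- Finite sums and Boolean indicators

  ∑-mono : ∀ {n} {f g : Fin n → ℚ} → (∀ i → f i ≤ g i) → ∑ f ≤ ∑ g
  ∑-mono {zero}  h = ≤-refl
  ∑-mono {suc n} h = +-mono-≤ (h zero) (∑-mono (λ i → h (suc i)))

  ∑-nonneg : ∀ {n} {f : Fin n → ℚ} → (∀ i → 0ℚ ≤ f i) → 0ℚ ≤ ∑ f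
  ∑-nonneg {zero}  h = ≤-refl
  ∑-nonneg {suc n} h = +-nonneg (h zero) (∑-nonneg (λ i → h (suc i)))

  ∑-zero : ∀ {n} {f : Fin n → ℚ} → (∀ i → f i ≡ 0ℚ) → ∑ f ≡ 0ℚ
  ∑-zero {zero}  h = refl
  ∑-zero {suc n} h = cong₂ _+_ (h zero) (∑-zero (λ i → h (suc i)))

  ∑-const : ∀ n c → ∑ {n} (λ _ → c) ≡ ι n * c
  ∑-const zero    c = sym (*-zeroˡ c)
  ∑-const (suc n) c = trans (cong (c +_) (∑-const n c)) (distrib (ι n) c)
    where
    distrib : ∀ x y → y + x * y ≡ (1ℚ + x) * y
    distrib = solve-∀ ℚ-ring

  *-∑ : ∀ {n} c (f : Fin n → ℚ) → c * ∑ f ≡ ∑ (λ i → c * f i)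
  *-∑ = *-distribˡ-sum

  ∑-* : ∀ {n} (f : Fin n → ℚ) c → ∑ f * c ≡ ∑ (λ i → f i * c)
  ∑-* f c = trans (*-comm (∑ f) c) (trans (*-∑ c f) (∑-cong (λ i → *-comm c (f i))))

  ∑-- : ∀ {n} (f g : Fin n → ℚ) → ∑ (λ i → f i - g i) ≡ ∑ f - ∑ g
  ∑-- {zero}  f g = refl
  ∑-- {suc n} f g = trans (cong ((f zero - g zero) +_) (∑-- (λ i → f (suc i)) (λ i → g (suc i)))) (swap (f zero) (g zero) (∑ (λ i → f (suc i))) (∑ (λ i → g (suc i))))
    where
    swap : ∀ a b c d → (a - b) + (c - d) ≡ (a + c) - (b + d)
    swap = solve-∀ ℚ-ring

  term≤∑ : ∀ {n} {f : Fin n → ℚ} → (∀ i → 0ℚ ≤ f i) → ∀ i → f i ≤ ∑ f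
  term≤∑ {suc n} {f} h zero    = ≤-by (∑ (λ i → f (suc i))) (∑-nonneg (λ i → h (suc i))) refl
  term≤∑ {suc n} {f} h (suc i) = ≤-trans (term≤∑ (λ i → h (suc i)) i) (≤-by (f zero) (h zero) (+-comm (f zero) _))

  ∑-witness : ∀ {n} (f : Fin n → ℚ) → 0ℚ < ∑ f → ∃ λ i → 0ℚ < f i
  ∑-witness {zero}  f h = ⊥-elim (<-irrefl refl h)
  ∑-witness {suc n} f h with 0ℚ <? f zero
  ... | yes 0<f₀ = zero , 0<f₀
  ... | no 0≮f₀ with ∑-witness (λ i → f (suc i)) (<-≤-trans h (≤-trans (+-monoˡ-≤ _ (≮⇒≥ 0≮f₀)) (≤-reflexive (+-identityˡ _))))
  ...   | i , 0<fᵢ = suc i , 0<fᵢ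

  false≢true : false ≢ true
  false≢true ()

  ⟦_⟧ : Bool → ℚ
  ⟦ true ⟧  = 1ℚ
  ⟦ false ⟧ = 0ℚ

  ⟦⟧-nonneg : ∀ b → 0ℚ ≤ ⟦ b ⟧
  ⟦⟧-nonneg true  = 0≤1
  ⟦⟧-nonneg false = ≤-refl

  ⟦⟧≤1 : ∀ b → ⟦ b ⟧ ≤ 1ℚ
  ⟦⟧≤1 true  = ≤-refl
  ⟦⟧≤1 false = 0≤1

  ⟦∧⟧ : ∀ a b → ⟦ a ∧ b ⟧ ≡ ⟦ a ⟧ * ⟦ b ⟧
  ⟦∧⟧ true  b = sym (*-identityˡ ⟦ b ⟧)
  ⟦∧⟧ false b = sym (*-zeroˡ ⟦ b ⟧)

  ⟦not⟧ : ∀ a → ⟦ not a ⟧ ≡ 1ℚ - ⟦ a ⟧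
  ⟦not⟧ true  = refl
  ⟦not⟧ false = refl

  ⟦⟧-mono : ∀ {a b} → (a ≡ true → b ≡ true) → ⟦ a ⟧ ≤ ⟦ b ⟧
  ⟦⟧-mono {true}  {b} h rewrite h refl = ≤-refl
  ⟦⟧-mono {false} {b} h = ⟦⟧-nonneg b

  any : ∀ {n} → (Fin n → Bool) → Bool
  any {zero}  p = false
  any {suc n} p = p zero ∨ any (λ i → p (suc i))

  any-intro : ∀ {n} (p : Fin n → Bool) i → p i ≡ true → any p ≡ true
  any-intro p zero    h rewrite h = refl
  any-intro p (suc i) h with p zero
  ... | true  = refl
  ... | false = any-intro (λ i → p (suc i)) i h

  any-elim : ∀ {n} (p : Fin n → Bool) → any p ≡ true → ∃ λ i → p i ≡ true
  any-elim {suc n} p h with p zero in eq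
  ... | true  = zero , eq
  ... | false with any-elim (λ i → p (suc i)) h
  ...   | i , pᵢ = suc i , pᵢ

  any-false : ∀ {n} (p : Fin n → Bool) → any p ≡ false → ∀ i → p i ≡ false
  any-false p h i with p i in eq
  ... | false = refl
  ... | true with trans (sym h) (any-intro p i eq)
  ...   | ()

  ⟦any⟧≤∑ : ∀ {n} (p : Fin n → Bool) → ⟦ any p ⟧ ≤ ∑ (λ i → ⟦ p i ⟧)
  ⟦any⟧≤∑ p with any p in eq
  ... | false = ∑-nonneg (λ i → ⟦⟧-nonneg (p i))
  ... | true with any-elim p eq
  ...   | i , pᵢ = subst (_≤ ∑ (λ i → ⟦ p i ⟧)) (cong ⟦_⟧ pᵢ) (term≤∑ (λ i → ⟦⟧-nonneg (p i)) i)

  ∧-true : ∀ {a b} → a ∧ b ≡ true → a ≡ true × b ≡ true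
  ∧-true {true} h = refl , h

  _==_ : ∀ {n} → Fin n → Fin n → Bool
  zero  == zero  = true
  zero  == suc j = false
  suc i == zero  = false
  suc i == suc j = i == j

  ==-refl : ∀ {n} (i : Fin n) → (i == i) ≡ true
  ==-refl zero    = refl
  ==-refl (suc i) = ==-refl i

  ==⇒≡ : ∀ {n} (i j : Fin n) → (i == j) ≡ true → i ≡ j
  ==⇒≡ zero    zero    h = refl
  ==⇒≡ (suc i) (suc j) h = cong suc (==⇒≡ i j h)

  ==-comm : ∀ {n} (i j : Fin n) → (i == j) ≡ (j == i)
  ==-comm zero    zero    = refl
  ==-comm zero    (suc j) = refl
  ==-comm (suc i) zero    = refl
  ==-comm (suc i) (suc j) = ==-comm i j

  ∑-select : ∀ {n} (j : Fin n) (f : Fin n → ℚ) → ∑ (λ i → ⟦ i == j ⟧ * f i) ≡ f j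
  ∑-select zero f = trans (cong₂ _+_ (*-identityˡ (f zero)) (∑-zero (λ i → *-zeroˡ (f (suc i))))) (+-identityʳ (f zero))
  ∑-select (suc j) f = trans (cong₂ _+_ (*-zeroˡ (f zero)) (∑-select j (λ i → f (suc i)))) (+-identityˡ (f (suc j)))

  ∑-select′ : ∀ {n} (j : Fin n) (f : Fin n → ℚ) → ∑ (λ i → ⟦ j == i ⟧ * f i) ≡ f j
  ∑-select′ j f = trans (∑-cong (λ i → cong (λ b → ⟦ b ⟧ * f i) (==-comm j i))) (∑-select j f)

  -- Expectation over finite product spaces

  module Expectation (s : ℕ) .{{_ : ℕ.NonZero s}} where

    avg : (Fin s → ℚ) → ℚ
    avg f = inv s * ∑ f

    0≤inv : 0ℚ ≤ inv s
    0≤inv = <⇒≤ (0<inv s)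

    avg-cong : ∀ {f g} → (∀ x → f x ≡ g x) → avg f ≡ avg g
    avg-cong h = cong (inv s *_) (∑-cong h)

    avg-mono : ∀ {f g} → (∀ x → f x ≤ g x) → avg f ≤ avg g
    avg-mono h = *-monoˡ 0≤inv (∑-mono h)

    avg-const : ∀ c → avg (λ _ → c) ≡ c
    avg-const c = trans (cong (inv s *_) (∑-const s c)) (trans (sym (*-assoc (inv s) (ι s) c))
      (trans (cong (_* c) (trans (*-comm (inv s) (ι s)) (ι*inv s))) (*-identityˡ c)))

    avg-nonneg : ∀ {f} → (∀ x → 0ℚ ≤ f x) → 0ℚ ≤ avg f
    avg-nonneg h = *-nonneg 0≤inv (∑-nonneg h)

    avg-+ : ∀ f g → avg (λ x → f x + g x) ≡ avg f + avg g
    avg-+ f g = trans (cong (inv s *_) (∑-distrib-+ f g)) (*-distribˡ-+ (inv s) (∑ f) (∑ g))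

    avg-* : ∀ c f → avg (λ x → c * f x) ≡ c * avg f
    avg-* c f = trans (cong (inv s *_) (sym (*-∑ c f))) (swap (inv s) c (∑ f))
      where
      swap : ∀ i c t → i * (c * t) ≡ c * (i * t)
      swap = solve-∀ ℚ-ring

    avg-∑ : ∀ {n} (f : Fin n → Fin s → ℚ) → avg (λ x → ∑ (λ i → f i x)) ≡ ∑ (λ i → avg (f i))
    avg-∑ f = trans (cong (inv s *_) (∑-comm (λ x i → f i x))) (*-∑ (inv s) (λ i → ∑ (f i)))

    Ω : ℕ → Set
    Ω N = Vec (Fin s) N

    -- Coordinates are averaged out one at a time, so that conditioning on the head coordinate is
    -- definitional. The inductions on `N` below are all of this kind.
    𝔼 : ∀ {N} → (Ω N → ℚ) → ℚ
    𝔼 {zero}  f = f []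
    𝔼 {suc N} f = avg (λ x → 𝔼 (λ ω → f (x ∷ ω)))

    𝔼-cong : ∀ {N} {f g : Ω N → ℚ} → (∀ ω → f ω ≡ g ω) → 𝔼 f ≡ 𝔼 g
    𝔼-cong {zero}  h = h []
    𝔼-cong {suc N} h = avg-cong (λ x → 𝔼-cong (λ ω → h (x ∷ ω)))

    𝔼-mono : ∀ {N} {f g : Ω N → ℚ} → (∀ ω → f ω ≤ g ω) → 𝔼 f ≤ 𝔼 g
    𝔼-mono {zero}  h = h []
    𝔼-mono {suc N} h = avg-mono (λ x → 𝔼-mono (λ ω → h (x ∷ ω)))

    𝔼-const : ∀ N c → 𝔼 {N} (λ _ → c) ≡ c
    𝔼-const zero    c = refl
    𝔼-const (suc N) c = trans (avg-cong (λ _ → 𝔼-const N c)) (avg-const c)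

    𝔼-nonneg : ∀ {N} {f : Ω N → ℚ} → (∀ ω → 0ℚ ≤ f ω) → 0ℚ ≤ 𝔼 f
    𝔼-nonneg {zero}  h = h []
    𝔼-nonneg {suc N} h = avg-nonneg (λ x → 𝔼-nonneg (λ ω → h (x ∷ ω)))

    𝔼-+ : ∀ {N} (f g : Ω N → ℚ) → 𝔼 (λ ω → f ω + g ω) ≡ 𝔼 f + 𝔼 g
    𝔼-+ {zero}  f g = refl
    𝔼-+ {suc N} f g = trans (avg-cong (λ x → 𝔼-+ (λ ω → f (x ∷ ω)) (λ ω → g (x ∷ ω)))) (avg-+ _ _)

    𝔼-* : ∀ {N} c (f : Ω N → ℚ) → 𝔼 (λ ω → c * f ω) ≡ c * 𝔼 f
    𝔼-* {zero}  c f = refl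
    𝔼-* {suc N} c f = trans (avg-cong (λ x → 𝔼-* c (λ ω → f (x ∷ ω)))) (avg-* c _)

    𝔼-- : ∀ {N} (f g : Ω N → ℚ) → 𝔼 (λ ω → f ω - g ω) ≡ 𝔼 f - 𝔼 g
    𝔼-- f g = trans (𝔼-cong (λ ω → minus (f ω) (g ω))) (trans (𝔼-+ f (λ ω → (- 1ℚ) * g ω))
      (trans (cong (𝔼 f +_) (𝔼-* (- 1ℚ) g)) (sym (minus (𝔼 f) (𝔼 g)))))
      where
      minus : ∀ a b → a - b ≡ a + (- 1ℚ) * b
      minus = solve-∀ ℚ-ring

    𝔼-∑ : ∀ {N n} (f : Fin n → Ω N → ℚ) → 𝔼 (λ ω → ∑ (λ i → f i ω)) ≡ ∑ (λ i → 𝔼 (f i))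
    𝔼-∑ {zero}  f = refl
    𝔼-∑ {suc N} f = trans (avg-cong (λ x → 𝔼-∑ (λ i ω → f i (x ∷ ω)))) (avg-∑ (λ i x → 𝔼 (λ ω → f i (x ∷ ω))))

    𝔼-coordinate : ∀ {N} (j : Fin N) (h : Fin s → ℚ) → 𝔼 (λ ω → h (lookup ω j)) ≡ avg h
    𝔼-coordinate {suc N} zero h = avg-cong (λ x → 𝔼-const N (h x))
    𝔼-coordinate (suc j) h = trans (avg-cong (λ _ → 𝔼-coordinate j h)) (avg-const (avg h))

    𝔼-witness : ∀ {N} (f : Ω N → ℚ) → 0ℚ < 𝔼 f → ∃ λ ω → 0ℚ < f ω
    𝔼-witness {zero}  f h = [] , h
    𝔼-witness {suc N} f h with ∑-witness _ (*-cancelˡ-<-nonNeg (inv s) {{nonNegInv}} (subst (_< avg g) (sym (*-zeroʳ (inv s))) h))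
      where
      g : Fin s → ℚ
      g x = 𝔼 (λ ω → f (x ∷ ω))
      nonNegInv : NonNegative (inv s)
      nonNegInv = nonNegative 0≤inv
    ... | x , hₓ with 𝔼-witness (λ ω → f (x ∷ ω)) hₓ
    ...   | ω , h′ = x ∷ ω , h′

    DependsOn : ∀ {N} → (Ω N → ℚ) → (Fin N → Bool) → Set
    DependsOn f V = ∀ ω ω′ → (∀ j → V j ≡ true → lookup ω j ≡ lookup ω′ j) → f ω ≡ f ω′

    private
      tail-depends : ∀ {N} {f : Ω (suc N) → ℚ} {V} x → DependsOn f V → DependsOn (λ ω → f (x ∷ ω)) (λ j → V (suc j))
      tail-depends x dep ω ω′ h = dep (x ∷ ω) (x ∷ ω′) λ where
        zero    _ → refl
        (suc j) v → h j v

      head-irrelevant : ∀ {N} {f : Ω (suc N) → ℚ} {V} → DependsOn f V → V zero ≡ false → ∀ x x′ ω → f (x ∷ ω) ≡ f (x′ ∷ ω)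
      head-irrelevant dep V₀ x x′ ω = dep (x ∷ ω) (x′ ∷ ω) λ where
        zero    v → ⊥-elim (false≢true (trans (sym V₀) v))
        (suc j) _ → refl

    -- The head coordinate lies outside `V` or outside `W`. Conditioned on it, one of the two
    -- factors is therefore constant and can be pulled out of the average; the tails factor by
    -- induction.
    𝔼-independent : ∀ {N} (f g : Ω N → ℚ) {V W} → DependsOn f V → DependsOn g W →
                    (∀ j → V j ≡ true → W j ≡ false) → 𝔼 (λ ω → f ω * g ω) ≡ 𝔼 f * 𝔼 g
    𝔼-independent {zero}  f g _ _ _ = refl
    𝔼-independent {suc N} f g {V} {W} df dg disj = trans (avg-cong λ x →
        𝔼-independent (λ ω → f (x ∷ ω)) (λ ω → g (x ∷ ω)) (tail-depends x df) (tail-depends x dg) (λ j → disj (suc j)))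
        (split (V zero) refl)
      where
      F G : Fin s → ℚ
      F x = 𝔼 (λ ω → f (x ∷ ω))
      G x = 𝔼 (λ ω → g (x ∷ ω))
      constant : (h : Fin s → ℚ) → (∀ x x′ → h x ≡ h x′) → ∀ x → h x ≡ avg h
      constant h eq x = sym (trans (avg-cong (λ x′ → eq x′ x)) (avg-const (h x)))
      split : ∀ b → V zero ≡ b → avg (λ x → F x * G x) ≡ avg F * avg G
      split true  eq = trans (avg-cong λ x → trans (cong (F x *_) (constant G (λ x x′ → 𝔼-cong (head-irrelevant dg (disj zero eq) x x′)) x)) (*-comm (F x) (avg G)))
        (trans (avg-* (avg G) F) (*-comm (avg G) (avg F)))
      split false eq = trans (avg-cong λ x → cong (_* G x) (constant F (λ x x′ → 𝔼-cong (head-irrelevant df eq x x′)) x))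
        (avg-* (avg F) G)

  -- Moment concentration for functions of independent coordinates

  private
    scale-≤ : ∀ {n K} w Q → n ℕ.≤ K → 0ℚ ≤ Q → ι K * w ≤ Q → ι n * w ≤ Q
    scale-≤ {n} {K} w Q n≤K 0≤Q h with ≤-total 0ℚ w
    ... | inj₁ 0≤w = ≤-trans (*-monoʳ 0≤w (ι-mono n≤K)) h
    ... | inj₂ w≤0 = ≤-trans (subst (ι n * w ≤_) (*-zeroʳ (ι n)) (*-monoˡ (ι-nonneg n) w≤0)) 0≤Q

    neg-scale : ∀ K w → - (K * w) ≡ K * (- w)
    neg-scale = solve-∀ ℚ-ring

  -- The second-order bound (1 + u)ⁿ ≤ 1 + nu + n²u² for |nu| ≤ 1, homogenised with u = w / Q.
  pow-second-order : ∀ K n Q w → n ℕ.≤ K → 0ℚ ≤ Q → ι K * w ≤ Q → - (ι K * w) ≤ Q →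
                     (Q + w) ^ n * (Q * Q) ≤ Q ^ n * (Q * Q + ι n * w * Q + ι n * ι n * (w * w))
  pow-second-order K zero Q w _ _ _ _ = ≤-reflexive (base Q w)
    where
    base : ∀ Q w → 1ℚ * (Q * Q) ≡ 1ℚ * (Q * Q + 0ℚ * w * Q + 0ℚ * 0ℚ * (w * w))
    base = solve-∀ ℚ-ring
  pow-second-order K (suc n) Q w n<K 0≤Q h h′ = ≤-trans (≤-reflexive (*-assoc (Q + w) ((Q + w) ^ n) (Q * Q)))
    (≤-trans (*-monoˡ 0≤Q+w (pow-second-order K n Q w n≤K 0≤Q h h′))
      (≤-by _ (*-nonneg (^-nonneg n 0≤Q) (*-nonneg (sq-nonneg w) rest)) (gap Q w (Q ^ n) (ι n))))
    where
    n≤K = ℕ.≤-trans (ℕ.n≤1+n n) n<K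
    0≤Q+w : 0ℚ ≤ Q + w
    0≤Q+w = subst (0ℚ ≤_) (one Q w) (p≤q⇒0≤q-p (scale-≤ {1} (- w) Q (ℕ.≤-trans (ℕ.s≤s ℕ.z≤n) n<K) 0≤Q (subst (_≤ Q) (neg-scale (ι K) w) h′)))
      where
      one : ∀ Q w → Q - (1ℚ + 0ℚ) * (- w) ≡ Q + w
      one = solve-∀ ℚ-ring
    rest : 0ℚ ≤ ι n * (Q - ι n * w) + Q
    rest = +-nonneg (*-nonneg (ι-nonneg n) (p≤q⇒0≤q-p (scale-≤ w Q n≤K 0≤Q h))) 0≤Q
    gap : ∀ Q w q n → (Q * q) * (Q * Q + (1ℚ + n) * w * Q + (1ℚ + n) * (1ℚ + n) * (w * w))
          ≡ (Q + w) * (q * (Q * Q + n * w * Q + n * n * (w * w))) + q * (w * w * (n * (Q - n * w) + Q))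
    gap = solve-∀ ℚ-ring

  sq-≤-sq : ∀ {x c} → x ≤ c → - x ≤ c → x * x ≤ c * c
  sq-≤-sq {x} {c} h h′ = ≤-by _ (*-nonneg (p≤q⇒0≤q-p h) (p≤q⇒0≤q-p h′)) (eq x c)
    where
    eq : ∀ x c → c * c ≡ x * x + (c - x) * (c - (- x))
    eq = solve-∀ ℚ-ring

  module Concentration (s : ℕ) .{{_ : ℕ.NonZero s}} where
    open Expectation s

    -- One martingale increment. With `Q = z * z + A`, the base changes by `w = 2 z δ + δ²`;
    -- expanded to second order, the part linear in `δ` averages to zero and only multiples of `δ²`
    -- remain. The offset `A` keeps the relative change of `Q` small even where `z` is near zero.
    moment-step : ∀ k (δ : Fin s → ℚ) z A β v → avg δ ≡ 0ℚ → (∀ x → δ x ≤ β) → (∀ x → - δ x ≤ β) →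
                  avg (λ x → δ x * δ x) ≤ v → 0ℚ < A → 2ℚ * (ι (suc k) * ι (suc k)) * (β * β) ≤ A →
                  avg (λ x → ((z + δ x) * (z + δ x) + A) ^ suc k) ≤ (z * z + A + 9ℚ * (ι (suc k) * ι (suc k)) * v) ^ suc k
    moment-step k δ z A β v mean≡0 δ≤β -δ≤β var≤v 0<A βbound =
      ≤-trans (*-cancelʳ-≤ (*-pos 0<Q 0<Q) averaged) final
      where
      κ = ι (suc k)
      Q = z * z + A
      1≤κ = 1≤ι k
      0≤κ = ι-nonneg (suc k)
      0<Q : 0ℚ < Q
      0<Q = subst (0ℚ <_) (+-comm A (z * z)) (+-pos 0<A (sq-nonneg z))
      0≤Q = <⇒≤ 0<Q
      0≤v : 0ℚ ≤ v
      0≤v = ≤-trans (avg-nonneg (λ x → sq-nonneg (δ x))) var≤v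
      w : Fin s → ℚ
      w x = 2ℚ * z * δ x + δ x * δ x
      δ²≤β² : ∀ x → δ x * δ x ≤ β * β
      δ²≤β² x = sq-≤-sq (δ≤β x) (-δ≤β x)
      κ≤κ² : κ ≤ κ * κ
      κ≤κ² = subst (_≤ κ * κ) (*-identityˡ κ) (*-monoʳ 0≤κ 1≤κ)
      2κ²δ²≤A : ∀ x → 2ℚ * (κ * κ) * (δ x * δ x) ≤ A
      2κ²δ²≤A x = ≤-trans (*-monoˡ (*-nonneg (0≤ 2) (sq-nonneg κ)) (δ²≤β² x)) βbound
      -- The cross term `2 κ z δ` is absorbed by completing a square, and `A ≥ 2 κ² β²` pays for the
      -- remaining `δ²`.
      κw≤Q : ∀ x → κ * w x ≤ Q
      κw≤Q x = ≤-by _ (+-nonneg (+-nonneg (sq-nonneg (z - κ * δ x)) (p≤q⇒0≤q-p (2κ²δ²≤A x))) (*-nonneg (p≤q⇒0≤q-p κ≤κ²) (sq-nonneg (δ x)))) (eq z A κ (δ x))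
        where
        eq : ∀ z A κ d → z * z + A ≡ κ * (2ℚ * z * d + d * d) + ((z - κ * d) * (z - κ * d) + (A - 2ℚ * (κ * κ) * (d * d)) + (κ * κ - κ) * (d * d))
        eq = solve-∀ ℚ-ring
      -κw≤Q : ∀ x → - (κ * w x) ≤ Q
      -κw≤Q x = ≤-by _ (+-nonneg (+-nonneg (sq-nonneg (z + κ * δ x)) (p≤q⇒0≤q-p (2κ²δ²≤A x))) (*-nonneg (+-nonneg (sq-nonneg κ) 0≤κ) (sq-nonneg (δ x)))) (eq z A κ (δ x))
        where
        eq : ∀ z A κ d → z * z + A ≡ - (κ * (2ℚ * z * d + d * d)) + ((z + κ * d) * (z + κ * d) + (A - 2ℚ * (κ * κ) * (d * d)) + (κ * κ + κ) * (d * d))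
        eq = solve-∀ ℚ-ring
      w²≤ : ∀ x → w x * w x ≤ 8ℚ * Q * (δ x * δ x)
      w²≤ x = ≤-by _ (*-nonneg (sq-nonneg (δ x)) (+-nonneg (+-nonneg (sq-nonneg (2ℚ * z - δ x))
          (*-nonneg (0≤ 2) (p≤q⇒0≤q-p (≤-trans (≤-by _ (*-nonneg (+-nonneg (*-nonneg (0≤ 2) (p≤q⇒0≤q-p 1≤κ²)) 0≤1) (sq-nonneg (δ x))) (eq′ (κ * κ) (δ x))) (2κ²δ²≤A x)))))
          (*-nonneg (0≤ 6) (<⇒≤ 0<A)))) (eq z A (δ x))
        where
        1≤κ² = ≤-trans 1≤κ κ≤κ²
        eq′ : ∀ K d → 2ℚ * K * (d * d) ≡ d * d + (2ℚ * (K - 1ℚ) + 1ℚ) * (d * d)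
        eq′ = solve-∀ ℚ-ring
        eq : ∀ z A d → 8ℚ * (z * z + A) * (d * d) ≡ (2ℚ * z * d + d * d) * (2ℚ * z * d + d * d) + (d * d) * ((2ℚ * z - d) * (2ℚ * z - d) + 2ℚ * (A - d * d) + 6ℚ * A)
        eq = solve-∀ ℚ-ring
      pointwise : ∀ x → (Q * Q) * ((z + δ x) * (z + δ x) + A) ^ suc k
                      ≤ Q ^ suc k * (Q * Q) + (Q ^ suc k * (2ℚ * κ * z * Q) * δ x + Q ^ suc k * (κ * Q + 8ℚ * (κ * κ) * Q) * (δ x * δ x))
      pointwise x = ≤-trans (≤-reflexive (trans (*-comm (Q * Q) _) (cong (λ q → q ^ suc k * (Q * Q)) (shift z A (δ x)))))
        (≤-trans (pow-second-order (suc k) (suc k) Q (w x) ℕ.≤-refl 0≤Q (κw≤Q x) (-κw≤Q x))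
        (≤-trans (*-monoˡ (^-nonneg (suc k) 0≤Q) (+-monoʳ-≤ (Q * Q + κ * w x * Q) (*-monoˡ (sq-nonneg κ) (w²≤ x))))
          (≤-reflexive (collect (Q ^ suc k) Q κ z (δ x)))))
        where
        shift : ∀ z A d → (z + d) * (z + d) + A ≡ (z * z + A) + (2ℚ * z * d + d * d)
        shift = solve-∀ ℚ-ring
        collect : ∀ q Q κ z d → q * (Q * Q + κ * (2ℚ * z * d + d * d) * Q + κ * κ * (8ℚ * Q * (d * d)))
                  ≡ q * (Q * Q) + (q * (2ℚ * κ * z * Q) * d + q * (κ * Q + 8ℚ * (κ * κ) * Q) * (d * d))
        collect = solve-∀ ℚ-ring
      -- The coefficient of `δ²` is `κ` from the first-order term and `8 κ²` from `w² ≤ 8 Q δ²`;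
      -- since `κ ≤ κ²` this is at most `9 κ²`.
      averaged : avg (λ x → ((z + δ x) * (z + δ x) + A) ^ suc k) * (Q * Q) ≤ Q ^ k * (Q + 9ℚ * (κ * κ) * v) * (Q * Q)
      averaged = ≤-trans (≤-reflexive (trans (*-comm _ (Q * Q)) (sym (avg-* (Q * Q) _)))) (≤-trans (avg-mono pointwise)
        (≤-trans (≤-reflexive (trans (avg-+ (λ _ → c₀) (λ x → c₁ * δ x + c₂ * (δ x * δ x))) (cong₂ _+_ (avg-const c₀) (trans (avg-+ (λ x → c₁ * δ x) (λ x → c₂ * (δ x * δ x))) (cong₂ _+_ (trans (avg-* c₁ δ) (trans (cong (c₁ *_) mean≡0) (*-zeroʳ c₁))) (avg-* c₂ (λ x → δ x * δ x)))))))
        (≤-trans (+-monoʳ-≤ c₀ (+-monoʳ-≤ 0ℚ (*-monoˡ 0≤c₂ var≤v)))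
          (≤-by _ (*-nonneg (*-nonneg (^-nonneg (suc k) 0≤Q) 0≤Q) (*-nonneg (p≤q⇒0≤q-p κ≤κ²) 0≤v)) (eq (Q ^ k) Q κ v)))))
        where
        c₀ = Q ^ suc k * (Q * Q)
        c₁ = Q ^ suc k * (2ℚ * κ * z * Q)
        c₂ = Q ^ suc k * (κ * Q + 8ℚ * (κ * κ) * Q)
        0≤c₂ : 0ℚ ≤ c₂
        0≤c₂ = *-nonneg (^-nonneg (suc k) 0≤Q) (+-nonneg (*-nonneg 0≤κ 0≤Q) (*-nonneg (*-nonneg (0≤ 8) (sq-nonneg κ)) 0≤Q))
        eq : ∀ q Q κ v → q * (Q + 9ℚ * (κ * κ) * v) * (Q * Q)
             ≡ (Q * q * (Q * Q) + (0ℚ + Q * q * (κ * Q + 8ℚ * (κ * κ) * Q) * v)) + Q * q * Q * ((κ * κ - κ) * v)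
        eq = solve-∀ ℚ-ring
      final : Q ^ k * (Q + 9ℚ * (κ * κ) * v) ≤ (Q + 9ℚ * (κ * κ) * v) ^ suc k
      final = ≤-trans (*-monoʳ (+-nonneg 0≤Q 0≤cv) (^-mono-≤ k 0≤Q (≤-by _ 0≤cv refl))) (≤-reflexive (*-comm _ (Q + 9ℚ * (κ * κ) * v)))
        where
        0≤cv = *-nonneg (*-nonneg (0≤ 9) (sq-nonneg κ)) 0≤v

    -- The price is attached to the value taken and not just to the coordinate. A coordinate that is
    -- rarely active thus costs only its mean `avg (y j)`, although its largest price may be `B`; a
    -- bounded-difference condition would charge `B` every time.
    Lipschitz : ∀ {N} → (Ω N → ℚ) → (Fin N → Fin s → ℚ) → Set
    Lipschitz f y = ∀ ω j x x′ → f (ω [ j ]≔ x) - f (ω [ j ]≔ x′) ≤ y j x + y j x′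

    -- The parameter `z` is the deviation exposed so far. Exposing one more coordinate shifts it by
    -- a mean-zero increment, and the induction hypothesis for the remaining coordinates merely
    -- enlarges `A`. Increments are at most `2 B` with variance at most `4 B m`, so the constants 2
    -- and 9 of `moment-step` become 8 and 36.
    moment-bound : ∀ k {N} (f : Ω N → ℚ) y B z A → Lipschitz f y → (∀ j x → 0ℚ ≤ y j x) → (∀ j x → y j x ≤ B) →
                   0ℚ < A → 8ℚ * (ι (suc k) * ι (suc k)) * (B * B) ≤ A →
                   𝔼 (λ ω → ((z + (f ω - 𝔼 f)) * (z + (f ω - 𝔼 f)) + A) ^ suc k)
                   ≤ (z * z + A + ℤ.+ 36 / 1 * (ι (suc k) * ι (suc k)) * B * ∑ (λ j → avg (y j))) ^ suc k
    moment-bound k {zero} f y B z A _ _ _ _ _ = ≤-reflexive (cong (_^ suc k) (eq z (f []) A (ι (suc k)) B))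
      where
      eq : ∀ z f A κ B → (z + (f - f)) * (z + (f - f)) + A ≡ z * z + A + ℤ.+ 36 / 1 * (κ * κ) * B * 0ℚ
      eq = solve-∀ ℚ-ring
    moment-bound k {suc N} f y B z A lip 0≤y y≤B 0<A Abound =
      ≤-trans (avg-mono λ x → ≤-trans (≤-reflexive (𝔼-cong λ ω → cong (λ q → (q * q + A) ^ suc k) (recentre z (f (x ∷ ω)) (𝔼 f) (g x))))
          (≤-trans (moment-bound k (λ ω → f (x ∷ ω)) (λ j → y (suc j)) B (z + δ x) A (λ ω j → lip (x ∷ ω) (suc j)) (λ j → 0≤y (suc j)) (λ j → y≤B (suc j)) 0<A Abound)
            (≤-reflexive (cong (_^ suc k) (+-assoc ((z + δ x) * (z + δ x)) A V)))))
        (≤-trans (moment-step k δ z (A + V) (2ℚ * B) (4ℚ * B * m) mean≡0 δ≤2B -δ≤2B var (+-pos 0<A 0≤V) βbound)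
          (≤-reflexive (cong (_^ suc k) (collect z A κ B (∑ (λ j → avg (y (suc j)))) m))))
      where
      κ = ι (suc k)
      V = ℤ.+ 36 / 1 * (κ * κ) * B * ∑ (λ j → avg (y (suc j)))
      g δ : Fin s → ℚ
      g x = 𝔼 (λ ω → f (x ∷ ω))
      δ x = g x - 𝔼 f
      m = avg (y zero)
      0≤m : 0ℚ ≤ m
      0≤m = avg-nonneg (0≤y zero)
      m≤B : m ≤ B
      m≤B = ≤-trans (avg-mono (y≤B zero)) (≤-reflexive (avg-const B))
      0≤B = ≤-trans 0≤m m≤B
      0≤V : 0ℚ ≤ V
      0≤V = *-nonneg (*-nonneg (*-nonneg (0≤ 36) (sq-nonneg κ)) 0≤B) (∑-nonneg (λ j → avg-nonneg (0≤y (suc j))))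
      recentre : ∀ z f e g → z + (f - e) ≡ (z + (g - e)) + (f - g)
      recentre = solve-∀ ℚ-ring
      collect : ∀ z A κ B S m → z * z + (A + ℤ.+ 36 / 1 * (κ * κ) * B * S) + 9ℚ * (κ * κ) * (4ℚ * B * m) ≡ z * z + A + ℤ.+ 36 / 1 * (κ * κ) * B * (m + S)
      collect = solve-∀ ℚ-ring
      g-diff : ∀ x x′ → g x - g x′ ≤ y zero x + y zero x′
      g-diff x x′ = ≤-trans (≤-reflexive (sym (𝔼-- (λ ω → f (x ∷ ω)) (λ ω → f (x′ ∷ ω))))) (≤-trans (𝔼-mono (λ ω → lip (x ∷ ω) zero x x′)) (≤-reflexive (𝔼-const N _)))
      mean≡0 : avg δ ≡ 0ℚ
      mean≡0 = trans (avg-+ g (λ _ → - 𝔼 f)) (trans (cong (𝔼 f +_) (avg-const (- 𝔼 f))) (+-inverseʳ (𝔼 f)))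
      δ≤ : ∀ x → δ x ≤ y zero x + m
      δ≤ x = ≤-trans (≤-reflexive (sym (trans (avg-+ (λ _ → g x) (λ x′ → - g x′)) (cong₂ _+_ (avg-const (g x)) (trans (avg-cong (λ x′ → neg (g x′))) (trans (avg-* (- 1ℚ) g) (sym (neg (𝔼 f)))))))))
        (≤-trans (avg-mono (g-diff x)) (≤-reflexive (trans (avg-+ (λ _ → y zero x) (y zero)) (cong (_+ m) (avg-const (y zero x))))))
        where
        neg : ∀ a → - a ≡ (- 1ℚ) * a
        neg = solve-∀ ℚ-ring
      -δ≤ : ∀ x → - δ x ≤ y zero x + m
      -δ≤ x = ≤-trans (≤-reflexive (sym (trans (avg-+ g (λ _ → - g x)) (trans (cong (𝔼 f +_) (avg-const (- g x))) (swap (𝔼 f) (g x))))))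
        (≤-trans (avg-mono (λ x′ → g-diff x′ x)) (≤-reflexive (trans (avg-+ (y zero) (λ _ → y zero x)) (trans (cong (m +_) (avg-const (y zero x))) (+-comm m (y zero x))))))
        where
        swap : ∀ a b → a + - b ≡ - (b - a)
        swap = solve-∀ ℚ-ring
      y+m≤2B : ∀ x → y zero x + m ≤ 2ℚ * B
      y+m≤2B x = ≤-trans (+-mono-≤ (y≤B zero x) m≤B) (≤-reflexive (double B))
        where
        double : ∀ b → b + b ≡ 2ℚ * b
        double = solve-∀ ℚ-ring
      δ≤2B : ∀ x → δ x ≤ 2ℚ * B
      δ≤2B x = ≤-trans (δ≤ x) (y+m≤2B x)
      -δ≤2B : ∀ x → - δ x ≤ 2ℚ * B
      -δ≤2B x = ≤-trans (-δ≤ x) (y+m≤2B x)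
      -- In the square of `y + m` one factor is bounded by a multiple of `B` and the other is
      -- averaged, so the variance is linear in the mean price.
      var : avg (λ x → δ x * δ x) ≤ 4ℚ * B * m
      var = ≤-trans (avg-mono λ x → ≤-trans (sq-≤-sq (δ≤ x) (-δ≤ x)) (≤-by _ (+-nonneg (*-nonneg (0≤y zero x) (p≤q⇒0≤q-p (y≤B zero x))) (*-nonneg (*-nonneg (0≤ 2) (0≤y zero x)) (p≤q⇒0≤q-p m≤B))) (eq (y zero x) m B)))
        (≤-trans (≤-reflexive (trans (avg-+ (λ _ → m * m) (λ x → 3ℚ * B * y zero x)) (cong₂ _+_ (avg-const (m * m)) (avg-* (3ℚ * B) (y zero)))))
          (≤-by _ (*-nonneg 0≤m (p≤q⇒0≤q-p m≤B)) (eq′ m B)))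
        where
        eq : ∀ y m B → m * m + 3ℚ * B * y ≡ (y + m) * (y + m) + (y * (B - y) + 2ℚ * y * (B - m))
        eq = solve-∀ ℚ-ring
        eq′ : ∀ m B → 4ℚ * B * m ≡ (m * m + 3ℚ * B * m) + m * (B - m)
        eq′ = solve-∀ ℚ-ring
      βbound : 2ℚ * (κ * κ) * (2ℚ * B * (2ℚ * B)) ≤ A + V
      βbound = ≤-trans (≤-reflexive (eq κ B)) (≤-trans Abound (≤-by V 0≤V refl))
        where
        eq : ∀ κ B → 2ℚ * (κ * κ) * (2ℚ * B * (2ℚ * B)) ≡ 8ℚ * (κ * κ) * (B * B)
        eq = solve-∀ ℚ-ring

    deviates : ∀ {N} → (Ω N → ℚ) → ℚ → Ω N → Bool
    deviates f t ω = does (t * t ≤? (f ω - 𝔼 f) * (f ω - 𝔼 f))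

    -- Markov's inequality for a power of the squared deviation plus `A`. The smallest admissible
    -- `A = 8 κ² B²` is at most `8 κ² B μ`; together with the 36 of the moment bound this gives 44.
    tail-bound : ∀ k {N} (f : Ω N → ℚ) y B μ t L → Lipschitz f y → (∀ j x → 0ℚ ≤ y j x) → (∀ j x → y j x ≤ B) →
                 0ℚ < B → B ≤ μ → ∑ (λ j → avg (y j)) ≤ μ → 0ℚ < t → 0ℚ ≤ L →
                 ℤ.+ 44 / 1 * (ι (suc k) * ι (suc k)) * B * μ * L ≤ t * t →
                 𝔼 (λ ω → ⟦ deviates f t ω ⟧) * L ^ suc k ≤ 1ℚ
    tail-bound k f y B μ t L lip 0≤y y≤B 0<B B≤μ Σ≤μ 0<t 0≤L Lbound = *-cancelˡ-≤ (^-pos (suc k) 0<t²) (begin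
      (t * t) ^ suc k * (P * L ^ suc k)    ≡⟨ *-assoc ((t * t) ^ suc k) P (L ^ suc k) ⟨
      (t * t) ^ suc k * P * L ^ suc k      ≤⟨ *-monoʳ (^-nonneg (suc k) 0≤L) markov ⟩
      M ^ suc k * L ^ suc k                ≡⟨ ^-distrib-* M L (suc k) ⟨
      (M * L) ^ suc k                      ≤⟨ ^-mono-≤ (suc k) (*-nonneg 0≤M 0≤L) Lbound ⟩
      (t * t) ^ suc k                      ≡⟨ *-identityʳ _ ⟨
      (t * t) ^ suc k * 1ℚ                 ∎)
      where
      open ≤-Reasoning
      κ = ι (suc k)
      P = 𝔼 (λ ω → ⟦ deviates f t ω ⟧)
      M = ℤ.+ 44 / 1 * (κ * κ) * B * μ
      A = 8ℚ * (κ * κ) * (B * B)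
      0<t² = *-pos 0<t 0<t
      0≤B = <⇒≤ 0<B
      0≤μ = ≤-trans 0≤B B≤μ
      0<A : 0ℚ < A
      0<A = *-pos (*-pos (positive⁻¹ 8ℚ) (*-pos (0<ι k) (0<ι k))) (*-pos 0<B 0<B)
      0≤M : 0ℚ ≤ M
      0≤M = *-nonneg (*-nonneg (*-nonneg (0≤ 44) (sq-nonneg κ)) 0≤B) 0≤μ
      X : _ → ℚ
      X ω = f ω - 𝔼 f
      pointwise : ∀ ω → (t * t) ^ suc k * ⟦ deviates f t ω ⟧ ≤ ((0ℚ + X ω) * (0ℚ + X ω) + A) ^ suc k
      pointwise ω = by-cases (t * t ≤? X ω * X ω)
        where
        by-cases : (d : Dec (t * t ≤ X ω * X ω)) → (t * t) ^ suc k * ⟦ does d ⟧ ≤ ((0ℚ + X ω) * (0ℚ + X ω) + A) ^ suc k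
        by-cases (yes t²≤X²) = ≤-trans (≤-reflexive (*-identityʳ ((t * t) ^ suc k))) (^-mono-≤ (suc k) (<⇒≤ 0<t²) (≤-trans t²≤X² (≤-by A (<⇒≤ 0<A) (cong (λ q → q * q + A) (+-identityˡ (X ω))))))
        by-cases (no _) = ≤-trans (≤-reflexive (*-zeroʳ ((t * t) ^ suc k))) (^-nonneg (suc k) (+-nonneg (sq-nonneg (0ℚ + X ω)) (<⇒≤ 0<A)))
      markov : (t * t) ^ suc k * P ≤ M ^ suc k
      markov = begin
        (t * t) ^ suc k * P                                       ≡⟨ 𝔼-* ((t * t) ^ suc k) (λ ω → ⟦ deviates f t ω ⟧) ⟨
        𝔼 (λ ω → (t * t) ^ suc k * ⟦ deviates f t ω ⟧)            ≤⟨ 𝔼-mono pointwise ⟩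
        𝔼 (λ ω → ((0ℚ + X ω) * (0ℚ + X ω) + A) ^ suc k)           ≤⟨ moment-bound k f y B 0ℚ A lip 0≤y y≤B 0<A ≤-refl ⟩
        (0ℚ * 0ℚ + A + c * ∑ (λ j → avg (y j))) ^ suc k           ≤⟨ ^-mono-≤ (suc k) 0≤base base≤M ⟩
        M ^ suc k                                                 ∎
        where
        c = ℤ.+ 36 / 1 * (κ * κ) * B
        0≤c = *-nonneg (*-nonneg (0≤ 36) (sq-nonneg κ)) 0≤B
        0≤base : 0ℚ ≤ 0ℚ * 0ℚ + A + c * ∑ (λ j → avg (y j))
        0≤base = +-nonneg (+-nonneg (sq-nonneg 0ℚ) (<⇒≤ 0<A)) (*-nonneg 0≤c (∑-nonneg (λ j → avg-nonneg (0≤y j))))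
        base≤M : 0ℚ * 0ℚ + A + c * ∑ (λ j → avg (y j)) ≤ M
        base≤M = ≤-trans (+-monoʳ-≤ (0ℚ * 0ℚ + A) (*-monoˡ 0≤c Σ≤μ)) (≤-by _ (*-nonneg (*-nonneg (*-nonneg (0≤ 8) (sq-nonneg κ)) 0≤B) (p≤q⇒0≤q-p B≤μ)) (eq κ B μ))
          where
          eq : ∀ κ B μ → ℤ.+ 44 / 1 * (κ * κ) * B * μ ≡ (0ℚ * 0ℚ + 8ℚ * (κ * κ) * (B * B) + ℤ.+ 36 / 1 * (κ * κ) * B * μ) + 8ℚ * (κ * κ) * B * (μ - B)
          eq = solve-∀ ℚ-ring

  -- The Lovász local lemma

  ∑ˡ : ∀ {I : Set} → List I → (I → ℚ) → ℚ
  ∑ˡ []       f = 0ℚ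
  ∑ˡ (i ∷ is) f = f i + ∑ˡ is f

  ∑ˡ-mono : ∀ {I : Set} (is : List I) {f g : I → ℚ} → (∀ i → f i ≤ g i) → ∑ˡ is f ≤ ∑ˡ is g
  ∑ˡ-mono []       h = ≤-refl
  ∑ˡ-mono (i ∷ is) h = +-mono-≤ (h i) (∑ˡ-mono is h)

  ∑ˡ-cong : ∀ {I : Set} (is : List I) {f g : I → ℚ} → (∀ i → f i ≡ g i) → ∑ˡ is f ≡ ∑ˡ is g
  ∑ˡ-cong []       h = refl
  ∑ˡ-cong (i ∷ is) h = cong₂ _+_ (h i) (∑ˡ-cong is h)

  ∑ˡ-nonneg : ∀ {I : Set} (is : List I) {f : I → ℚ} → (∀ i → 0ℚ ≤ f i) → 0ℚ ≤ ∑ˡ is f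
  ∑ˡ-nonneg []       h = ≤-refl
  ∑ˡ-nonneg (i ∷ is) h = +-nonneg (h i) (∑ˡ-nonneg is h)

  ∑ˡ-* : ∀ {I : Set} (is : List I) c (f : I → ℚ) → ∑ˡ is (λ i → c * f i) ≡ c * ∑ˡ is f
  ∑ˡ-* []       c f = sym (*-zeroʳ c)
  ∑ˡ-* (i ∷ is) c f = trans (cong (c * f i +_) (∑ˡ-* is c f)) (sym (*-distribˡ-+ c (f i) (∑ˡ is f)))

  ∑ˡ-∑-comm : ∀ {I : Set} {n} (is : List I) (f : I → Fin n → ℚ) → ∑ˡ is (λ i → ∑ (f i)) ≡ ∑ (λ j → ∑ˡ is (λ i → f i j))
  ∑ˡ-∑-comm {n = n} [] f = sym (∑-zero {n} (λ _ → refl))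
  ∑ˡ-∑-comm (i ∷ is) f = trans (cong (∑ (f i) +_) (∑ˡ-∑-comm is f)) (sym (∑-distrib-+ (f i) (λ j → ∑ˡ is (λ i → f i j))))

  module LocalLemma (s : ℕ) .{{_ : ℕ.NonZero s}} {N : ℕ} {I : Set}
                    (bad : I → Vec (Fin s) N → Bool) (V : I → Fin N → Bool) where
    open Expectation s

    neighbour : I → I → Bool
    neighbour i i′ = any (λ j → V i j ∧ V i′ j)

    degree : I → List I → ℚ
    degree i S = ∑ˡ S (λ i′ → ⟦ neighbour i i′ ⟧)

    avoid : List I → Ω N → Bool
    avoid []      ω = true
    avoid (i ∷ S) ω = not (bad i ω) ∧ avoid S ω

    𝔸 : List I → ℚ
    𝔸 S = 𝔼 (λ ω → ⟦ avoid S ω ⟧)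

    private
      far : I → List I → List I
      far b [] = []
      far b (i ∷ S) with neighbour b i
      ... | true  = far b S
      ... | false = i ∷ far b S

      degree-far : ∀ i b S → degree i (far b S) ≤ degree i S
      degree-far i b [] = ≤-refl
      degree-far i b (i′ ∷ S) with neighbour b i′
      ... | false = +-monoʳ-≤ ⟦ neighbour i i′ ⟧ (degree-far i b S)
      ... | true  = ≤-trans (degree-far i b S) (≤-by ⟦ neighbour i i′ ⟧ (⟦⟧-nonneg (neighbour i i′)) (+-comm ⟦ neighbour i i′ ⟧ _))

      length-far : ∀ b S → length (far b S) ℕ.≤ length S
      length-far b [] = ℕ.z≤n
      length-far b (i ∷ S) with neighbour b i
      ... | true  = ℕ.m≤n⇒m≤1+n (length-far b S)
      ... | false = ℕ.s≤s (length-far b S)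

      far-full : ∀ b S → ¬ (length (far b S) ℕ.< length S) → far b S ≡ S
      far-full b [] h = refl
      far-full b (i ∷ S) h with neighbour b i
      ... | true  = ⊥-elim (h (ℕ.s≤s (length-far b S)))
      ... | false = cong (i ∷_) (far-full b S (λ lt → h (ℕ.s≤s lt)))

      avoid-far : ∀ b S ω → avoid S ω ≡ true → avoid (far b S) ω ≡ true
      avoid-far b [] ω h = refl
      avoid-far b (i ∷ S) ω h with neighbour b i | ∧-true {not (bad i ω)} h
      ... | true  | _ , hS = avoid-far b S ω hS
      ... | false | hi , hS = cong₂ _∧_ hi (avoid-far b S ω hS)

      avoid-cover : ∀ b S ω → avoid (far b S) ω ≡ true → 1ℚ ≤ ⟦ avoid S ω ⟧ + ∑ˡ S (λ i → ⟦ neighbour b i ⟧ * ⟦ bad i ω ⟧)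
      avoid-cover b [] ω h = ≤-refl
      avoid-cover b (i ∷ S) ω h with neighbour b i
      ... | false with bad i ω
      ...   | false = ≤-trans (avoid-cover b S ω h) (≤-reflexive (shift ⟦ avoid S ω ⟧ (∑ˡ S _)))
        where
        shift : ∀ a x → a + x ≡ a + (0ℚ * 0ℚ + x)
        shift = solve-∀ ℚ-ring
      avoid-cover b (i ∷ S) ω h | true with bad i ω
      ... | true  = ≤-by _ (+-nonneg ≤-refl (∑ˡ-nonneg S (λ i → *-nonneg (⟦⟧-nonneg (neighbour b i)) (⟦⟧-nonneg (bad i ω))))) (shift (∑ˡ S _))
        where
        shift : ∀ x → 0ℚ + (1ℚ * 1ℚ + x) ≡ 1ℚ + (0ℚ + x)
        shift = solve-∀ ℚ-ring
      ... | false = ≤-trans (avoid-cover b S ω h) (≤-reflexive (shift ⟦ avoid S ω ⟧ (∑ˡ S _)))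
        where
        shift : ∀ a x → a + x ≡ a + (1ℚ * 0ℚ + x)
        shift = solve-∀ ℚ-ring

      𝔸-nonneg : ∀ S → 0ℚ ≤ 𝔸 S
      𝔸-nonneg S = 𝔼-nonneg (λ ω → ⟦⟧-nonneg (avoid S ω))

      𝔼-∑ˡ : ∀ (S : List I) (f : I → Ω N → ℚ) → 𝔼 (λ ω → ∑ˡ S (λ i → f i ω)) ≡ ∑ˡ S (λ i → 𝔼 (f i))
      𝔼-∑ˡ []      f = 𝔼-const N 0ℚ
      𝔼-∑ˡ (i ∷ S) f = trans (𝔼-+ (f i) (λ ω → ∑ˡ S (λ i → f i ω))) (cong (𝔼 (f i) +_) (𝔼-∑ˡ S f))

    module _ (dep : ∀ i → DependsOn (λ ω → ⟦ bad i ω ⟧) (V i)) (P Δ : ℚ) (0<Δ : 0ℚ < Δ) (4Δ≤P : 4ℚ * Δ ≤ P)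
             (bad≤ : ∀ i → P * 𝔼 (λ ω → ⟦ bad i ω ⟧) ≤ 1ℚ) where
      private
        0<P : 0ℚ < P
        0<P = <-≤-trans (*-pos (positive⁻¹ 4ℚ) 0<Δ) 4Δ≤P

        far-depends : ∀ b S → DependsOn (λ ω → ⟦ avoid (far b S) ω ⟧) (λ j → not (V b j))
        far-depends b [] ω ω′ h = refl
        far-depends b (i ∷ S) with neighbour b i in eq
        ... | true  = far-depends b S
        ... | false = λ ω ω′ h → trans (⟦∧⟧ (not (bad i ω)) _) (trans (cong₂ _*_
                (trans (⟦not⟧ (bad i ω)) (trans (cong (λ q → 1ℚ - q) (dep i ω ω′ (λ j v → h j (disjoint j v)))) (sym (⟦not⟧ (bad i ω′)))))
                (far-depends b S ω ω′ h)) (sym (⟦∧⟧ (not (bad i ω′)) _)))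
          where
          disjoint : ∀ j → V i j ≡ true → not (V b j) ≡ true
          disjoint j v with V b j | any-false (λ j → V b j ∧ V i j) eq j
          ... | false | _ = refl
          ... | true  | f = ⊥-elim (false≢true (trans (sym f) v))

        -- The probability of a bad event given that `S` is avoided is at most `2 / P`,
        -- cross-multiplied so that no avoidance probability is a denominator. Removing the
        -- neighbours of `b` from `S` leaves `U`, which is independent of `b`. By induction each
        -- neighbour has conditional probability at most `2 / P` given `U`, so avoiding the at most
        -- `Δ` of them as well costs at most the fraction `2 Δ / P ≤ 1 / 2`; hence `𝔸 U ≤ 2 𝔸 S`.
        conditional : ∀ n S → length S ℕ.≤ n → (∀ i → degree i S ≤ Δ) →
                      ∀ b → P * 𝔼 (λ ω → ⟦ bad b ω ⟧ * ⟦ avoid S ω ⟧) ≤ 2ℚ * 𝔸 S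
        conditional n S len deg b = ≤-trans (*-monoˡ (<⇒≤ 0<P) (𝔼-mono λ ω → *-monoˡ (⟦⟧-nonneg (bad b ω)) (⟦⟧-mono (avoid-far b S ω))))
          (≤-trans (≤-reflexive (trans (cong (P *_) (𝔼-independent _ _ (dep b) (far-depends b S) (λ j v → cong not v))) (sym (*-assoc P _ (𝔸 U)))))
          (≤-trans (*-monoʳ (𝔸-nonneg U) (bad≤ b)) (≤-trans (≤-reflexive (*-identityˡ (𝔸 U))) U≤2S)))
          where
          U = far b S
          U≤2S : 𝔸 U ≤ 2ℚ * 𝔸 S
          U≤2S with length U ℕ.<? length S
          ... | no ¬lt = subst (λ T → 𝔸 T ≤ 2ℚ * 𝔸 S) (sym (far-full b S ¬lt)) (≤-by (𝔸 S) (𝔸-nonneg S) (double (𝔸 S)))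
            where
            double : ∀ x → 2ℚ * x ≡ x + x
            double = solve-∀ ℚ-ring
          ... | yes lt = *-cancelˡ-≤ 0<P (≤-trans (≤-by _ (+-nonneg (*-nonneg (0≤ 2) (p≤q⇒0≤q-p expanded)) (*-nonneg (p≤q⇒0≤q-p 4Δ≤P) (𝔸-nonneg U))) (eq P (𝔸 U) (𝔸 S) Δ)) ≤-refl)
            where
            m<n : ∀ n → length S ℕ.≤ n → ∃ λ m → n ≡ suc m × length U ℕ.≤ m
            m<n zero    h = ⊥-elim (ℕ.n≮0 (ℕ.<-≤-trans lt h))
            m<n (suc m) h = m , refl , ℕ.≤-pred (ℕ.<-≤-trans lt h)
            -- Recursion is on the bound `n` for the length. The recursive call is handed over as a
            -- function of the predecessor, so that it is structural although `n` is only later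
            -- known to be a successor.
            IH : ∀ n → length S ℕ.≤ n → (∀ m → n ≡ suc m → length U ℕ.≤ m → ∀ i → P * 𝔼 (λ ω → ⟦ bad i ω ⟧ * ⟦ avoid U ω ⟧) ≤ 2ℚ * 𝔸 U) → ∀ i → P * 𝔼 (λ ω → ⟦ bad i ω ⟧ * ⟦ avoid U ω ⟧) ≤ 2ℚ * 𝔸 U
            IH n h ih with m<n n h
            ... | m , eq , h′ = ih m eq h′
            term≤ : ∀ i → P * 𝔼 (λ ω → ⟦ bad i ω ⟧ * ⟦ avoid U ω ⟧) ≤ 2ℚ * 𝔸 U
            term≤ = IH n len (λ { m refl h′ → conditional m U h′ (λ i → ≤-trans (degree-far i b S) (deg i)) })
            pointwise : ∀ ω → ⟦ avoid U ω ⟧ ≤ ⟦ avoid S ω ⟧ + ∑ˡ S (λ i → ⟦ neighbour b i ⟧ * (⟦ bad i ω ⟧ * ⟦ avoid U ω ⟧))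
            pointwise ω with avoid U ω in eq
            ... | true  = subst (λ q → 1ℚ ≤ ⟦ avoid S ω ⟧ + q) (∑ˡ-cong S (λ i → cong (⟦ neighbour b i ⟧ *_) (sym (*-identityʳ ⟦ bad i ω ⟧)))) (avoid-cover b S ω eq)
            ... | false = +-nonneg (⟦⟧-nonneg (avoid S ω)) (∑ˡ-nonneg S (λ i → *-nonneg (⟦⟧-nonneg (neighbour b i)) (*-nonneg (⟦⟧-nonneg (bad i ω)) (≤-refl {0ℚ}))))
            E : I → ℚ
            E i = 𝔼 (λ ω → ⟦ bad i ω ⟧ * ⟦ avoid U ω ⟧)
            expanded : P * 𝔸 U ≤ P * 𝔸 S + Δ * (2ℚ * 𝔸 U)
            expanded = begin
              P * 𝔸 U
                ≤⟨ *-monoˡ (<⇒≤ 0<P) (𝔼-mono pointwise) ⟩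
              P * 𝔼 (λ ω → ⟦ avoid S ω ⟧ + ∑ˡ S (λ i → ⟦ neighbour b i ⟧ * (⟦ bad i ω ⟧ * ⟦ avoid U ω ⟧)))
                ≡⟨ cong (P *_) (trans (𝔼-+ (λ ω → ⟦ avoid S ω ⟧) (λ ω → ∑ˡ S (λ i → ⟦ neighbour b i ⟧ * (⟦ bad i ω ⟧ * ⟦ avoid U ω ⟧)))) (cong (𝔸 S +_) (𝔼-∑ˡ S (λ i ω → ⟦ neighbour b i ⟧ * (⟦ bad i ω ⟧ * ⟦ avoid U ω ⟧))))) ⟩
              P * (𝔸 S + ∑ˡ S (λ i → 𝔼 (λ ω → ⟦ neighbour b i ⟧ * (⟦ bad i ω ⟧ * ⟦ avoid U ω ⟧))))
                ≡⟨ trans (*-distribˡ-+ P (𝔸 S) _) (cong (P * 𝔸 S +_) (sym (∑ˡ-* S P _))) ⟩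
              P * 𝔸 S + ∑ˡ S (λ i → P * 𝔼 (λ ω → ⟦ neighbour b i ⟧ * (⟦ bad i ω ⟧ * ⟦ avoid U ω ⟧)))
                ≤⟨ +-monoʳ-≤ (P * 𝔸 S) (∑ˡ-mono S (λ i → ≤-trans (≤-reflexive (trans (cong (P *_) (𝔼-* ⟦ neighbour b i ⟧ (λ ω → ⟦ bad i ω ⟧ * ⟦ avoid U ω ⟧))) (swap P ⟦ neighbour b i ⟧ (E i))))
                     (≤-trans (*-monoˡ (⟦⟧-nonneg (neighbour b i)) (term≤ i)) (≤-reflexive (*-comm ⟦ neighbour b i ⟧ (2ℚ * 𝔸 U)))))) ⟩
              P * 𝔸 S + ∑ˡ S (λ i → 2ℚ * 𝔸 U * ⟦ neighbour b i ⟧)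
                ≡⟨ cong (P * 𝔸 S +_) (trans (∑ˡ-* S (2ℚ * 𝔸 U) _) (*-comm (2ℚ * 𝔸 U) _)) ⟩
              P * 𝔸 S + degree b S * (2ℚ * 𝔸 U)
                ≤⟨ +-monoʳ-≤ (P * 𝔸 S) (*-monoʳ (*-nonneg (0≤ 2) (𝔸-nonneg U)) (deg b)) ⟩
              P * 𝔸 S + Δ * (2ℚ * 𝔸 U) ∎
              where
              open ≤-Reasoning
              swap : ∀ p q r → p * (q * r) ≡ q * (p * r)
              swap = solve-∀ ℚ-ring
            eq : ∀ P U S Δ → P * (2ℚ * S) ≡ P * U + (2ℚ * ((P * S + Δ * (2ℚ * U)) - P * U) + (P - 4ℚ * Δ) * U)
            eq = solve-∀ ℚ-ring

        -- Each further event removes at most the fraction `2 / P` of the remaining probability, and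
        -- `P ≥ 4 Δ ≥ 4`.
        avoid-positive : 1ℚ ≤ Δ → ∀ S → (∀ i → degree i S ≤ Δ) → 0ℚ < 𝔸 S
        avoid-positive 1≤Δ []      deg = subst (0ℚ <_) (sym (𝔼-const N 1ℚ)) 0<1
        avoid-positive 1≤Δ (i ∷ S) deg = *-cancelˡ-<-nonNeg P {{nonNegP}} (subst (_< P * 𝔸 (i ∷ S)) (sym (*-zeroʳ P))
            (<-≤-trans (*-pos 0<P-2 (avoid-positive 1≤Δ S degS)) (≤-by _ (p≤q⇒0≤q-p (conditional (length S) S ℕ.≤-refl degS i)) (trans (cong (P *_) 𝔸-cons) (eq P (𝔸 S) _)))))
          where
          nonNegP : NonNegative P
          nonNegP = nonNegative (<⇒≤ 0<P)
          degS : ∀ i → degree i S ≤ Δ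
          degS i′ = ≤-trans (≤-by _ (⟦⟧-nonneg (neighbour i′ i)) (+-comm ⟦ neighbour i′ i ⟧ _)) (deg i′)
          0<P-2 : 0ℚ < P - 2ℚ
          0<P-2 = p<q⇒0<q-p {2ℚ} (<-≤-trans (<-by {2ℚ} {4ℚ} 2ℚ (positive⁻¹ 2ℚ) refl) (≤-trans (*-monoˡ (0≤ 4) 1≤Δ) 4Δ≤P))
          𝔸-cons : 𝔸 (i ∷ S) ≡ 𝔸 S - 𝔼 (λ ω → ⟦ bad i ω ⟧ * ⟦ avoid S ω ⟧)
          𝔸-cons = trans (𝔼-cong (λ ω → trans (⟦∧⟧ (not (bad i ω)) _) (trans (cong (_* ⟦ avoid S ω ⟧) (⟦not⟧ (bad i ω))) (minus ⟦ bad i ω ⟧ ⟦ avoid S ω ⟧)))) (𝔼-- (λ ω → ⟦ avoid S ω ⟧) (λ ω → ⟦ bad i ω ⟧ * ⟦ avoid S ω ⟧))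
            where
            minus : ∀ b a → (1ℚ - b) * a ≡ a - b * a
            minus = solve-∀ ℚ-ring
          eq : ∀ P S E → P * (S - E) ≡ (P - 2ℚ) * S + (2ℚ * S - P * E)
          eq = solve-∀ ℚ-ring

      local-lemma : 1ℚ ≤ Δ → (all : List I) → (∀ i → degree i all ≤ Δ) → ∃ λ ω → ∀ i → i ∈ all → bad i ω ≡ false
      local-lemma 1≤Δ all deg with 𝔼-witness _ (avoid-positive 1≤Δ all deg)
      ... | ω , h = ω , avoid-elim all (positive-true (avoid all ω) h)
        where
        positive-true : ∀ b → 0ℚ < ⟦ b ⟧ → b ≡ true
        positive-true true  _ = refl
        positive-true false h = ⊥-elim (<-irrefl refl h)
        avoid-elim : ∀ S → avoid S ω ≡ true → ∀ i → i ∈ S → bad i ω ≡ false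
        avoid-elim (i ∷ S) h .i (here refl) with bad i ω
        ... | false = refl
        avoid-elim (i ∷ S) h i′ (there i′∈) = avoid-elim S (proj₂ (∧-true {not (bad i ω)} h)) i′ i′∈

  -- Concentration of many statistics at once, by the local lemma

  module SimultaneousConcentration (s : ℕ) .{{_ : ℕ.NonZero s}} where
    open Expectation s
    open Concentration s

    -- One point is turned into the other by changing one coordinate at a time.
    coordinatewise⇒depends : ∀ {N} (f : Ω N → ℚ) (V : Fin N → Bool) →
      (∀ j → V j ≡ false → ∀ ω x x′ → f (ω [ j ]≔ x) ≡ f (ω [ j ]≔ x′)) → DependsOn f V
    coordinatewise⇒depends f V h []      []        agree = refl
    coordinatewise⇒depends f V h (x ∷ ω) (x′ ∷ ω′) agree =
      trans (coordinatewise⇒depends (λ ω → f (x ∷ ω)) (λ j → V (suc j)) (λ j v ω → h (suc j) v (x ∷ ω)) ω ω′ (λ j → agree (suc j)))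
            (head (V zero) refl)
      where
      head : ∀ b → V zero ≡ b → f (x ∷ ω′) ≡ f (x′ ∷ ω′)
      head true  v = cong (λ z → f (z ∷ ω′)) (agree zero v)
      head false v = h zero v (x ∷ ω′) x x′

    support : ∀ {N} → (Fin N → Fin s → ℚ) → Fin N → Bool
    support y j = does (0ℚ <? ∑ (y j))

    depends-on-support : ∀ {N} (f : Ω N → ℚ) y → Lipschitz f y → (∀ j x → 0ℚ ≤ y j x) → DependsOn f (support y)
    depends-on-support f y lip 0≤y = coordinatewise⇒depends f (support y) λ j v ω x x′ →
        ≤-antisym (bound j ω x x′ (0ℚ <? ∑ (y j)) v) (bound j ω x′ x (0ℚ <? ∑ (y j)) v)
      where
      bound : ∀ j ω x x′ (d : Dec (0ℚ < ∑ (y j))) → does d ≡ false → f (ω [ j ]≔ x) ≤ f (ω [ j ]≔ x′)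
      bound j ω x x′ (no ∑≯0) _ = 0≤q-p⇒p≤q (subst (0ℚ ≤_) (flip (f (ω [ j ]≔ x)) (f (ω [ j ]≔ x′)))
          (neg-antimono-≤ (≤-trans (lip ω j x x′) (+-mono-≤ (y≤0 x) (y≤0 x′)))))
        where
        y≤0 : ∀ x → y j x ≤ 0ℚ
        y≤0 x = ≤-trans (term≤∑ (0≤y j) x) (≮⇒≥ ∑≯0)
        flip : ∀ a b → - (a - b) ≡ b - a
        flip = solve-∀ ℚ-ring

    -- Prices will be natural numbers, so a positive price is at least 1. This lets sums of prices
    -- count dependencies.
    support≤∑ : ∀ {N} (y : Fin N → Fin s → ℚ) j → (∀ x → 0ℚ ≤ y j x) → (∀ x → 0ℚ < y j x → 1ℚ ≤ y j x) → ⟦ support y j ⟧ ≤ ∑ (y j)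
    support≤∑ y j 0≤y integral = by-cases (0ℚ <? ∑ (y j))
      where
      by-cases : (d : Dec (0ℚ < ∑ (y j))) → ⟦ does d ⟧ ≤ ∑ (y j)
      by-cases (no _)    = ∑-nonneg 0≤y
      by-cases (yes 0<∑) with ∑-witness (y j) 0<∑
      ... | x , 0<yₓ = ≤-trans (integral x 0<yₓ) (term≤∑ 0≤y x)

    -- The dependency degree is read off from the prices. Two events are adjacent only if both pay
    -- at a common coordinate `j`, so the degree of `i` is at most the sum over `j` of `∑ (y i j)`
    -- times the price of all statistics together at `j`. The first factors add up to at most
    -- `ι s * μ⁺`, the second are at most `ι s * Δ`, however many statistics there are. Statistics
    -- of different size may be mixed, as each has its own `B`, `μ` and `t`.
    concentrate : ∀ k {N} {I : Set} (all : List I) (f : I → Ω N → ℚ) (y : I → Fin N → Fin s → ℚ) (B μ t : I → ℚ) (L μ⁺ Δ : ℚ) →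
      (∀ i → Lipschitz (f i) (y i)) →
      (∀ i j x → 0ℚ ≤ y i j x) → (∀ i j x → 0ℚ < y i j x → 1ℚ ≤ y i j x) → (∀ i j x → y i j x ≤ B i) →
      (∀ i → 0ℚ < B i) → (∀ i → B i ≤ μ i) → (∀ i → ∑ (λ j → avg (y i j)) ≤ μ i) → (∀ i → μ i ≤ μ⁺) →
      (∀ i → 0ℚ < t i) → (∀ i → ℤ.+ 44 / 1 * (ι (suc k) * ι (suc k)) * B i * μ i * L ≤ t i * t i) →
      (∀ j x → ∑ˡ all (λ i → y i j x) ≤ Δ) → 0ℚ ≤ Δ → 0ℚ ≤ L → 1ℚ ≤ ι s * μ⁺ * (ι s * Δ) → 4ℚ * (ι s * μ⁺ * (ι s * Δ)) ≤ L ^ suc k →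
      ∃ λ ω → ∀ i → i ∈ all → (f i ω - 𝔼 (f i)) * (f i ω - 𝔼 (f i)) < t i * t i
    concentrate k {N} {I} all f y B μ t L μ⁺ Δ lip 0≤y integral y≤B 0<B B≤μ Σ≤μ μ≤μ⁺ 0<t Lbound Σy≤Δ 0≤Δ 0≤L 1≤Δ′ 4Δ′≤L =
      proj₁ good , λ i i∈ → small i (t i * t i ≤? (f i ω - 𝔼 (f i)) * (f i ω - 𝔼 (f i))) (proj₂ good i i∈)
      where
      bad : I → Ω N → Bool
      bad i = deviates (f i) (t i)
      V : I → Fin N → Bool
      V i = support (y i)
      open LocalLemma s bad V using (degree; neighbour; local-lemma)
      Δ′ = ι s * μ⁺ * (ι s * Δ)
      dep : ∀ i → DependsOn (λ ω → ⟦ bad i ω ⟧) (V i)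
      dep i ω ω′ agree = cong (λ q → ⟦ does (t i * t i ≤? (q - 𝔼 (f i)) * (q - 𝔼 (f i))) ⟧) (depends-on-support (f i) (y i) (lip i) (0≤y i) ω ω′ agree)
      ∑y≤ : ∀ j → ∑ˡ all (λ i → ∑ (y i j)) ≤ ι s * Δ
      ∑y≤ j = ≤-trans (≤-reflexive (∑ˡ-∑-comm all (λ i → y i j))) (≤-trans (∑-mono (Σy≤Δ j)) (≤-reflexive (∑-const s Δ)))
      ∑≡s*avg : ∀ (g : Fin s → ℚ) → ∑ g ≡ ι s * avg g
      ∑≡s*avg g = trans (sym (*-identityˡ (∑ g))) (trans (cong (_* ∑ g) (sym (ι*inv s))) (*-assoc (ι s) (inv s) (∑ g)))
      neighbour≤ : ∀ i i′ → ⟦ neighbour i i′ ⟧ ≤ ∑ (λ j → ∑ (y i j) * ∑ (y i′ j))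
      neighbour≤ i i′ = ≤-trans (⟦any⟧≤∑ (λ j → V i j ∧ V i′ j)) (∑-mono λ j → ≤-trans (≤-reflexive (⟦∧⟧ (V i j) (V i′ j)))
        (*-mono (∑-nonneg (0≤y i j)) (⟦⟧-nonneg (V i′ j)) (support≤∑ (y i) j (0≤y i j) (integral i j)) (support≤∑ (y i′) j (0≤y i′ j) (integral i′ j))))
      deg : ∀ i → degree i all ≤ Δ′
      deg i = begin
        ∑ˡ all (λ i′ → ⟦ neighbour i i′ ⟧)                            ≤⟨ ∑ˡ-mono all (neighbour≤ i) ⟩
        ∑ˡ all (λ i′ → ∑ (λ j → ∑ (y i j) * ∑ (y i′ j)))              ≡⟨ ∑ˡ-∑-comm all (λ i′ j → ∑ (y i j) * ∑ (y i′ j)) ⟩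
        ∑ (λ j → ∑ˡ all (λ i′ → ∑ (y i j) * ∑ (y i′ j)))              ≡⟨ ∑-cong (λ j → ∑ˡ-* all (∑ (y i j)) (λ i′ → ∑ (y i′ j))) ⟩
        ∑ (λ j → ∑ (y i j) * ∑ˡ all (λ i′ → ∑ (y i′ j)))              ≤⟨ ∑-mono (λ j → *-monoˡ (∑-nonneg (0≤y i j)) (∑y≤ j)) ⟩
        ∑ (λ j → ∑ (y i j) * (ι s * Δ))                               ≡⟨ ∑-cong (λ j → trans (cong (_* (ι s * Δ)) (∑≡s*avg (y i j))) (swap (ι s) (avg (y i j)) (ι s * Δ))) ⟩
        ∑ (λ j → avg (y i j) * (ι s * (ι s * Δ)))                     ≤⟨ ∑avg≤ ⟩
        μ⁺ * (ι s * (ι s * Δ))                                        ≡⟨ swap (ι s) μ⁺ (ι s * Δ) ⟨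
        Δ′                                                            ∎
        where
        open ≤-Reasoning
        swap : ∀ a b c → a * b * c ≡ b * (a * c)
        swap = solve-∀ ℚ-ring
        ∑avg≤ : ∑ (λ j → avg (y i j) * (ι s * (ι s * Δ))) ≤ μ⁺ * (ι s * (ι s * Δ))
        ∑avg≤ = ≤-trans (≤-reflexive (sym (∑-* (λ j → avg (y i j)) (ι s * (ι s * Δ)))))
          (*-monoʳ (*-nonneg (ι-nonneg s) (*-nonneg (ι-nonneg s) 0≤Δ)) (≤-trans (Σ≤μ i) (μ≤μ⁺ i)))
      good = local-lemma dep (L ^ suc k) Δ′ (<-≤-trans 0<1 1≤Δ′) 4Δ′≤L
               (λ i → ≤-trans (≤-reflexive (*-comm (L ^ suc k) _)) (tail-bound k (f i) (y i) (B i) (μ i) (t i) L (lip i) (0≤y i) (y≤B i) (0<B i) (B≤μ i) (Σ≤μ i) (0<t i) 0≤L (Lbound i)))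
               1≤Δ′ all deg
      ω = proj₁ good
      small : ∀ i (d : Dec (t i * t i ≤ (f i ω - 𝔼 (f i)) * (f i ω - 𝔼 (f i)))) → does d ≡ false → (f i ω - 𝔼 (f i)) * (f i ω - 𝔼 (f i)) < t i * t i
      small i (no h) _ = ≰⇒> h

  -- Edge-coloured hypergraphs as families of edges indexed by colour

  ∑₂ : ∀ {m n} → (Fin m → Fin n → ℚ) → ℚ
  ∑₂ f = ∑ (λ i → ∑ (f i))

  ∑₂-mono : ∀ {m n} {f g : Fin m → Fin n → ℚ} → (∀ i j → f i j ≤ g i j) → ∑₂ f ≤ ∑₂ g
  ∑₂-mono h = ∑-mono (λ i → ∑-mono (h i))

  ∑₂-cong : ∀ {m n} {f g : Fin m → Fin n → ℚ} → (∀ i j → f i j ≡ g i j) → ∑₂ f ≡ ∑₂ g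
  ∑₂-cong h = ∑-cong (λ i → ∑-cong (h i))

  ∑₂-nonneg : ∀ {m n} {f : Fin m → Fin n → ℚ} → (∀ i j → 0ℚ ≤ f i j) → 0ℚ ≤ ∑₂ f
  ∑₂-nonneg h = ∑-nonneg (λ i → ∑-nonneg (h i))

  ∑₂-+ : ∀ {m n} (f g : Fin m → Fin n → ℚ) → ∑₂ (λ i j → f i j + g i j) ≡ ∑₂ f + ∑₂ g
  ∑₂-+ f g = trans (∑-cong (λ i → ∑-distrib-+ (f i) (g i))) (∑-distrib-+ (λ i → ∑ (f i)) (λ i → ∑ (g i)))

  *-∑₂ : ∀ {m n} c (f : Fin m → Fin n → ℚ) → c * ∑₂ f ≡ ∑₂ (λ i j → c * f i j)
  *-∑₂ c f = trans (*-∑ c (λ i → ∑ (f i))) (∑-cong (λ i → *-∑ c (f i)))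

  ∑₂-* : ∀ {m n} (f : Fin m → Fin n → ℚ) c → ∑₂ f * c ≡ ∑₂ (λ i j → f i j * c)
  ∑₂-* f c = trans (∑-* (λ i → ∑ (f i)) c) (∑-cong (λ i → ∑-* (f i) c))

  ∑₂-∑-comm : ∀ {l m n} (f : Fin m → Fin n → Fin l → ℚ) → ∑₂ (λ i j → ∑ (f i j)) ≡ ∑ (λ k → ∑₂ (λ i j → f i j k))
  ∑₂-∑-comm f = trans (∑-cong (λ i → ∑-comm (f i))) (∑-comm (λ i k → ∑ (λ j → f i j k)))

  ∑ˡ-++ : ∀ {I : Set} (xs ys : List I) (f : I → ℚ) → ∑ˡ (xs ++ ys) f ≡ ∑ˡ xs f + ∑ˡ ys f
  ∑ˡ-++ []       ys f = sym (+-identityˡ (∑ˡ ys f))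
  ∑ˡ-++ (x ∷ xs) ys f = trans (cong (f x +_) (∑ˡ-++ xs ys f)) (sym (+-assoc (f x) (∑ˡ xs f) (∑ˡ ys f)))

  ∑ˡ-map : ∀ {I J : Set} (g : I → J) (xs : List I) (f : J → ℚ) → ∑ˡ (map g xs) f ≡ ∑ˡ xs (λ i → f (g i))
  ∑ˡ-map g []       f = refl
  ∑ˡ-map g (x ∷ xs) f = cong (f (g x) +_) (∑ˡ-map g xs f)

  ∑ˡ-tabulate : ∀ {I : Set} {n} (g : Fin n → I) (f : I → ℚ) → ∑ˡ (List.tabulate g) f ≡ ∑ (λ i → f (g i))
  ∑ˡ-tabulate {n = zero}  g f = refl
  ∑ˡ-tabulate {n = suc n} g f = cong (f (g zero) +_) (∑ˡ-tabulate (λ i → g (suc i)) f)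

  ∑ˡ-cartesianProduct : ∀ {I J : Set} (xs : List I) (ys : List J) (f : I × J → ℚ) → ∑ˡ (cartesianProduct xs ys) f ≡ ∑ˡ xs (λ x → ∑ˡ ys (λ y → f (x , y)))
  ∑ˡ-cartesianProduct []       ys f = refl
  ∑ˡ-cartesianProduct (x ∷ xs) ys f = trans (∑ˡ-++ (map (x ,_) ys) (cartesianProduct xs ys) f) (cong₂ _+_ (∑ˡ-map (x ,_) ys f) (∑ˡ-cartesianProduct xs ys f))

  Family : ℕ → ℕ → ℕ → Set
  Family C a V = Fin C → Fin a → Fin V → Bool

  record Bounded {C a V} (edge : Family C a V) (r d K : ℚ) : Set where
    field
      size   : ∀ c i → ∑ (λ v → ⟦ edge c i v ⟧) ≤ r
      deg    : ∀ v → ∑₂ (λ c i → ⟦ edge c i v ⟧) ≤ d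
      codeg  : ∀ u v → u ≢ v → ∑₂ (λ c i → ⟦ edge c i u ⟧ * ⟦ edge c i v ⟧) ≤ K
      coldeg : ∀ v c → ∑ (λ i → ⟦ edge c i v ⟧) ≤ K

  Transversal : ∀ {C a V} → Family C a V → Set
  Transversal {C} {a} edge = Σ (Fin C → Fin a) λ pick → ∀ c c′ → c ≢ c′ → ∀ v → edge c (pick c) v ≡ true → edge c′ (pick c′) v ≡ false

  -- Statistics are attached to vertices and to colours alike: an edge is incident with its colour.
  module Incidence {C a V} (edge : Family C a V) where

    W : Set
    W = Fin V ⊎ Fin C

    inc : W → Fin C → Fin a → Bool
    inc (inj₁ v)  c i = edge c i v
    inc (inj₂ c₀) c i = c == c₀

    off : W → Fin V → Bool
    off (inj₁ v) u = not (v == u)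
    off (inj₂ _) u = true

    -- Only common vertices away from the reference `w` count. If `w` is a vertex, a single edge
    -- through it shares it with all of the up to `d` edges there; away from it, codegrees bound how
    -- many of these edges can be met. For a colour as reference nothing is excluded, and `clash` is
    -- this case.
    meet : W → Fin C → Fin a → Fin C → Fin a → Bool
    meet w c i c′ i′ = not (c == c′) ∧ any (λ u → off w u ∧ (edge c i u ∧ edge c′ i′ u))

    clash : Fin C → Fin a → Fin C → Fin a → Bool
    clash c = meet (inj₂ c) c

    meet≤∑ : ∀ w c i c′ i′ → ⟦ meet w c i c′ i′ ⟧ ≤ ∑ (λ u → ⟦ off w u ⟧ * (⟦ edge c i u ⟧ * ⟦ edge c′ i′ u ⟧))
    meet≤∑ w c i c′ i′ = ≤-trans (⟦⟧-mono (λ h → proj₂ (∧-true {not (c == c′)} h)))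
      (≤-trans (⟦any⟧≤∑ (λ u → off w u ∧ (edge c i u ∧ edge c′ i′ u)))
        (≤-reflexive (∑-cong (λ u → trans (⟦∧⟧ (off w u) _) (cong (⟦ off w u ⟧ *_) (⟦∧⟧ (edge c i u) (edge c′ i′ u)))))))

    meet⇒clash : ∀ w c i c′ i′ → ⟦ meet w c i c′ i′ ⟧ ≤ ⟦ clash c i c′ i′ ⟧
    meet⇒clash w c i c′ i′ = ⟦⟧-mono {meet w c i c′ i′} {clash c i c′ i′} implies
      where
      implies : meet w c i c′ i′ ≡ true → clash c i c′ i′ ≡ true
      implies h with ∧-true {not (c == c′)} h
      ... | p , q with any-elim (λ u → off w u ∧ (edge c i u ∧ edge c′ i′ u)) q
      ...   | u , hᵤ = cong₂ _∧_ p (any-intro (λ u → true ∧ (edge c i u ∧ edge c′ i′ u)) u (proj₂ (∧-true {off w u} hᵤ)))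

    clash-intro : ∀ {c i c′ i′ v} → c ≢ c′ → edge c i v ≡ true → edge c′ i′ v ≡ true → clash c i c′ i′ ≡ true
    clash-intro {c} {i} {c′} {i′} {v} c≢c′ h h′ = cong₂ _∧_ (different (c == c′) refl) (any-intro (λ u → true ∧ (edge c i u ∧ edge c′ i′ u)) v (cong₂ _∧_ h h′))
      where
      different : ∀ b → (c == c′) ≡ b → not b ≡ true
      different false _  = refl
      different true  eq = ⊥-elim (c≢c′ (==⇒≡ c c′ eq))

    clash≤meet+ : ∀ v c i c′ i′ → ⟦ clash c i c′ i′ ⟧ ≤ ⟦ meet (inj₁ v) c i c′ i′ ⟧ + ⟦ edge c′ i′ v ⟧
    clash≤meet+ v c i c′ i′ with clash c i c′ i′ in eq
    ... | false = +-nonneg (⟦⟧-nonneg (meet (inj₁ v) c i c′ i′)) (⟦⟧-nonneg (edge c′ i′ v))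
    ... | true with ∧-true {not (c == c′)} eq
    ...   | p , q with any-elim (λ u → true ∧ (edge c i u ∧ edge c′ i′ u)) q
    ...     | u , hᵤ = by-cases (v == u) refl
      where
      by-cases : ∀ b → (v == u) ≡ b → 1ℚ ≤ ⟦ meet (inj₁ v) c i c′ i′ ⟧ + ⟦ edge c′ i′ v ⟧
      by-cases true  v≡u rewrite ==⇒≡ v u v≡u | proj₂ (∧-true {edge c i u} hᵤ) =
        ≤-by ⟦ meet (inj₁ u) c i c′ i′ ⟧ (⟦⟧-nonneg (meet (inj₁ u) c i c′ i′)) (+-comm ⟦ meet (inj₁ u) c i c′ i′ ⟧ 1ℚ)
      by-cases false v≢u = ≤-by ⟦ edge c′ i′ v ⟧ (⟦⟧-nonneg (edge c′ i′ v)) (cong (λ b → ⟦ b ⟧ + ⟦ edge c′ i′ v ⟧)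
        (cong₂ _∧_ p (any-intro (λ u → not (v == u) ∧ (edge c i u ∧ edge c′ i′ u)) u (cong₂ _∧_ (cong not v≢u) hᵤ))))

    N : W → Fin C → Fin a → ℚ
    N w c i = ∑₂ (λ c′ i′ → ⟦ meet w c i c′ i′ ⟧)

    module _ {r d K} (bounded : Bounded edge r d K) (0≤d : 0ℚ ≤ d) (0≤K : 0ℚ ≤ K) where
      open Bounded bounded

      meet≤∑′ : ∀ w c i c′ i′ → ⟦ meet w c i c′ i′ ⟧ ≤ ∑ (λ u → ⟦ edge c i u ⟧ * ⟦ edge c′ i′ u ⟧)
      meet≤∑′ w c i c′ i′ = ≤-trans (meet≤∑ w c i c′ i′) (∑-mono λ u → ≤-trans (*-monoʳ (*-nonneg (⟦⟧-nonneg (edge c i u)) (⟦⟧-nonneg (edge c′ i′ u))) (⟦⟧≤1 (off w u)))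
        (≤-reflexive (*-identityˡ _)))

      weigh-edge : ∀ c i (x : Fin V → ℚ) b → 0ℚ ≤ b → (∀ u → x u ≤ b) → ∑ (λ u → ⟦ edge c i u ⟧ * x u) ≤ r * b
      weigh-edge c i x b 0≤b x≤b = ≤-trans (∑-mono (λ u → *-monoˡ (⟦⟧-nonneg (edge c i u)) (x≤b u)))
        (≤-trans (≤-reflexive (sym (∑-* (λ u → ⟦ edge c i u ⟧) b))) (*-monoʳ 0≤b (size c i)))

      N≤rd : ∀ w c i → N w c i ≤ r * d
      N≤rd w c i = ≤-trans (∑₂-mono (meet≤∑′ w c i)) (≤-trans (≤-reflexive (∑₂-∑-comm (λ c′ i′ u → ⟦ edge c i u ⟧ * ⟦ edge c′ i′ u ⟧)))
        (≤-trans (≤-reflexive (∑-cong (λ u → sym (*-∑₂ ⟦ edge c i u ⟧ (λ c′ i′ → ⟦ edge c′ i′ u ⟧)))))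
          (weigh-edge c i (λ u → ∑₂ (λ c′ i′ → ⟦ edge c′ i′ u ⟧)) d 0≤d deg)))

      N-column≤rd : ∀ w c′ i′ → ∑₂ (λ c i → ⟦ meet w c i c′ i′ ⟧) ≤ r * d
      N-column≤rd w c′ i′ = ≤-trans (∑₂-mono (λ c i → meet≤∑′ w c i c′ i′)) (≤-trans (≤-reflexive (∑₂-∑-comm (λ c i u → ⟦ edge c i u ⟧ * ⟦ edge c′ i′ u ⟧)))
        (≤-trans (≤-reflexive (∑-cong (λ u → trans (∑₂-cong (λ c i → *-comm ⟦ edge c i u ⟧ ⟦ edge c′ i′ u ⟧)) (sym (*-∑₂ ⟦ edge c′ i′ u ⟧ (λ c i → ⟦ edge c i u ⟧))))))
          (weigh-edge c′ i′ (λ u → ∑₂ (λ c i → ⟦ edge c i u ⟧)) d 0≤d deg)))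

      -- For a vertex `w` this is a codegree, for a colour `w` a colour degree: the two local bounds
      -- on the colouring are the same bound for the extended incidence.
      pair-degree≤K : ∀ w u → ∑₂ (λ c i → ⟦ inc w c i ⟧ * (⟦ off w u ⟧ * ⟦ edge c i u ⟧)) ≤ K
      pair-degree≤K (inj₁ v) u with v == u in eq
      ... | true  = ≤-trans (≤-reflexive (∑-zero (λ c → ∑-zero (λ i → zero* ⟦ edge c i v ⟧ ⟦ edge c i u ⟧)))) 0≤K
        where
        zero* : ∀ x y → x * (0ℚ * y) ≡ 0ℚ
        zero* = solve-∀ ℚ-ring
      ... | false = ≤-trans (≤-reflexive (∑₂-cong (λ c i → cong (⟦ edge c i v ⟧ *_) (*-identityˡ ⟦ edge c i u ⟧))))
                      (codeg v u λ { refl → false≢true (trans (sym eq) (==-refl v)) })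
      pair-degree≤K (inj₂ c₀) u = ≤-trans (≤-reflexive (trans (∑-cong (λ c → sym (*-∑ ⟦ c == c₀ ⟧ (λ i → 1ℚ * ⟦ edge c i u ⟧))))
        (trans (∑-select c₀ (λ c → ∑ (λ i → 1ℚ * ⟦ edge c i u ⟧))) (∑-cong (λ i → *-identityˡ ⟦ edge c₀ i u ⟧))))) (coldeg u c₀)

      -- Each of the at most `r` vertices of an edge lies on at most `K` edges incident with `w`.
      -- This is the price of one choice, and so the place where small codegrees produce
      -- concentration.
      inc-meet≤rK : ∀ w c′ i′ → ∑₂ (λ c i → ⟦ inc w c i ⟧ * ⟦ meet w c i c′ i′ ⟧) ≤ r * K
      inc-meet≤rK w c′ i′ = ≤-trans (∑₂-mono (λ c i → *-monoˡ (⟦⟧-nonneg (inc w c i)) (meet≤∑ w c i c′ i′)))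
        (≤-trans (≤-reflexive (trans (∑₂-cong (λ c i → trans (*-∑ ⟦ inc w c i ⟧ (λ u → ⟦ off w u ⟧ * (⟦ edge c i u ⟧ * ⟦ edge c′ i′ u ⟧)))
                                                       (∑-cong (λ u → rotate ⟦ inc w c i ⟧ ⟦ off w u ⟧ ⟦ edge c i u ⟧ ⟦ edge c′ i′ u ⟧))))
            (trans (∑₂-∑-comm (λ c i u → ⟦ edge c′ i′ u ⟧ * (⟦ inc w c i ⟧ * (⟦ off w u ⟧ * ⟦ edge c i u ⟧))))
              (∑-cong (λ u → sym (*-∑₂ ⟦ edge c′ i′ u ⟧ (λ c i → ⟦ inc w c i ⟧ * (⟦ off w u ⟧ * ⟦ edge c i u ⟧))))))))
          (weigh-edge c′ i′ (λ u → ∑₂ (λ c i → ⟦ inc w c i ⟧ * (⟦ off w u ⟧ * ⟦ edge c i u ⟧))) K 0≤K (pair-degree≤K w)))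
        where
        rotate : ∀ x y z w → x * (y * (z * w)) ≡ w * (x * (y * z))
        rotate = solve-∀ ℚ-ring

      -- Meetings at `v` itself number at most its degree. The term `d` is what turns `r * d` into
      -- `r * d - d` in the degree recursion.
      N-clash≤ : ∀ v c i → N (inj₂ c) c i ≤ N (inj₁ v) c i + d
      N-clash≤ v c i = ≤-trans (∑₂-mono (clash≤meet+ v c i)) (≤-trans (≤-reflexive (∑₂-+ (meet′) (λ c′ i′ → ⟦ edge c′ i′ v ⟧))) (+-monoʳ-≤ (N (inj₁ v) c i) (deg v)))
        where
        meet′ : Fin C → Fin a → ℚ
        meet′ c′ i′ = ⟦ meet (inj₁ v) c i c′ i′ ⟧

    inc-count : ∀ {r d K} → Bounded edge r d K → d ≤ ι a → ∀ w → ∑₂ (λ c i → ⟦ inc w c i ⟧) ≤ ι a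
    inc-count bounded d≤a (inj₁ v)  = ≤-trans (Bounded.deg bounded v) d≤a
    inc-count bounded d≤a (inj₂ c₀) = ≤-reflexive (trans (∑-cong (λ c → trans (∑-const a ⟦ c == c₀ ⟧) (*-comm (ι a) ⟦ c == c₀ ⟧))) (∑-select c₀ (λ _ → ι a)))

  -- Finishing with one random choice when edges are plentiful

  ∑ˡ-allFin : ∀ n (f : Fin n → ℚ) → ∑ˡ (allFin n) f ≡ ∑ f
  ∑ˡ-allFin n f = ∑ˡ-tabulate (λ i → i) f

  ==-sym-false : ∀ {n} (i j : Fin n) → (i == j) ≡ false → i ≢ j
  ==-sym-false i .i eq refl = false≢true (trans (sym eq) (==-refl i))

  module _ (s : ℕ) .{{_ : ℕ.NonZero s}} where
    open Expectation s

    avg-indicator : ∀ i → avg (λ x → ⟦ x == i ⟧) ≡ inv s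
    avg-indicator i = trans (cong (inv s *_) (trans (∑-cong (λ x → sym (*-identityʳ ⟦ x == i ⟧))) (∑-select i (λ _ → 1ℚ)))) (*-identityʳ (inv s))

    𝔼-coordinates : ∀ {N} {j j′ : Fin N} → j ≢ j′ → (g h : Fin s → ℚ) → 𝔼 (λ ω → g (lookup ω j) * h (lookup ω j′)) ≡ avg g * avg h
    𝔼-coordinates {N} {j} {j′} j≢j′ g h = trans (𝔼-independent (λ ω → g (lookup ω j)) (λ ω → h (lookup ω j′)) {j ==_} {j′ ==_}
        (λ ω ω′ agree → cong g (agree j (==-refl j))) (λ ω ω′ agree → cong h (agree j′ (==-refl j′))) disjoint)
        (cong₂ _*_ (𝔼-coordinate j g) (𝔼-coordinate j′ h))
      where
      disjoint : ∀ k → (j == k) ≡ true → (j′ == k) ≡ false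
      disjoint k jk with j′ == k in eq
      ... | false = refl
      ... | true  = ⊥-elim (j≢j′ (trans (==⇒≡ j k jk) (sym (==⇒≡ j′ k eq))))

  -- A given clashing pair is chosen with probability `1 / a²`. A colour takes part in at most
  -- `2 a r d` ordered clashing pairs, so such a pair shares a colour with at most `4 a r d` others.
  -- The local lemma wants four times this to be at most `a²`, which is `16 r d ≤ a`.
  sparse⇒transversal : ∀ {C a V} .{{_ : ℕ.NonZero a}} (edge : Family C a V) {r d K} → Bounded edge r d K → 0ℚ ≤ d → 0ℚ ≤ K →
                       1ℚ ≤ r * d → ℤ.+ 16 / 1 * (r * d) ≤ ι a → Transversal edge
  sparse⇒transversal {C} {a} {V} edge {r} {d} {K} bounded 0≤d 0≤K 1≤rd 16rd≤a =
    conclude (local-lemma dep P Δ (<-≤-trans 0<1 1≤Δ) 4Δ≤P bad≤ 1≤Δ all deg)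
    where
    open Incidence edge
    open Expectation a
    E = Fin C × Fin a
    edges : List E
    edges = cartesianProduct (allFin C) (allFin a)
    all : List (E × E)
    all = cartesianProduct edges edges
    ∑ˡ-edges : ∀ (f : E → ℚ) → ∑ˡ edges f ≡ ∑₂ (λ c i → f (c , i))
    ∑ˡ-edges f = trans (∑ˡ-cartesianProduct (allFin C) (allFin a) f) (trans (∑ˡ-allFin C _) (∑-cong (λ c → ∑ˡ-allFin a (λ i → f (c , i)))))
    ∑ˡ-all : ∀ (f : E × E → ℚ) → ∑ˡ all f ≡ ∑₂ (λ c i → ∑₂ (λ c′ i′ → f ((c , i) , (c′ , i′))))
    ∑ˡ-all f = trans (∑ˡ-cartesianProduct edges edges f) (trans (∑ˡ-edges _) (∑₂-cong (λ c i → ∑ˡ-edges (λ e → f ((c , i) , e)))))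
    bad : E × E → Ω C → Bool
    bad ((c , i) , (c′ , i′)) ω = clash c i c′ i′ ∧ ((lookup ω c == i) ∧ (lookup ω c′ == i′))
    -- A pair without a clash is never bad and depends on no coordinate. The events can therefore be
    -- indexed by all pairs of edges without filtering.
    Var : E × E → Fin C → Bool
    Var ((c , i) , (c′ , i′)) j = clash c i c′ i′ ∧ ((c == j) ∨ (c′ == j))
    open LocalLemma a bad Var using (local-lemma; degree; neighbour)
    dep : ∀ e → DependsOn (λ ω → ⟦ bad e ω ⟧) (Var e)
    dep ((c , i) , (c′ , i′)) ω ω′ agree with clash c i c′ i′
    ... | false = refl
    ... | true  = cong₂ (λ x x′ → ⟦ (x == i) ∧ (x′ == i′) ⟧) (agree c (cong (_∨ (c′ == c)) (==-refl c))) (agree c′ (trans (cong ((c == c′) ∨_) (==-refl c′)) (∨-true (c == c′))))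
      where
      ∨-true : ∀ b → b ∨ true ≡ true
      ∨-true true  = refl
      ∨-true false = refl
    P = ι a * ι a
    Δ = 4ℚ * ι a * (r * d)
    0≤rd = ≤-trans 0≤1 1≤rd
    bad≤ : ∀ e → P * 𝔼 (λ ω → ⟦ bad e ω ⟧) ≤ 1ℚ
    bad≤ ((c , i) , (c′ , i′)) with clash c i c′ i′ in eq
    ... | false = ≤-trans (≤-reflexive (trans (cong (P *_) (𝔼-const C 0ℚ)) (*-zeroʳ P))) 0≤1
    ... | true  = ≤-reflexive (trans (cong (P *_) (trans (𝔼-cong (λ ω → ⟦∧⟧ (lookup ω c == i) (lookup ω c′ == i′)))
          (trans (𝔼-coordinates a c≢c′ (λ x → ⟦ x == i ⟧) (λ x → ⟦ x == i′ ⟧)) (cong₂ _*_ (avg-indicator a i) (avg-indicator a i′)))))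
        (trans (regroup (ι a) (inv a)) (cong₂ _*_ (ι*inv a) (ι*inv a))))
      where
      c≢c′ : c ≢ c′
      c≢c′ = ==-sym-false c c′ (not-true (proj₁ (∧-true {not (c == c′)} eq)))
        where
        not-true : ∀ {b} → not b ≡ true → b ≡ false
        not-true {false} _ = refl
      regroup : ∀ x y → x * x * (y * y) ≡ (x * y) * (x * y)
      regroup = solve-∀ ℚ-ring
    ⟦∨⟧≤ : ∀ a b → ⟦ a ∨ b ⟧ ≤ ⟦ a ⟧ + ⟦ b ⟧
    ⟦∨⟧≤ true  b = ≤-by ⟦ b ⟧ (⟦⟧-nonneg b) refl
    ⟦∨⟧≤ false b = ≤-reflexive (sym (+-identityˡ ⟦ b ⟧))
    Var-count : ∀ j → ∑ˡ all (λ e → ⟦ Var e j ⟧) ≤ 2ℚ * ι a * (r * d)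
    Var-count j = begin
      ∑ˡ all (λ e → ⟦ Var e j ⟧)                                                    ≡⟨ ∑ˡ-all (λ e → ⟦ Var e j ⟧) ⟩
      ∑₂ (λ c i → ∑₂ (λ c′ i′ → ⟦ Var ((c , i) , (c′ , i′)) j ⟧))                   ≤⟨ ∑₂-mono (λ c i → ∑₂-mono (λ c′ i′ → split c i c′ i′)) ⟩
      ∑₂ (λ c i → ∑₂ (λ c′ i′ → x c i c′ i′ + y c i c′ i′))                         ≡⟨ ∑₂-cong (λ c i → ∑₂-+ (x c i) (y c i)) ⟩
      ∑₂ (λ c i → ∑₂ (x c i) + ∑₂ (y c i))                                          ≡⟨ ∑₂-+ (λ c i → ∑₂ (x c i)) (λ c i → ∑₂ (y c i)) ⟩
      ∑₂ (λ c i → ∑₂ (x c i)) + ∑₂ (λ c i → ∑₂ (y c i))                             ≡⟨ cong (∑₂ (λ c i → ∑₂ (x c i)) +_) (exchange y) ⟩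
      ∑₂ (λ c i → ∑₂ (x c i)) + ∑₂ (λ c′ i′ → ∑₂ (λ c i → y c i c′ i′))             ≤⟨ +-mono-≤ (∑₂-mono (λ c i → ≤-trans (≤-reflexive (sym (*-∑₂ ⟦ c == j ⟧ (λ c′ i′ → ⟦ clash c i c′ i′ ⟧))))
                                                                                            (*-monoˡ (⟦⟧-nonneg (c == j)) (N≤rd bounded 0≤d 0≤K (inj₂ c) c i))))
                                                                                         (∑₂-mono (λ c′ i′ → ≤-trans (≤-reflexive (sym (*-∑₂ ⟦ c′ == j ⟧ (λ c i → ⟦ clash c i c′ i′ ⟧))))
                                                                                            (*-monoˡ (⟦⟧-nonneg (c′ == j)) (N-column≤rd bounded 0≤d 0≤K (inj₂ c′) c′ i′)))) ⟩
      ∑₂ {C} {a} (λ c i → ⟦ c == j ⟧ * (r * d)) + ∑₂ {C} {a} (λ c i → ⟦ c == j ⟧ * (r * d))   ≡⟨ cong₂ _+_ select select ⟩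
      ι a * (r * d) + ι a * (r * d)                                                 ≡⟨ double (ι a) (r * d) ⟩
      2ℚ * ι a * (r * d)                                                            ∎
      where
      open ≤-Reasoning
      x y : Fin C → Fin a → Fin C → Fin a → ℚ
      x c i c′ i′ = ⟦ c == j ⟧ * ⟦ clash c i c′ i′ ⟧
      y c i c′ i′ = ⟦ c′ == j ⟧ * ⟦ clash c i c′ i′ ⟧
      split : ∀ c i c′ i′ → ⟦ Var ((c , i) , (c′ , i′)) j ⟧ ≤ x c i c′ i′ + y c i c′ i′
      split c i c′ i′ = ≤-trans (≤-reflexive (⟦∧⟧ (clash c i c′ i′) _)) (≤-trans (*-monoˡ (⟦⟧-nonneg (clash c i c′ i′)) (⟦∨⟧≤ (c == j) (c′ == j)))
        (≤-reflexive (dist ⟦ clash c i c′ i′ ⟧ ⟦ c == j ⟧ ⟦ c′ == j ⟧)))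
        where
        dist : ∀ a b c → a * (b + c) ≡ b * a + c * a
        dist = solve-∀ ℚ-ring
      exchange : ∀ (f : Fin C → Fin a → Fin C → Fin a → ℚ) → ∑₂ (λ c i → ∑₂ (f c i)) ≡ ∑₂ (λ c′ i′ → ∑₂ (λ c i → f c i c′ i′))
      exchange f = trans (∑₂-∑-comm (λ c i c′ → ∑ (f c i c′))) (∑-cong (λ c′ → ∑₂-∑-comm (λ c i i′ → f c i c′ i′)))
      select : ∑₂ {C} {a} (λ c i → ⟦ c == j ⟧ * (r * d)) ≡ ι a * (r * d)
      select = trans (∑-cong (λ c → trans (∑-const a (⟦ c == j ⟧ * (r * d))) (swap (ι a) ⟦ c == j ⟧ (r * d)))) (∑-select j (λ _ → ι a * (r * d)))
        where
        swap : ∀ a b c → a * (b * c) ≡ b * (a * c)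
        swap = solve-∀ ℚ-ring
      double : ∀ a b → a * b + a * b ≡ 2ℚ * a * b
      double = solve-∀ ℚ-ring
    deg : ∀ e → degree e all ≤ Δ
    deg e@((c , i) , (c′ , i′)) = begin
      ∑ˡ all (λ e′ → ⟦ neighbour e e′ ⟧)                       ≤⟨ ∑ˡ-mono all shared ⟩
      ∑ˡ all (λ e′ → ⟦ Var e′ c ⟧ + ⟦ Var e′ c′ ⟧)             ≡⟨ ∑ˡ-+ all (λ e′ → ⟦ Var e′ c ⟧) (λ e′ → ⟦ Var e′ c′ ⟧) ⟩
      ∑ˡ all (λ e′ → ⟦ Var e′ c ⟧) + ∑ˡ all (λ e′ → ⟦ Var e′ c′ ⟧) ≤⟨ +-mono-≤ (Var-count c) (Var-count c′) ⟩
      2ℚ * ι a * (r * d) + 2ℚ * ι a * (r * d)                  ≡⟨ double (ι a) (r * d) ⟩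
      Δ                                                        ∎
      where
      open ≤-Reasoning
      double : ∀ a b → 2ℚ * a * b + 2ℚ * a * b ≡ 4ℚ * a * b
      double = solve-∀ ℚ-ring
      ∑ˡ-+ : ∀ {I : Set} (is : List I) (f g : I → ℚ) → ∑ˡ is (λ i → f i + g i) ≡ ∑ˡ is f + ∑ˡ is g
      ∑ˡ-+ []       f g = refl
      ∑ˡ-+ (i ∷ is) f g = trans (cong (f i + g i +_) (∑ˡ-+ is f g)) (inter (f i) (g i) (∑ˡ is f) (∑ˡ is g))
        where
        inter : ∀ a b c d → a + b + (c + d) ≡ (a + c) + (b + d)
        inter = solve-∀ ℚ-ring
      shared : ∀ e′ → ⟦ neighbour e e′ ⟧ ≤ ⟦ Var e′ c ⟧ + ⟦ Var e′ c′ ⟧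
      shared e′ = ≤-trans (⟦⟧-mono {neighbour e e′} {Var e′ c ∨ Var e′ c′} implies) (⟦∨⟧≤ (Var e′ c) (Var e′ c′))
        where
        implies : neighbour e e′ ≡ true → Var e′ c ∨ Var e′ c′ ≡ true
        implies h with any-elim (λ j → Var e j ∧ Var e′ j) h
        ... | j , hⱼ with ∧-true {Var e j} hⱼ
        ...   | v , v′ with ∧-true {clash c i c′ i′} v
        ...     | _ , cj = or (c == j) refl cj
          where
          or : ∀ b → (c == j) ≡ b → b ∨ (c′ == j) ≡ true → Var e′ c ∨ Var e′ c′ ≡ true
          or true  eq _  rewrite ==⇒≡ c j eq | v′ = refl
          or false _  eq rewrite ==⇒≡ c′ j eq | v′ with Var e′ c
          ... | true  = refl
          ... | false = refl
    0<rd = <-≤-trans 0<1 1≤rd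
    1≤a : 1ℚ ≤ ι a
    1≤a = 1≤ι-nonZero a
    1≤Δ : 1ℚ ≤ Δ
    1≤Δ = ≤-trans 1≤rd (≤-by _ (*-nonneg 0≤rd (+-nonneg (*-nonneg (0≤ 4) (p≤q⇒0≤q-p 1≤a)) (0≤ 3))) (eq (ι a) (r * d)))
      where
      eq : ∀ a x → 4ℚ * a * x ≡ x + x * (4ℚ * (a - 1ℚ) + 3ℚ)
      eq = solve-∀ ℚ-ring
    4Δ≤P : 4ℚ * Δ ≤ P
    4Δ≤P = ≤-trans (≤-reflexive (eq (ι a) (r * d))) (*-monoˡ (ι-nonneg a) 16rd≤a)
      where
      eq : ∀ a x → 4ℚ * (4ℚ * a * x) ≡ a * (ℤ.+ 16 / 1 * x)
      eq = solve-∀ ℚ-ring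
    conclude : (∃ λ ω → ∀ e → e ∈ all → bad e ω ≡ false) → Transversal edge
    conclude (ω , good) = lookup ω , disjoint
      where
      ∈edges : ∀ c i → (c , i) ∈ edges
      ∈edges c i = ∈-cartesianProduct⁺ (∈-allFin c) (∈-allFin i)
      disjoint : ∀ c c′ → c ≢ c′ → ∀ v → edge c (lookup ω c) v ≡ true → edge c′ (lookup ω c′) v ≡ false
      disjoint c c′ c≢c′ v h with edge c′ (lookup ω c′) v in eq
      ... | false = refl
      ... | true  = ⊥-elim (false≢true (trans (sym (good ((c , lookup ω c) , (c′ , lookup ω c′)) (∈-cartesianProduct⁺ (∈edges c (lookup ω c)) (∈edges c′ (lookup ω c′)))))
            (cong₂ _∧_ (clash-intro c≢c′ h eq) (cong₂ _∧_ (==-refl (lookup ω c)) (==-refl (lookup ω c′))))))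

  -- First stage of a nibble step: one edge per colour

  Natural : ℚ → Set
  Natural q = ∃ λ n → q ≡ ι n

  ⟦⟧-natural : ∀ b → Natural ⟦ b ⟧
  ⟦⟧-natural true  = 1 , refl
  ⟦⟧-natural false = 0 , refl

  +-natural : ∀ {p q} → Natural p → Natural q → Natural (p + q)
  +-natural (m , refl) (n , refl) = m ℕ.+ n , sym (ι-+ m n)

  *-natural : ∀ {p q} → Natural p → Natural q → Natural (p * q)
  *-natural (m , refl) (n , refl) = m ℕ.* n , sym (ι-* m n)

  ∑-natural : ∀ {n} {f : Fin n → ℚ} → (∀ i → Natural (f i)) → Natural (∑ f)
  ∑-natural {zero}  h = 0 , refl
  ∑-natural {suc n} h = +-natural (h zero) (∑-natural (λ i → h (suc i)))

  natural⇒1≤ : ∀ {q} → Natural q → 0ℚ < q → 1ℚ ≤ q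
  natural⇒1≤ (zero  , refl) 0<q = ⊥-elim (<-irrefl refl 0<q)
  natural⇒1≤ (suc n , refl) _   = 1≤ι n

  sq<sq⇒< : ∀ {x t} → 0ℚ < t → x * x < t * t → x < t
  sq<sq⇒< {x} {t} 0<t h with x <? t
  ... | yes x<t = x<t
  ... | no x≮t  = ⊥-elim (<-irrefl refl (<-≤-trans h (*-mono (≤-trans (<⇒≤ 0<t) t≤x) (<⇒≤ 0<t) t≤x t≤x)))
    where t≤x = ≮⇒≥ x≮t

  module _ {x e t : ℚ} (0<t : 0ℚ < t) (h : (x - e) * (x - e) < t * t) where

    deviation-upper : x ≤ e + t
    deviation-upper = ≤-trans (≤-reflexive (p+[q-p]≡q e x)) (+-monoʳ-≤ e (<⇒≤ (sq<sq⇒< 0<t h)))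

    deviation-lower : e ≤ x + t
    deviation-lower = ≤-trans (≤-reflexive (swap x e)) (+-monoʳ-≤ x (<⇒≤ (sq<sq⇒< 0<t (subst (_< t * t) (sym (neg-sq (x - e))) h))))
      where
      swap : ∀ x e → e ≡ x + - (x - e)
      swap = solve-∀ ℚ-ring

  module Linear (s : ℕ) .{{_ : ℕ.NonZero s}} where
    open Expectation s
    open Concentration s

    linear : ∀ {N} → (Fin N → Fin s → ℚ) → Ω N → ℚ
    linear y ω = ∑ (λ j → y j (lookup ω j))

    linear-lipschitz : ∀ {N} (y : Fin N → Fin s → ℚ) → (∀ j x → 0ℚ ≤ y j x) → Lipschitz (linear y) y
    linear-lipschitz y 0≤y (x₀ ∷ ω) zero x x′ = ≤-by (2ℚ * y zero x′) (*-nonneg (0≤ 2) (0≤y zero x′)) (eq (y zero x) (y zero x′) (∑ (λ j → y (suc j) (lookup ω j))))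
      where
      eq : ∀ a b c → a + b ≡ (a + c) - (b + c) + 2ℚ * b
      eq = solve-∀ ℚ-ring
    linear-lipschitz y 0≤y (x₀ ∷ ω) (suc j) x x′ = ≤-trans (≤-reflexive (eq (y zero x₀) _ _)) (linear-lipschitz (λ j → y (suc j)) (λ j → 0≤y (suc j)) ω j x x′)
      where
      eq : ∀ c a b → (c + a) - (c + b) ≡ a - b
      eq = solve-∀ ℚ-ring

    𝔼-linear : ∀ {N} (y : Fin N → Fin s → ℚ) → 𝔼 (linear y) ≡ ∑ (λ j → avg (y j))
    𝔼-linear y = trans (𝔼-∑ (λ j ω → y j (lookup ω j))) (∑-cong (λ j → 𝔼-coordinate j (y j)))

  module Picks {C a V} .{{_ : ℕ.NonZero a}} (edge : Family C a V) where
    open Incidence edge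

    H : (Fin C → Fin a) → W → Fin C → Fin a → ℚ
    H pk w c i = ∑ (λ c′ → ⟦ meet w c i c′ (pk c′) ⟧)

    hits : (Fin C → Fin a) → Fin V → ℚ
    hits pk u = ∑ (λ c → ⟦ edge c (pk c) u ⟧)

    -- Each statistic is controlled only on the side where it does harm: a colour must not lose too
    -- many edges, and a vertex must not lose too little of its degree. The factor `inv a` is the
    -- probability that a given edge is the chosen one of its colour.
    record Spread (d t h : ℚ) (pk : Fin C → Fin a) : Set where
      field
        colour-upper : ∀ c → ∑ (λ i → H pk (inj₂ c) c i) ≤ inv a * ∑ (λ i → N (inj₂ c) c i) + t
        vertex-lower : ∀ v → inv a * ∑₂ (λ c i → ⟦ edge c i v ⟧ * N (inj₁ v) c i) ≤ ∑₂ (λ c i → ⟦ edge c i v ⟧ * H pk (inj₁ v) c i) + t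
        hits-upper   : ∀ u → hits pk u ≤ h

    module _ {r d K} (bounded : Bounded edge r d K) (1≤r : 1ℚ ≤ r) (1≤d : 1ℚ ≤ d) (1≤K : 1ℚ ≤ K) (K≤d : K ≤ d) (d≤a : d ≤ ι a)
             (k : ℕ) {L t : ℚ} (0<L : 0ℚ < L) (0<t : 0ℚ < t)
             (t-large : ℤ.+ 44 / 1 * (ι (suc k) * ι (suc k)) * (r * K) * (r * d) * L ≤ t * t)
             (L-large : ℤ.+ 44 / 1 * (ι (suc k) * ι (suc k)) * 1ℚ * 1ℚ * L ≤ L * L)
             (k-large : 4ℚ * (ι a * (r * d) * (ι a * (r * (r * d) + r * d + r))) ≤ L ^ suc k) where
      open Bounded bounded
      open Expectation a
      open Linear a
      open SimultaneousConcentration a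

      private
        0≤r = ≤-trans 0≤1 1≤r
        0≤d = ≤-trans 0≤1 1≤d
        0≤K = ≤-trans 0≤1 1≤K
        1≤r*_ : ∀ {x} → 1ℚ ≤ x → 1ℚ ≤ r * x
        1≤r* 1≤x = *-mono {1ℚ} {r} {1ℚ} 0≤r 0≤1 1≤r 1≤x
        1≤rd = 1≤r* 1≤d
        0≤rd = ≤-trans 0≤1 1≤rd
        I = W ⊎ Fin V
        vertices = List.map {B = W} inj₁ (allFin V)
        colours = List.map {B = W} inj₂ (allFin C)
        all : List I
        all = List.map inj₁ (vertices ++ colours) ++ List.map inj₂ (allFin V)
        ∑ˡ-all : ∀ f → ∑ˡ all f ≡ ∑ (λ v → f (inj₁ (inj₁ v))) + ∑ (λ c → f (inj₁ (inj₂ c))) + ∑ (λ u → f (inj₂ u))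
        ∑ˡ-all f = trans (∑ˡ-++ (List.map inj₁ (vertices ++ colours)) _ f) (cong₂ _+_
          (trans (∑ˡ-map inj₁ (vertices ++ colours) f) (trans (∑ˡ-++ vertices colours _) (cong₂ _+_ (trans (∑ˡ-map inj₁ (allFin V) _) (∑ˡ-allFin V _)) (trans (∑ˡ-map inj₂ (allFin C) _) (∑ˡ-allFin C _)))))
          (trans (∑ˡ-map inj₂ (allFin V) f) (∑ˡ-allFin V _)))
        ∈-all : ∀ i → i ∈ all
        ∈-all (inj₁ (inj₁ v)) = ∈-++⁺ˡ (∈-map⁺ inj₁ (∈-++⁺ˡ (∈-map⁺ inj₁ (∈-allFin v))))
        ∈-all (inj₁ (inj₂ c)) = ∈-++⁺ˡ (∈-map⁺ inj₁ (∈-++⁺ʳ vertices (∈-map⁺ inj₂ (∈-allFin c))))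
        ∈-all (inj₂ u)        = ∈-++⁺ʳ (List.map inj₁ (vertices ++ colours)) (∈-map⁺ inj₂ (∈-allFin u))
        y : I → Fin C → Fin a → ℚ
        y (inj₁ w) c′ x = ∑₂ (λ c i → ⟦ inc w c i ⟧ * ⟦ meet w c i c′ x ⟧)
        y (inj₂ u) c′ x = ⟦ edge c′ x u ⟧
        y-natural : ∀ i c x → Natural (y i c x)
        y-natural (inj₁ w) c′ x = ∑-natural (λ c → ∑-natural (λ i → *-natural (⟦⟧-natural (inc w c i)) (⟦⟧-natural (meet w c i c′ x))))
        y-natural (inj₂ u) c′ x = ⟦⟧-natural (edge c′ x u)
        y-nonneg : ∀ i c x → 0ℚ ≤ y i c x
        y-nonneg (inj₁ w) c′ x = ∑₂-nonneg (λ c i → *-nonneg (⟦⟧-nonneg (inc w c i)) (⟦⟧-nonneg (meet w c i c′ x)))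
        y-nonneg (inj₂ u) c′ x = ⟦⟧-nonneg (edge c′ x u)
        B μ τ : I → ℚ
        B (inj₁ _) = r * K
        B (inj₂ _) = 1ℚ
        μ (inj₁ _) = r * d
        μ (inj₂ _) = 1ℚ
        τ (inj₁ _) = t
        τ (inj₂ _) = L
        y≤B : ∀ i c x → y i c x ≤ B i
        y≤B (inj₁ w) c x = inc-meet≤rK bounded 0≤d 0≤K w c x
        y≤B (inj₂ u) c x = ⟦⟧≤1 (edge c x u)
        0<B : ∀ i → 0ℚ < B i
        0<B (inj₁ _) = <-≤-trans 0<1 (1≤r* 1≤K)
        0<B (inj₂ _) = 0<1
        B≤μ : ∀ i → B i ≤ μ i
        B≤μ (inj₁ _) = *-monoˡ 0≤r K≤d
        B≤μ (inj₂ _) = ≤-refl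
        mean-w : ∀ w → ∑ (λ c′ → avg (y (inj₁ w) c′)) ≡ inv a * ∑₂ (λ c i → ⟦ inc w c i ⟧ * N w c i)
        mean-w w = trans (sym (*-∑ (inv a) (λ c′ → ∑ (y (inj₁ w) c′)))) (cong (inv a *_) (sym (trans
          (∑₂-cong (λ c i → trans (*-∑₂ ⟦ inc w c i ⟧ (λ c′ x → ⟦ meet w c i c′ x ⟧)) refl))
          (trans (∑₂-∑-comm (λ c i c′ → ∑ (λ x → ⟦ inc w c i ⟧ * ⟦ meet w c i c′ x ⟧)))
            (∑-cong (λ c′ → ∑₂-∑-comm (λ c i x → ⟦ inc w c i ⟧ * ⟦ meet w c i c′ x ⟧)))))))
        shrink : ∀ {x b} → 0ℚ ≤ b → x ≤ ι a * b → inv a * x ≤ b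
        shrink {x} {b} 0≤b h = ≤-trans (*-monoˡ (<⇒≤ (0<inv a)) h) (≤-reflexive (trans (sym (*-assoc (inv a) (ι a) b)) (trans (cong (_* b) (trans (*-comm (inv a) (ι a)) (ι*inv a))) (*-identityˡ b))))
        mean≤μ : ∀ i → ∑ (λ c → avg (y i c)) ≤ μ i
        mean≤μ (inj₁ w) = ≤-trans (≤-reflexive (mean-w w)) (shrink 0≤rd (≤-trans (∑₂-mono (λ c i → *-monoˡ (⟦⟧-nonneg (inc w c i)) (N≤rd bounded 0≤d 0≤K w c i)))
          (≤-trans (≤-reflexive (sym (∑₂-* (λ c i → ⟦ inc w c i ⟧) (r * d)))) (*-monoʳ 0≤rd (inc-count bounded d≤a w)))))
        mean≤μ (inj₂ u) = ≤-trans (≤-reflexive (sym (*-∑ (inv a) (λ c → ∑ (λ x → ⟦ edge c x u ⟧))))) (shrink 0≤1 (≤-trans (deg u) (≤-trans d≤a (≤-reflexive (sym (*-identityʳ (ι a)))))))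
        μ≤rd : ∀ i → μ i ≤ r * d
        μ≤rd (inj₁ _) = ≤-refl
        μ≤rd (inj₂ _) = 1≤rd
        0<τ : ∀ i → 0ℚ < τ i
        0<τ (inj₁ _) = 0<t
        0<τ (inj₂ _) = 0<L
        τ-large : ∀ i → ℤ.+ 44 / 1 * (ι (suc k) * ι (suc k)) * B i * μ i * L ≤ τ i * τ i
        τ-large (inj₁ _) = t-large
        τ-large (inj₂ _) = L-large
        -- Total price of one choice: the edge meets at most `r d` others, each of which is counted
        -- at up to `r` vertices and at its colour; in addition it hits up to `r` vertices itself.
        Δ = r * (r * d) + r * d + r
        1≤Δ : 1ℚ ≤ Δ
        1≤Δ = ≤-trans 1≤r (≤-by _ (+-nonneg (*-nonneg 0≤r 0≤rd) 0≤rd) (+-comm (r * (r * d) + r * d) r))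
        Σy≤Δ : ∀ c′ x → ∑ˡ all (λ i → y i c′ x) ≤ Δ
        Σy≤Δ c′ x = ≤-trans (≤-reflexive (∑ˡ-all (λ i → y i c′ x))) (+-mono-≤ (+-mono-≤ vertex-part colour-part) (size c′ x))
          where
          column : ∑₂ (λ c i → ⟦ clash c i c′ x ⟧) ≤ r * d
          column = N-column≤rd bounded 0≤d 0≤K (inj₂ c′) c′ x
          vertex-part : ∑ (λ v → y (inj₁ (inj₁ v)) c′ x) ≤ r * (r * d)
          vertex-part = ≤-trans (∑-mono (λ v → ∑₂-mono (λ c i → *-monoˡ (⟦⟧-nonneg (edge c i v)) (meet⇒clash (inj₁ v) c i c′ x))))
            (≤-trans (≤-reflexive (sym (∑₂-∑-comm (λ c i v → ⟦ edge c i v ⟧ * ⟦ clash c i c′ x ⟧))))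
            (≤-trans (∑₂-mono (λ c i → ≤-trans (≤-reflexive (sym (∑-* (λ v → ⟦ edge c i v ⟧) ⟦ clash c i c′ x ⟧))) (*-monoʳ (⟦⟧-nonneg (clash c i c′ x)) (size c i))))
            (≤-trans (≤-reflexive (sym (*-∑₂ r (λ c i → ⟦ clash c i c′ x ⟧)))) (*-monoˡ 0≤r column))))
          colour-part : ∑ (λ c₀ → y (inj₁ (inj₂ c₀)) c′ x) ≤ r * d
          colour-part = ≤-trans (≤-reflexive (sym (∑₂-∑-comm (λ c i c₀ → ⟦ c == c₀ ⟧ * ⟦ clash c i c′ x ⟧))))
            (≤-trans (≤-reflexive (∑₂-cong (λ c i → trans (∑-cong (λ c₀ → cong (λ b → ⟦ b ⟧ * ⟦ clash c i c′ x ⟧) (==-comm c c₀))) (∑-select c (λ _ → ⟦ clash c i c′ x ⟧))))) column)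

      -- All statistics are linear in the choices. Those at `w` have mean at most `r d`, because at
      -- most `a` edges are incident with `w`, each is met by at most `r d` edges, and each of these
      -- is chosen with probability `1 / a`. The expected number of chosen edges at a vertex is at
      -- most `d / a ≤ 1`, which with tolerance `L` gives `1ℚ + L`.
      spread-picks : Σ (Fin C → Fin a) (Spread d t (1ℚ + L))
      spread-picks = conclude (concentrate k all (λ i → linear (y i)) y B μ τ L (r * d) Δ
          (λ i → linear-lipschitz (y i) (y-nonneg i)) y-nonneg (λ i c x → natural⇒1≤ (y-natural i c x)) y≤B 0<B B≤μ mean≤μ μ≤rd 0<τ τ-large
          Σy≤Δ (≤-trans 0≤1 1≤Δ) (<⇒≤ 0<L) (*-mono {1ℚ} {_} {1ℚ} (*-nonneg (ι-nonneg a) 0≤rd) 0≤1 (1≤a* 1≤rd) (1≤a* 1≤Δ)) k-large)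
        where
        1≤a*_ : ∀ {x} → 1ℚ ≤ x → 1ℚ ≤ ι a * x
        1≤a* 1≤x = *-mono {1ℚ} {ι a} {1ℚ} (ι-nonneg a) 0≤1 (1≤ι-nonZero a) 1≤x
        conclude : (∃ λ ω → ∀ i → i ∈ all → (linear (y i) ω - 𝔼 (linear (y i))) * (linear (y i) ω - 𝔼 (linear (y i))) < τ i * τ i) → Σ (Fin C → Fin a) (Spread d t (1ℚ + L))
        conclude (ω , close) = lookup ω , record { colour-upper = cu ; vertex-lower = vl ; hits-upper = hu }
          where
          pk = lookup ω
          linear≡H : ∀ w → linear (y (inj₁ w)) ω ≡ ∑₂ (λ c i → ⟦ inc w c i ⟧ * H pk w c i)
          linear≡H w = trans (sym (∑₂-∑-comm (λ c i c′ → ⟦ inc w c i ⟧ * ⟦ meet w c i c′ (pk c′) ⟧))) (∑₂-cong (λ c i → sym (*-∑ ⟦ inc w c i ⟧ (λ c′ → ⟦ meet w c i c′ (pk c′) ⟧))))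
          select : ∀ c₀ (g : Fin C → Fin a → ℚ) → ∑₂ (λ c i → ⟦ c == c₀ ⟧ * g c i) ≡ ∑ (g c₀)
          select c₀ g = trans (∑-cong (λ c → sym (*-∑ ⟦ c == c₀ ⟧ (g c)))) (∑-select c₀ (λ c → ∑ (g c)))
          cu : ∀ c → ∑ (λ i → H pk (inj₂ c) c i) ≤ inv a * ∑ (λ i → N (inj₂ c) c i) + t
          cu c = subst₂ (λ x e → x ≤ e + t) (trans (linear≡H (inj₂ c)) (select c (H pk (inj₂ c))))
            (trans (𝔼-linear (y (inj₁ (inj₂ c)))) (trans (mean-w (inj₂ c)) (cong (inv a *_) (select c (N (inj₂ c))))))
            (deviation-upper 0<t (close (inj₁ (inj₂ c)) (∈-all _)))
          vl : ∀ v → inv a * ∑₂ (λ c i → ⟦ edge c i v ⟧ * N (inj₁ v) c i) ≤ ∑₂ (λ c i → ⟦ edge c i v ⟧ * H pk (inj₁ v) c i) + t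
          vl v = subst₂ (λ x e → e ≤ x + t) (linear≡H (inj₁ v)) (trans (𝔼-linear (y (inj₁ (inj₁ v)))) (mean-w (inj₁ v)))
            (deviation-lower {x = linear (y (inj₁ (inj₁ v))) ω} 0<t (close (inj₁ (inj₁ v)) (∈-all _)))
          hu : ∀ u → hits pk u ≤ 1ℚ + L
          hu u = ≤-trans (deviation-upper 0<L (close (inj₂ u) (∈-all _))) (+-monoˡ-≤ L (≤-trans (≤-reflexive (𝔼-linear (y (inj₂ u)))) (mean≤μ (inj₂ u))))

  -- Second stage of a nibble step: activation and trimming

  ∑-++ : ∀ m {n} (f : Fin (m ℕ.+ n) → ℚ) → ∑ f ≡ ∑ (λ i → f (i ↑ˡ n)) + ∑ (λ j → f (m ↑ʳ j))
  ∑-++ zero    f = sym (+-identityˡ (∑ f))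
  ∑-++ (suc m) f = trans (cong (f zero +_) (∑-++ m (λ i → f (suc i)))) (sym (+-assoc (f zero) _ _))

  ∑-combine : ∀ m {n} (f : Fin (m ℕ.* n) → ℚ) → ∑ f ≡ ∑₂ (λ (i : Fin m) (j : Fin n) → f (combine i j))
  ∑-combine zero    f = refl
  ∑-combine (suc m) {n} f = trans (∑-++ n f) (cong (∑ (λ j → f (j ↑ˡ (m ℕ.* n))) +_) (∑-combine m (λ j → f (n ↑ʳ j))))

  ∏ : ∀ {n} → (Fin n → ℚ) → ℚ
  ∏ {zero}  f = 1ℚ
  ∏ {suc n} f = f zero * ∏ (λ i → f (suc i))

  ∏-nonneg : ∀ {n} {f : Fin n → ℚ} → (∀ i → 0ℚ ≤ f i) → 0ℚ ≤ ∏ f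
  ∏-nonneg {zero}  h = 0≤1
  ∏-nonneg {suc n} h = *-nonneg (h zero) (∏-nonneg (λ i → h (suc i)))

  ∏≤1 : ∀ {n} {f : Fin n → ℚ} → (∀ i → 0ℚ ≤ f i) → (∀ i → f i ≤ 1ℚ) → ∏ f ≤ 1ℚ
  ∏≤1 {zero}  h h′ = ≤-refl
  ∏≤1 {suc n} h h′ = *-mono {q′ = 1ℚ} 0≤1 (∏-nonneg (λ i → h (suc i))) (h′ zero) (∏≤1 (λ i → h (suc i)) (λ i → h′ (suc i)))

  ∏≡1 : ∀ {n} {f : Fin n → ℚ} → (∀ i → f i ≡ 1ℚ) → ∏ f ≡ 1ℚ
  ∏≡1 {zero}  h = refl
  ∏≡1 {suc n} h = cong₂ _*_ (h zero) (∏≡1 (λ i → h (suc i)))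

  ∏-cong : ∀ {n} {f g : Fin n → ℚ} → (∀ i → f i ≡ g i) → ∏ f ≡ ∏ g
  ∏-cong {zero}  h = refl
  ∏-cong {suc n} h = cong₂ _*_ (h zero) (∏-cong (λ i → h (suc i)))

  -- A truncated inclusion-exclusion. The rates summed later are of order `θ`, so the square is a
  -- second-order error.
  ∏[1-p]≤ : ∀ {n} (p : Fin n → ℚ) → (∀ i → 0ℚ ≤ p i) → (∀ i → p i ≤ 1ℚ) → ∏ (λ i → 1ℚ - p i) ≤ 1ℚ - ∑ p + ∑ p * ∑ p
  ∏[1-p]≤ {zero}  p 0≤p p≤1 = ≤-refl
  ∏[1-p]≤ {suc n} p 0≤p p≤1 = ≤-trans (*-monoˡ (p≤q⇒0≤q-p (p≤1 zero)) (∏[1-p]≤ (λ i → p (suc i)) (λ i → 0≤p (suc i)) (λ i → p≤1 (suc i))))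
    (≤-by _ (+-nonneg (*-nonneg 0≤x (sq-nonneg S)) (+-nonneg (*-nonneg 0≤x 0≤S) (sq-nonneg x))) (eq x S))
    where
    x = p zero
    S = ∑ (λ i → p (suc i))
    0≤x = 0≤p zero
    0≤S = ∑-nonneg (λ i → 0≤p (suc i))
    eq : ∀ x S → 1ℚ - (x + S) + (x + S) * (x + S) ≡ (1ℚ - x) * (1ℚ - S + S * S) + (x * (S * S) + (x * S + x * x))
    eq = solve-∀ ℚ-ring

  -- An event with exactly `T` favourable values, used to realise prescribed rational probabilities
  -- on a uniform space.
  below : ∀ {n} → ℕ → Fin n → Bool
  below zero    x       = false
  below (suc T) zero    = true
  below (suc T) (suc x) = below T x

  ∑-below : ∀ {n} T → T ℕ.≤ n → ∑ {n} (λ x → ⟦ below T x ⟧) ≡ ι T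
  ∑-below {n} zero T≤n = ∑-zero {n} (λ _ → refl)
  ∑-below (suc T) (ℕ.s≤s T≤n) = cong (1ℚ +_) (∑-below T T≤n)

  inv-* : ∀ m n .{{_ : ℕ.NonZero m}} .{{_ : ℕ.NonZero n}} .{{_ : ℕ.NonZero (m ℕ.* n)}} → inv (m ℕ.* n) ≡ inv m * inv n
  inv-* m n = trans (sym (*-identityʳ (inv (m ℕ.* n)))) (trans (cong (inv (m ℕ.* n) *_) (sym (trans (regroup (ι m) (ι n) (inv m) (inv n)) (cong₂ _*_ (ι*inv m) (ι*inv n)))))
    (trans (sym (*-assoc (inv (m ℕ.* n)) (ι m * ι n) (inv m * inv n))) (trans (cong (_* (inv m * inv n)) (trans (*-comm (inv (m ℕ.* n)) (ι m * ι n)) (trans (cong (_* inv (m ℕ.* n)) (sym (ι-* m n))) (ι*inv (m ℕ.* n))))) (*-identityˡ (inv m * inv n)))))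
    where
    regroup : ∀ a b c d → a * b * (c * d) ≡ (a * c) * (b * d)
    regroup = solve-∀ ℚ-ring

  module LipschitzCalculus (s : ℕ) .{{_ : ℕ.NonZero s}} where
    open Expectation s
    open Concentration s

    lipschitz-mono : ∀ {N} {f : Ω N → ℚ} {y y′} → Lipschitz f y → (∀ j x → y j x ≤ y′ j x) → Lipschitz f y′
    lipschitz-mono lip h ω j x x′ = ≤-trans (lip ω j x x′) (+-mono-≤ (h j x) (h j x′))

    lipschitz-+ : ∀ {N} {f g : Ω N → ℚ} {y z} → Lipschitz f y → Lipschitz g z → Lipschitz (λ ω → f ω + g ω) (λ j x → y j x + z j x)
    lipschitz-+ {f = f} {g} {y} {z} lf lg ω j x x′ = ≤-trans (≤-reflexive (e₁ (f (ω [ j ]≔ x)) (g (ω [ j ]≔ x)) (f (ω [ j ]≔ x′)) (g (ω [ j ]≔ x′))))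
      (≤-trans (+-mono-≤ (lf ω j x x′) (lg ω j x x′)) (≤-reflexive (e₂ (y j x) (y j x′) (z j x) (z j x′))))
      where
      e₁ : ∀ a b c d → (a + b) - (c + d) ≡ (a - c) + (b - d)
      e₁ = solve-∀ ℚ-ring
      e₂ : ∀ a b c d → (a + b) + (c + d) ≡ (a + c) + (b + d)
      e₂ = solve-∀ ℚ-ring

    lipschitz-* : ∀ {N} {f : Ω N → ℚ} {y} c → 0ℚ ≤ c → Lipschitz f y → Lipschitz (λ ω → c * f ω) (λ j x → c * y j x)
    lipschitz-* {f = f} {y} c 0≤c lf ω j x x′ = ≤-trans (≤-reflexive (e₁ c (f (ω [ j ]≔ x)) (f (ω [ j ]≔ x′))))
      (≤-trans (*-monoˡ 0≤c (lf ω j x x′)) (≤-reflexive (*-distribˡ-+ c (y j x) (y j x′))))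
      where
      e₁ : ∀ c a b → c * a - c * b ≡ c * (a - b)
      e₁ = solve-∀ ℚ-ring

    lipschitz-∑ : ∀ {N n} {f : Fin n → Ω N → ℚ} {y : Fin n → Fin N → Fin s → ℚ} → (∀ i → Lipschitz (f i) (y i)) → Lipschitz (λ ω → ∑ (λ i → f i ω)) (λ j x → ∑ (λ i → y i j x))
    lipschitz-∑ {f = f} {y} lf ω j x x′ = ≤-trans (≤-reflexive (sym (∑-- (λ i → f i (ω [ j ]≔ x)) (λ i → f i (ω [ j ]≔ x′)))))
      (≤-trans (∑-mono (λ i → lf i ω j x x′)) (≤-reflexive (∑-distrib-+ (λ i → y i j x) (λ i → y i j x′))))

    -- The change of a product splits as `f * (g - g′) + (f - f′) * g′`, where the factor that
    -- stands still is at most 1 or at most `G`.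
    lipschitz-product : ∀ {N} {f g : Ω N → ℚ} {y z} G → 0ℚ ≤ G → (∀ ω → 0ℚ ≤ f ω) → (∀ ω → f ω ≤ 1ℚ) → (∀ ω → 0ℚ ≤ g ω) → (∀ ω → g ω ≤ G) →
      (∀ j x → 0ℚ ≤ y j x) → (∀ j x → 0ℚ ≤ z j x) → Lipschitz f y → Lipschitz g z → Lipschitz (λ ω → f ω * g ω) (λ j x → G * y j x + z j x)
    lipschitz-product {f = f} {g} {y} {z} G 0≤G 0≤f f≤1 0≤g g≤G 0≤y 0≤z lf lg ω j x x′ =
      ≤-by _ (+-nonneg (+-nonneg (*-nonneg (0≤f ω₁) (p≤q⇒0≤q-p (lg ω j x x′))) (*-nonneg (p≤q⇒0≤q-p (f≤1 ω₁)) (+-nonneg (0≤z j x) (0≤z j x′))))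
                       (+-nonneg (*-nonneg (0≤g ω₂) (p≤q⇒0≤q-p (lf ω j x x′))) (*-nonneg (p≤q⇒0≤q-p (g≤G ω₂)) (+-nonneg (0≤y j x) (0≤y j x′)))))
        (eq (f ω₁) (g ω₁) (f ω₂) (g ω₂) (y j x) (y j x′) (z j x) (z j x′) G)
      where
      ω₁ = ω [ j ]≔ x
      ω₂ = ω [ j ]≔ x′
      eq : ∀ f g f′ g′ y y′ z z′ G → (G * y + z) + (G * y′ + z′) ≡ (f * g - f′ * g′) +
           ((f * ((z + z′) - (g - g′)) + (1ℚ - f) * (z + z′)) + (g′ * ((y + y′) - (f - f′)) + (G - g′) * (y + y′)))
      eq = solve-∀ ℚ-ring

    lipschitz-coordinate : ∀ {N} (j₀ : Fin N) (g : Fin s → ℚ) → (∀ x → 0ℚ ≤ g x) → Lipschitz (λ ω → g (lookup ω j₀)) (λ j x → ⟦ j == j₀ ⟧ * g x)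
    lipschitz-coordinate j₀ g 0≤g ω j x x′ with j ≟ᶠ j₀
    ... | yes refl rewrite lookup∘update j ω x | lookup∘update j ω x′ | ==-refl j = ≤-by (2ℚ * g x′) (*-nonneg (0≤ 2) (0≤g x′)) (eq (g x) (g x′))
      where
      eq : ∀ a b → 1ℚ * a + 1ℚ * b ≡ (a - b) + 2ℚ * b
      eq = solve-∀ ℚ-ring
    ... | no j≢j₀ rewrite lookup∘update′ (λ eq → j≢j₀ (sym eq)) ω x | lookup∘update′ (λ eq → j≢j₀ (sym eq)) ω x′ =
      ≤-trans (≤-reflexive (+-inverseʳ (g (lookup ω j₀)))) (+-nonneg (*-nonneg (⟦⟧-nonneg (j == j₀)) (0≤g x)) (*-nonneg (⟦⟧-nonneg (j == j₀)) (0≤g x′)))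

    -- A coordinate enters a single factor, and the other factors lie between 0 and 1.
    lipschitz-∏ : ∀ {N} (b : Fin N → Fin s → ℚ) → (∀ j x → 0ℚ ≤ b j x) → (∀ j x → b j x ≤ 1ℚ) → Lipschitz (λ ω → ∏ (λ j → 1ℚ - b j (lookup ω j))) b
    lipschitz-∏ {suc N} b 0≤b b≤1 (x₀ ∷ ω) zero x x′ = ≤-by _ (+-nonneg (*-nonneg (0≤b zero x) (+-nonneg 0≤1 0≤R)) (*-nonneg (0≤b zero x′) (p≤q⇒0≤q-p R≤1))) (eq (b zero x) (b zero x′) R)
      where
      R = ∏ (λ j → 1ℚ - b (suc j) (lookup ω j))
      0≤R : 0ℚ ≤ R
      0≤R = ∏-nonneg (λ j → p≤q⇒0≤q-p (b≤1 (suc j) (lookup ω j)))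
      R≤1 : R ≤ 1ℚ
      R≤1 = ∏≤1 (λ j → p≤q⇒0≤q-p (b≤1 (suc j) (lookup ω j))) (λ j → ≤-by (b (suc j) (lookup ω j)) (0≤b (suc j) (lookup ω j)) (back (b (suc j) (lookup ω j))))
        where
        back : ∀ x → 1ℚ ≡ (1ℚ - x) + x
        back = solve-∀ ℚ-ring
      eq : ∀ a b R → a + b ≡ ((1ℚ - a) * R - (1ℚ - b) * R) + (a * (1ℚ + R) + b * (1ℚ - R))
      eq = solve-∀ ℚ-ring
    lipschitz-∏ {suc N} b 0≤b b≤1 (x₀ ∷ ω) (suc j) x x′ = ≤-trans (≤-reflexive (e₁ u P P′))
        (≤-by _ (+-nonneg (*-nonneg 0≤u (p≤q⇒0≤q-p IH)) (*-nonneg (0≤b zero x₀) (+-nonneg (0≤b (suc j) x) (0≤b (suc j) x′)))) (e₂ (b zero x₀) (b (suc j) x) (b (suc j) x′) (P - P′)))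
      where
      u = 1ℚ - b zero x₀
      0≤u = p≤q⇒0≤q-p (b≤1 zero x₀)
      P = ∏ (λ i → 1ℚ - b (suc i) (lookup (ω [ j ]≔ x) i))
      P′ = ∏ (λ i → 1ℚ - b (suc i) (lookup (ω [ j ]≔ x′) i))
      IH : P - P′ ≤ b (suc j) x + b (suc j) x′
      IH = lipschitz-∏ (λ i → b (suc i)) (λ i → 0≤b (suc i)) (λ i → b≤1 (suc i)) ω j x x′
      e₁ : ∀ u p q → u * p - u * q ≡ u * (p - q)
      e₁ = solve-∀ ℚ-ring
      e₂ : ∀ v y y′ D → y + y′ ≡ (1ℚ - v) * D + ((1ℚ - v) * ((y + y′) - D) + v * (y + y′))
      e₂ = solve-∀ ℚ-ring

    𝔼-∏ : ∀ {N} (g : Fin N → Fin s → ℚ) → 𝔼 (λ ω → ∏ (λ j → g j (lookup ω j))) ≡ ∏ (λ j → avg (g j))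
    𝔼-∏ {zero}  g = refl
    𝔼-∏ {suc N} g = trans (avg-cong (λ x → trans (𝔼-* (g zero x) (λ ω → ∏ (λ j → g (suc j) (lookup ω j)))) (trans (cong (g zero x *_) (𝔼-∏ (λ j → g (suc j)))) (*-comm (g zero x) R))))
      (trans (avg-* R (g zero)) (*-comm R (avg (g zero))))
      where R = ∏ (λ j → avg (g (suc j)))

  -- Choosing an edge for every colour first, and activating a few colours only afterwards, leaves each chosen edge in clash with
  -- at most r h others. Otherwise the number of activated but unmatched colours would not be a Lipschitz statistic.
  influence crowding : ℚ → ℚ → ℚ
  influence r h = 1ℚ + 2ℚ * r + 3ℚ * (r * h)
  crowding r h = (1ℚ + r + r * h) * (1ℚ + r + r * h) + r * h

  -- Bounds the total price of one activation or coin over all colours and vertices. It serves only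
  -- for the dependency degree, so a crude bound is enough.
  reach : ℚ → ℚ → ℚ → ℚ → ℚ
  reach r h d a = r * d + r * (r * d + a * (1ℚ + 2ℚ * (r * h))) + (1ℚ + r)

  module Trimming {C a V} .{{_ : ℕ.NonZero a}} (edge : Family C a V) (Θ : ℕ) .{{_ : ℕ.NonZero Θ}} (pk : Fin C → Fin a) where
    open Incidence edge
    open Picks edge

    θ α : ℚ
    θ = inv Θ
    α = inv a

    blocked : (Fin C → Bool) → Fin C → Fin a → Bool
    blocked act c i = any (λ c′ → clash c i c′ (pk c′) ∧ act c′)

    alive : (Fin C → Bool) → (Fin C → Fin a → Bool) → Fin C → Fin a → Bool
    alive act coin c i = not (coin c i) ∧ not (blocked act c i)

    retained : (Fin C → Bool) → Fin C → Bool
    retained act c = act c ∧ not (blocked act c (pk c))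

    -- An edge at `v` is lost at rate `θ` through its own colour and at rate `θ * α * (r * d - d)`
    -- through hits away from `v`: the equalised rate minus the meetings at `v` itself. The four
    -- units `θ * t` in `degree` are the deviations of the two stages, the second-order terms and
    -- the rounding of the coins; in `loss` the two units are the two deviations.
    record Trimmed (r d t : ℚ) : Set where
      field
        act    : Fin C → Bool
        coin   : Fin C → Fin a → Bool
        loss   : ∀ c → ∑ (λ i → ⟦ not (alive act coin c i) ⟧) ≤ θ * (r * d + 2ℚ * t)
        degree : ∀ v → ∑₂ (λ c i → ⟦ edge c i v ⟧ * ⟦ alive act coin c i ∧ not (retained act c) ⟧) ≤ d - θ * (d + α * (r * d - d) * d) + 4ℚ * (θ * t)

    module _ {r d K t h} (bounded : Bounded edge r d K) (spread : Spread d t h pk)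
             (1≤r : 1ℚ ≤ r) (1≤d : 1ℚ ≤ d) (1≤K : 1ℚ ≤ K) (d≤a : d ≤ ι a) (1≤h : 1ℚ ≤ h) (1≤t : 1ℚ ≤ t) (t≤d : t ≤ d) (r≤Θ : r ≤ ι Θ)
             (k : ℕ) {L : ℚ} (0<L : 0ℚ < L) where
      open Bounded bounded
      open Spread spread

      private
        instance
          s≢0 : ℕ.NonZero (a ℕ.* Θ)
          s≢0 = ℕ.m*n≢0 a Θ
        -- A common denominator for all probabilities: an activation has `a` favourable values and
        -- hence probability `θ`, a coin has `pad` favourable values and hence probability
        -- `pad * α * θ`.
        s = a ℕ.* Θ
        0≤r = ≤-trans 0≤1 1≤r
        0≤d = ≤-trans 0≤1 1≤d
        0≤K = ≤-trans 0≤1 1≤K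
        0≤h = ≤-trans 0≤1 1≤h
        0≤t = ≤-trans 0≤1 1≤t
        0<θ = 0<inv Θ
        0≤θ = <⇒≤ 0<θ
        0≤α = <⇒≤ (0<inv a)
        0≤rd = *-nonneg 0≤r 0≤d
        0≤rh = *-nonneg 0≤r 0≤h
        θ*Θ : θ * ι Θ ≡ 1ℚ
        θ*Θ = trans (*-comm θ (ι Θ)) (ι*inv Θ)
        α*a : α * ι a ≡ 1ℚ
        α*a = trans (*-comm α (ι a)) (ι*inv a)
        inv-s : inv s ≡ α * θ
        inv-s = inv-* a Θ

      open Expectation s
      open Concentration s
      open Linear s
      open LipschitzCalculus s
      open SimultaneousConcentration s

      private
        slack : ∀ c i → 0ℚ ≤ r * d - N (inj₂ c) c i
        slack c i = p≤q⇒0≤q-p (N≤rd bounded 0≤d 0≤K (inj₂ c) c i)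
        -- Coins top up the expected rate at which an edge is hit to r d / a, whatever the degrees of its vertices.
        pad : Fin C → Fin a → ℕ
        pad c i = proj₁ (floor (r * d - N (inj₂ c) c i) (slack c i))
        pad≤ : ∀ c i → ι (pad c i) ≤ r * d - N (inj₂ c) c i
        pad≤ c i = proj₁ (proj₂ (floor (r * d - N (inj₂ c) c i) (slack c i)))
        ≤pad+1 : ∀ c i → r * d - N (inj₂ c) c i ≤ 1ℚ + ι (pad c i)
        ≤pad+1 c i = <⇒≤ (proj₂ (proj₂ (floor (r * d - N (inj₂ c) c i) (slack c i))))
        N-nonneg : ∀ w c i → 0ℚ ≤ N w c i
        N-nonneg w c i = ∑₂-nonneg (λ c′ i′ → ⟦⟧-nonneg (meet w c i c′ i′))
        pad≤rd : ∀ c i → ι (pad c i) ≤ r * d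
        pad≤rd c i = ≤-trans (pad≤ c i) (≤-by (N (inj₂ c) c i) (N-nonneg (inj₂ c) c i) (back (r * d) (N (inj₂ c) c i)))
          where
          back : ∀ x y → x ≡ (x - y) + y
          back = solve-∀ ℚ-ring

        -- Under each colour, index `zero` is its activation and `suc i` is the coin of its edge
        -- `i`.
        P : Set
        P = Fin C × Fin (suc a)
        T : P → ℕ
        T (c , zero)  = a
        T (c , suc i) = pad c i
        T≤s : ∀ p → T p ℕ.≤ s
        T≤s (c , zero)  = ℕ.m≤m*n a Θ
        T≤s (c , suc i) = ι-cancel-≤ (≤-trans (pad≤rd c i) (≤-trans (*-mono (ι-nonneg Θ) 0≤d r≤Θ d≤a) (≤-reflexive (trans (*-comm (ι Θ) (ι a)) (sym (ι-* a Θ))))))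
        on : P → Fin s → Bool
        on p = below (T p)
        prob : P → ℚ
        prob p = inv s * ι (T p)
        avg-on : ∀ p → avg (λ x → ⟦ on p x ⟧) ≡ prob p
        avg-on p = cong (inv s *_) (∑-below (T p) (T≤s p))
        prob-nonneg : ∀ p → 0ℚ ≤ prob p
        prob-nonneg p = *-nonneg (<⇒≤ (0<inv s)) (ι-nonneg (T p))
        prob≤1 : ∀ p → prob p ≤ 1ℚ
        prob≤1 p = ≤-trans (*-monoˡ (<⇒≤ (0<inv s)) (ι-mono (T≤s p))) (≤-reflexive (trans (*-comm (inv s) (ι s)) (ι*inv s)))
        π : Fin C → Fin a → ℚ
        π c i = prob (c , suc i)
        prob-act : ∀ c → prob (c , zero) ≡ θ
        prob-act c = trans (cong (_* ι a) inv-s) (trans (swap α θ (ι a)) (trans (cong (θ *_) α*a) (*-identityʳ θ)))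
          where
          swap : ∀ x y z → x * y * z ≡ y * (x * z)
          swap = solve-∀ ℚ-ring
        rq : Fin (C ℕ.* suc a) → P
        rq = remQuot (suc a)
        cb : P → Fin (C ℕ.* suc a)
        cb (c , q) = combine c q
        cb-rq : ∀ j → cb (rq j) ≡ j
        cb-rq j = combine-remQuot {C} (suc a) j
        flatten : ∀ (Y : P → ℚ) → ∑ (λ j → Y (rq j)) ≡ ∑ (λ c → Y (c , zero) + ∑ (λ i → Y (c , suc i)))
        flatten Y = trans (∑-combine C (λ j → Y (rq j))) (∑₂-cong (λ c q → cong Y (remQuot-combine c q)))
        st : Ω (C ℕ.* suc a) → P → Bool
        st ω p = on p (lookup ω (cb p))
        on-lookup : ∀ ω j → on (rq j) (lookup ω j) ≡ st ω (rq j)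
        on-lookup ω j = cong (λ j′ → on (rq j) (lookup ω j′)) (sym (cb-rq j))

        cl : Fin C → ℚ
        cl c = H pk (inj₂ c) c (pk c)
        cl-nonneg : ∀ c → 0ℚ ≤ cl c
        cl-nonneg c = ∑-nonneg (λ c′ → ⟦⟧-nonneg (clash c (pk c) c′ (pk c′)))
        -- Prices by coordinate: `δ` for the colour's own activation, `m₀` for the activation of a
        -- chosen edge clashing with its chosen edge, `m` for whatever kills the edge `i` as seen
        -- from `v`. In `n`, the price of `S₂`, the own activation is weighted by the number `cl c`
        -- of possible clashes.
        δ m₀ : Fin C → P → ℚ
        δ c (c′ , zero)  = ⟦ c′ == c ⟧
        δ c (c′ , suc _) = 0ℚ
        m₀ c (c′ , zero)  = ⟦ clash c (pk c) c′ (pk c′) ⟧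
        m₀ c (c′ , suc _) = 0ℚ
        m : Fin V → Fin C → Fin a → P → ℚ
        m v c i (c′ , zero)   = ⟦ meet (inj₁ v) c i c′ (pk c′) ⟧ + ⟦ c′ == c ⟧
        m v c i (c′ , suc i′) = ⟦ c′ == c ⟧ * ⟦ i′ == i ⟧
        n : Fin C → P → ℚ
        n c p = cl c * δ c p + m₀ c p
        δ-nonneg : ∀ c p → 0ℚ ≤ δ c p
        δ-nonneg c (c′ , zero)  = ⟦⟧-nonneg (c′ == c)
        δ-nonneg c (c′ , suc _) = ≤-refl
        m₀-nonneg : ∀ c p → 0ℚ ≤ m₀ c p
        m₀-nonneg c (c′ , zero)  = ⟦⟧-nonneg (clash c (pk c) c′ (pk c′))
        m₀-nonneg c (c′ , suc _) = ≤-refl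
        m-nonneg : ∀ v c i p → 0ℚ ≤ m v c i p
        m-nonneg v c i (c′ , zero)   = +-nonneg (⟦⟧-nonneg (meet (inj₁ v) c i c′ (pk c′))) (⟦⟧-nonneg (c′ == c))
        m-nonneg v c i (c′ , suc i′) = *-nonneg (⟦⟧-nonneg (c′ == c)) (⟦⟧-nonneg (i′ == i))
        -- The two summands exclude each other, as edges of the same colour never meet.
        m≤1 : ∀ v c i p → m v c i p ≤ 1ℚ
        m≤1 v c i (c′ , suc i′) = *-mono {q′ = 1ℚ} 0≤1 (⟦⟧-nonneg (i′ == i)) (⟦⟧≤1 (c′ == c)) (⟦⟧≤1 (i′ == i))
        m≤1 v c i (c′ , zero) with c′ == c in eq
        ... | false = ≤-trans (≤-reflexive (+-identityʳ ⟦ meet (inj₁ v) c i c′ (pk c′) ⟧)) (⟦⟧≤1 (meet (inj₁ v) c i c′ (pk c′)))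
        ... | true rewrite ==⇒≡ c′ c eq | ==-refl c = ≤-refl

        I = Fin C ⊎ Fin V
        all : List I
        all = List.map inj₁ (allFin C) ++ List.map inj₂ (allFin V)
        ∑ˡ-all : ∀ f → ∑ˡ all f ≡ ∑ (λ c → f (inj₁ c)) + ∑ (λ v → f (inj₂ v))
        ∑ˡ-all f = trans (∑ˡ-++ (List.map inj₁ (allFin C)) _ f) (cong₂ _+_ (trans (∑ˡ-map inj₁ (allFin C) f) (∑ˡ-allFin C _)) (trans (∑ˡ-map inj₂ (allFin V) f) (∑ˡ-allFin V _)))
        ∈-all : ∀ i → i ∈ all
        ∈-all (inj₁ c) = ∈-++⁺ˡ (∈-map⁺ inj₁ (∈-allFin c))
        ∈-all (inj₂ v) = ∈-++⁺ʳ (List.map inj₁ (allFin C)) (∈-map⁺ inj₂ (∈-allFin v))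

        Y : I → P → ℚ
        Y (inj₁ c₀) (c′ , zero)  = ∑ (λ i → ⟦ clash c₀ i c′ (pk c′) ⟧)
        Y (inj₁ c₀) (c′ , suc _) = ⟦ c′ == c₀ ⟧
        Y (inj₂ v) p = ∑₂ (λ c i → ⟦ edge c i v ⟧ * (m v c i p + n c p))
        y : I → Fin (C ℕ.* suc a) → Fin s → ℚ
        y i j x = Y i (rq j) * ⟦ on (rq j) x ⟧
        Y-natural : ∀ i p → Natural (Y i p)
        Y-natural (inj₁ c₀) (c′ , zero)  = ∑-natural (λ i → ⟦⟧-natural (clash c₀ i c′ (pk c′)))
        Y-natural (inj₁ c₀) (c′ , suc _) = ⟦⟧-natural (c′ == c₀)
        Y-natural (inj₂ v) p = ∑-natural (λ c → ∑-natural (λ i → *-natural (⟦⟧-natural (edge c i v)) (+-natural (m-natural c i p) (+-natural (*-natural (∑-natural (λ c′ → ⟦⟧-natural (clash c (pk c) c′ (pk c′)))) (δ-natural c p)) (m₀-natural c p)))))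
          where
          m-natural : ∀ c i p → Natural (m v c i p)
          m-natural c i (c′ , zero)   = +-natural (⟦⟧-natural (meet (inj₁ v) c i c′ (pk c′))) (⟦⟧-natural (c′ == c))
          m-natural c i (c′ , suc i′) = *-natural (⟦⟧-natural (c′ == c)) (⟦⟧-natural (i′ == i))
          δ-natural : ∀ c p → Natural (δ c p)
          δ-natural c (c′ , zero)  = ⟦⟧-natural (c′ == c)
          δ-natural c (c′ , suc _) = 0 , refl
          m₀-natural : ∀ c p → Natural (m₀ c p)
          m₀-natural c (c′ , zero)  = ⟦⟧-natural (clash c (pk c) c′ (pk c′))
          m₀-natural c (c′ , suc _) = 0 , refl
        Y-nonneg : ∀ i p → 0ℚ ≤ Y i p
        Y-nonneg i p with Y-natural i p
        ... | k , eq = subst (0ℚ ≤_) (sym eq) (ι-nonneg k)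
        y-nonneg : ∀ i j x → 0ℚ ≤ y i j x
        y-nonneg i j x = *-nonneg (Y-nonneg i (rq j)) (⟦⟧-nonneg (on (rq j) x))
        y-natural : ∀ i j x → Natural (y i j x)
        y-natural i j x = *-natural (Y-natural i (rq j)) (⟦⟧-natural (on (rq j) x))
        y≤Y : ∀ i j x → y i j x ≤ Y i (rq j)
        y≤Y i j x = ≤-trans (*-monoˡ (Y-nonneg i (rq j)) (⟦⟧≤1 (on (rq j) x))) (≤-reflexive (*-identityʳ (Y i (rq j))))
        avg-y : ∀ i j → avg (y i j) ≡ Y i (rq j) * prob (rq j)
        avg-y i j = trans (avg-* (Y i (rq j)) (λ x → ⟦ on (rq j) x ⟧)) (cong (Y i (rq j) *_) (avg-on (rq j)))
        mean : ∀ i → ∑ (λ j → avg (y i j)) ≡ ∑ (λ c → Y i (c , zero) * θ + ∑ (λ i′ → Y i (c , suc i′) * π c i′))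
        mean i = trans (∑-cong (avg-y i)) (trans (flatten (λ p → Y i p * prob p)) (∑-cong (λ c → cong (λ q → Y i (c , zero) * q + ∑ (λ i′ → Y i (c , suc i′) * π c i′)) (prob-act c))))

        A : Fin C → Ω (C ℕ.* suc a) → ℚ
        A c ω = ⟦ st ω (c , zero) ⟧
        g : Fin C → Ω (C ℕ.* suc a) → ℚ
        g c ω = ∑ (λ c′ → ⟦ clash c (pk c) c′ (pk c′) ⟧ * A c′ ω)
        -- S₁: nothing hits the edge; S₂: its colour is activated but not matched. Hits at v itself are ignored in S₁, so that the effect
        -- of one activation on the degree of v is bounded by codegrees.
        S₁ : Fin V → Fin C → Fin a → Ω (C ℕ.* suc a) → ℚ
        S₁ v c i ω = ∏ (λ j → 1ℚ - m v c i (rq j) * ⟦ on (rq j) (lookup ω j) ⟧)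
        S₂ : Fin C → Ω (C ℕ.* suc a) → ℚ
        S₂ c ω = A c ω * g c ω
        f : I → Ω (C ℕ.* suc a) → ℚ
        f (inj₁ c) = linear (y (inj₁ c))
        f (inj₂ v) ω = ∑₂ (λ c i → ⟦ edge c i v ⟧ * (S₁ v c i ω + S₂ c ω))

        A-lipschitz : ∀ c → Lipschitz (A c) (λ j x → δ c (rq j) * ⟦ on (rq j) x ⟧)
        A-lipschitz c = lipschitz-mono {f = A c} (lipschitz-coordinate (cb (c , zero)) (λ x → ⟦ on (c , zero) x ⟧) (λ x → ⟦⟧-nonneg (on (c , zero) x))) λ j x → by-cases j x (j == cb (c , zero)) refl
          where
          by-cases : ∀ j x b → (j == cb (c , zero)) ≡ b → ⟦ b ⟧ * ⟦ on (c , zero) x ⟧ ≤ δ c (rq j) * ⟦ on (rq j) x ⟧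
          by-cases j x false _ = ≤-trans (≤-reflexive (*-zeroˡ ⟦ on (c , zero) x ⟧)) (*-nonneg (δ-nonneg c (rq j)) (⟦⟧-nonneg (on (rq j) x)))
          by-cases j x true eq = ≤-reflexive (sym (trans (cong (λ p → δ c p * ⟦ on p x ⟧) (trans (cong rq (==⇒≡ j _ eq)) (remQuot-combine {C} {suc a} c zero))) (cong (λ b → ⟦ b ⟧ * ⟦ on (c , zero) x ⟧) (==-refl c))))
        g-lipschitz : ∀ c → Lipschitz (g c) (λ j x → m₀ c (rq j) * ⟦ on (rq j) x ⟧)
        g-lipschitz c = lipschitz-mono {f = g c} (lipschitz-∑ {f = λ c′ ω → ⟦ clash c (pk c) c′ (pk c′) ⟧ * A c′ ω} (λ c′ → lipschitz-* {f = A c′} ⟦ clash c (pk c) c′ (pk c′) ⟧ (⟦⟧-nonneg (clash c (pk c) c′ (pk c′))) (A-lipschitz c′)))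
            λ j x → ≤-reflexive (trans (∑-cong (λ c′ → sym (*-assoc ⟦ clash c (pk c) c′ (pk c′) ⟧ (δ c′ (rq j)) ⟦ on (rq j) x ⟧))) (trans (sym (∑-* (λ c′ → ⟦ clash c (pk c) c′ (pk c′) ⟧ * δ c′ (rq j)) ⟦ on (rq j) x ⟧)) (cong (_* ⟦ on (rq j) x ⟧) (collapse (rq j)))))
          where
          collapse : ∀ p → ∑ (λ c′ → ⟦ clash c (pk c) c′ (pk c′) ⟧ * δ c′ p) ≡ m₀ c p
          collapse (c″ , zero)  = trans (∑-cong (λ c′ → trans (*-comm ⟦ clash c (pk c) c′ (pk c′) ⟧ ⟦ c″ == c′ ⟧) (cong (λ b → ⟦ b ⟧ * ⟦ clash c (pk c) c′ (pk c′) ⟧) (==-comm c″ c′)))) (∑-select c″ (λ c′ → ⟦ clash c (pk c) c′ (pk c′) ⟧))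
          collapse (c″ , suc _) = ∑-zero (λ c′ → *-zeroʳ ⟦ clash c (pk c) c′ (pk c′) ⟧)
        g-nonneg : ∀ c ω → 0ℚ ≤ g c ω
        g-nonneg c ω = ∑-nonneg (λ c′ → *-nonneg (⟦⟧-nonneg (clash c (pk c) c′ (pk c′))) (⟦⟧-nonneg (st ω (c′ , zero))))
        g≤cl : ∀ c ω → g c ω ≤ cl c
        g≤cl c ω = ∑-mono (λ c′ → ≤-trans (*-monoˡ (⟦⟧-nonneg (clash c (pk c) c′ (pk c′))) (⟦⟧≤1 (st ω (c′ , zero)))) (≤-reflexive (*-identityʳ _)))
        S₂-lipschitz : ∀ c → Lipschitz (S₂ c) (λ j x → n c (rq j) * ⟦ on (rq j) x ⟧)
        S₂-lipschitz c = lipschitz-mono {f = S₂ c} (lipschitz-product {f = A c} {g = g c} (cl c) (cl-nonneg c) (λ ω → ⟦⟧-nonneg (st ω (c , zero))) (λ ω → ⟦⟧≤1 (st ω (c , zero))) (g-nonneg c) (g≤cl c)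
            (λ j x → *-nonneg (δ-nonneg c (rq j)) (⟦⟧-nonneg (on (rq j) x))) (λ j x → *-nonneg (m₀-nonneg c (rq j)) (⟦⟧-nonneg (on (rq j) x))) (A-lipschitz c) (g-lipschitz c))
            λ j x → ≤-reflexive (eq (cl c) (δ c (rq j)) (m₀ c (rq j)) ⟦ on (rq j) x ⟧)
          where
          eq : ∀ G d m o → G * (d * o) + m * o ≡ (G * d + m) * o
          eq = solve-∀ ℚ-ring
        S₁-lipschitz : ∀ v c i → Lipschitz (S₁ v c i) (λ j x → m v c i (rq j) * ⟦ on (rq j) x ⟧)
        S₁-lipschitz v c i = lipschitz-∏ (λ j x → m v c i (rq j) * ⟦ on (rq j) x ⟧) (λ j x → *-nonneg (m-nonneg v c i (rq j)) (⟦⟧-nonneg (on (rq j) x)))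
          (λ j x → *-mono {q′ = 1ℚ} 0≤1 (⟦⟧-nonneg (on (rq j) x)) (m≤1 v c i (rq j)) (⟦⟧≤1 (on (rq j) x)))
        f-lipschitz : ∀ i → Lipschitz (f i) (y i)
        f-lipschitz (inj₁ c) = linear-lipschitz (y (inj₁ c)) (y-nonneg (inj₁ c))
        f-lipschitz (inj₂ v) = lipschitz-mono {f = f (inj₂ v)} (lipschitz-∑ {f = λ c ω → ∑ (λ i → ⟦ edge c i v ⟧ * (S₁ v c i ω + S₂ c ω))} (λ c → lipschitz-∑ {f = λ i ω → ⟦ edge c i v ⟧ * (S₁ v c i ω + S₂ c ω)} (λ i →
            lipschitz-* {f = λ ω → S₁ v c i ω + S₂ c ω} ⟦ edge c i v ⟧ (⟦⟧-nonneg (edge c i v)) (lipschitz-+ {f = S₁ v c i} {g = S₂ c} {y = λ j x → m v c i (rq j) * ⟦ on (rq j) x ⟧} {z = λ j x → n c (rq j) * ⟦ on (rq j) x ⟧} (S₁-lipschitz v c i) (S₂-lipschitz c)))))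
            λ j x → ≤-reflexive (trans (∑₂-cong (λ c i → eq ⟦ edge c i v ⟧ (m v c i (rq j)) (n c (rq j)) ⟦ on (rq j) x ⟧)) (sym (∑₂-* (λ c i → ⟦ edge c i v ⟧ * (m v c i (rq j) + n c (rq j))) ⟦ on (rq j) x ⟧)))
          where
          eq : ∀ e m n o → e * (m * o + n * o) ≡ e * (m + n) * o
          eq = solve-∀ ℚ-ring

        meet-picks≤rh : ∀ c i (pk′ : Fin C → ℚ) → (∀ c′ → pk′ c′ ≤ ∑ (λ u → ⟦ edge c i u ⟧ * ⟦ edge c′ (pk c′) u ⟧)) → ∑ pk′ ≤ r * h
        meet-picks≤rh c i x x≤ = ≤-trans (∑-mono x≤) (≤-trans (≤-reflexive (trans (∑-comm (λ c′ u → ⟦ edge c i u ⟧ * ⟦ edge c′ (pk c′) u ⟧)) (∑-cong (λ u → sym (*-∑ ⟦ edge c i u ⟧ (λ c′ → ⟦ edge c′ (pk c′) u ⟧))))))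
          (weigh-edge bounded 0≤d 0≤K c i (hits pk) h 0≤h hits-upper))
        H≤rh : ∀ w c i → H pk w c i ≤ r * h
        H≤rh w c i = meet-picks≤rh c i (λ c′ → ⟦ meet w c i c′ (pk c′) ⟧) (λ c′ → meet≤∑′ bounded 0≤d 0≤K w c i c′ (pk c′))
        clash-column≤rh : ∀ c′ → ∑ (λ c → ⟦ clash c (pk c) c′ (pk c′) ⟧) ≤ r * h
        clash-column≤rh c′ = meet-picks≤rh c′ (pk c′) (λ c → ⟦ clash c (pk c) c′ (pk c′) ⟧) (λ c → ≤-trans (meet≤∑′ bounded 0≤d 0≤K (inj₂ c) c (pk c) c′ (pk c′)) (≤-reflexive (∑-cong (λ u → *-comm ⟦ edge c (pk c) u ⟧ ⟦ edge c′ (pk c′) u ⟧))))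

        M G E : ℚ
        M = influence r h
        G = 1ℚ + r + r * h
        E = crowding r h
        1≤M : 1ℚ ≤ M
        1≤M = ≤-by _ (+-nonneg (*-nonneg (0≤ 2) 0≤r) (*-nonneg (0≤ 3) 0≤rh)) (+-assoc 1ℚ (2ℚ * r) (3ℚ * (r * h)))
        0≤M = ≤-trans 0≤1 1≤M
        KM-bound : ∀ {x} z → 0ℚ ≤ z → M ≡ x + z → K * x ≤ K * M
        KM-bound z 0≤z eq = *-monoˡ 0≤K (≤-by z 0≤z eq)
        1≤KM : 1ℚ ≤ K * M
        1≤KM = *-mono {q = 1ℚ} 0≤K 0≤1 1≤K 1≤M

        select-row : ∀ c′ (x : Fin C → Fin a → ℚ) → ∑₂ (λ c i → ⟦ c′ == c ⟧ * x c i) ≡ ∑ (x c′)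
        select-row c′ x = trans (∑-cong (λ c → sym (*-∑ ⟦ c′ == c ⟧ (x c)))) (∑-select′ c′ (λ c → ∑ (x c)))
        row-clash : ∀ c₀ c′ i′ → ∑ (λ i → ⟦ clash c₀ i c′ i′ ⟧) ≤ r * K
        row-clash c₀ c′ i′ = subst (_≤ r * K) (trans (∑-cong (λ c → sym (*-∑ ⟦ c == c₀ ⟧ (λ i → ⟦ clash c i c′ i′ ⟧)))) (∑-select c₀ (λ c → ∑ (λ i → ⟦ clash c i c′ i′ ⟧))))
          (inc-meet≤rK bounded 0≤d 0≤K (inj₂ c₀) c′ i′)

        -- The four contributions of the activation of c′ to the statistic at v.
        a₁ a₂ a₃ a₄ : Fin V → Fin C → ℚ
        a₁ v c′ = ∑₂ (λ c i → ⟦ edge c i v ⟧ * ⟦ meet (inj₁ v) c i c′ (pk c′) ⟧)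
        a₂ v c′ = ∑₂ (λ c i → ⟦ c′ == c ⟧ * ⟦ edge c i v ⟧)
        a₃ v c′ = ∑₂ (λ c i → ⟦ c′ == c ⟧ * (cl c * ⟦ edge c i v ⟧))
        a₄ v c′ = ∑₂ (λ c i → ⟦ clash c (pk c) c′ (pk c′) ⟧ * ⟦ edge c i v ⟧)
        Y-vertex : ∀ v c′ → Y (inj₂ v) (c′ , zero) ≡ a₁ v c′ + a₂ v c′ + (a₃ v c′ + a₄ v c′)
        Y-vertex v c′ = trans (∑₂-cong (λ c i → eq ⟦ edge c i v ⟧ ⟦ meet (inj₁ v) c i c′ (pk c′) ⟧ ⟦ c′ == c ⟧ (cl c) ⟦ clash c (pk c) c′ (pk c′) ⟧))
          (trans (∑₂-+ (λ c i → ⟦ edge c i v ⟧ * ⟦ meet (inj₁ v) c i c′ (pk c′) ⟧ + ⟦ c′ == c ⟧ * ⟦ edge c i v ⟧) (λ c i → ⟦ c′ == c ⟧ * (cl c * ⟦ edge c i v ⟧) + ⟦ clash c (pk c) c′ (pk c′) ⟧ * ⟦ edge c i v ⟧))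
            (cong₂ _+_ (∑₂-+ (λ c i → ⟦ edge c i v ⟧ * ⟦ meet (inj₁ v) c i c′ (pk c′) ⟧) (λ c i → ⟦ c′ == c ⟧ * ⟦ edge c i v ⟧))
                       (∑₂-+ (λ c i → ⟦ c′ == c ⟧ * (cl c * ⟦ edge c i v ⟧)) (λ c i → ⟦ clash c (pk c) c′ (pk c′) ⟧ * ⟦ edge c i v ⟧))))
          where
          eq : ∀ e x y G z → e * ((x + y) + (G * y + z)) ≡ (e * x + y * e) + (y * (G * e) + z * e)
          eq = solve-∀ ℚ-ring
        Y-coin : ∀ v c′ i′ → Y (inj₂ v) (c′ , suc i′) ≡ ⟦ edge c′ i′ v ⟧
        Y-coin v c′ i′ = trans (∑₂-cong (λ c i → eq ⟦ edge c i v ⟧ ⟦ c′ == c ⟧ ⟦ i′ == i ⟧ (cl c)))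
          (trans (select-row c′ (λ c i → ⟦ i′ == i ⟧ * ⟦ edge c i v ⟧)) (∑-select′ i′ (λ i → ⟦ edge c′ i v ⟧)))
          where
          eq : ∀ e x y G → e * (x * y + (G * 0ℚ + 0ℚ)) ≡ x * (y * e)
          eq = solve-∀ ℚ-ring

        a₁≤ : ∀ v c′ → a₁ v c′ ≤ r * K
        a₁≤ v c′ = inc-meet≤rK bounded 0≤d 0≤K (inj₁ v) c′ (pk c′)
        a₂≤ : ∀ v c′ → a₂ v c′ ≤ K
        a₂≤ v c′ = ≤-trans (≤-reflexive (select-row c′ (λ c i → ⟦ edge c i v ⟧))) (coldeg v c′)
        a₃≤ : ∀ v c′ → a₃ v c′ ≤ r * h * K
        a₃≤ v c′ = ≤-trans (≤-reflexive (trans (select-row c′ (λ c i → cl c * ⟦ edge c i v ⟧)) (sym (*-∑ (cl c′) (λ i → ⟦ edge c′ i v ⟧)))))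
          (*-mono 0≤rh (∑-nonneg (λ i → ⟦⟧-nonneg (edge c′ i v))) (H≤rh (inj₂ c′) c′ (pk c′)) (coldeg v c′))
        a₄≤ : ∀ v c′ → a₄ v c′ ≤ r * h * K
        a₄≤ v c′ = ≤-trans (∑-mono (λ c → ≤-trans (≤-reflexive (sym (*-∑ ⟦ clash c (pk c) c′ (pk c′) ⟧ (λ i → ⟦ edge c i v ⟧)))) (*-monoˡ (⟦⟧-nonneg (clash c (pk c) c′ (pk c′))) (coldeg v c))))
          (≤-trans (≤-reflexive (sym (∑-* (λ c → ⟦ clash c (pk c) c′ (pk c′) ⟧) K))) (*-monoʳ 0≤K (clash-column≤rh c′)))

        Y≤KM : ∀ i p → Y i p ≤ K * M
        Y≤KM (inj₁ c₀) (c′ , zero)  = ≤-trans (row-clash c₀ c′ (pk c′)) (≤-trans (≤-reflexive (*-comm r K)) (KM-bound _ (+-nonneg (+-nonneg 0≤1 0≤r) (*-nonneg (0≤ 3) 0≤rh)) (eq r (r * h))))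
          where
          eq : ∀ r x → 1ℚ + 2ℚ * r + 3ℚ * x ≡ r + (1ℚ + r + 3ℚ * x)
          eq = solve-∀ ℚ-ring
        Y≤KM (inj₁ c₀) (c′ , suc _) = ≤-trans (⟦⟧≤1 (c′ == c₀)) 1≤KM
        Y≤KM (inj₂ v) (c′ , zero)   = ≤-trans (≤-reflexive (Y-vertex v c′)) (≤-trans (+-mono-≤ (+-mono-≤ (a₁≤ v c′) (a₂≤ v c′)) (+-mono-≤ (a₃≤ v c′) (a₄≤ v c′)))
          (≤-trans (≤-reflexive (fold r h K)) (KM-bound _ (+-nonneg 0≤r 0≤rh) (eq r (r * h)))))
          where
          fold : ∀ r h K → r * K + K + (r * h * K + r * h * K) ≡ K * (r + 1ℚ + 2ℚ * (r * h))
          fold = solve-∀ ℚ-ring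
          eq : ∀ r x → 1ℚ + 2ℚ * r + 3ℚ * x ≡ (r + 1ℚ + 2ℚ * x) + (r + x)
          eq = solve-∀ ℚ-ring
        Y≤KM (inj₂ v) (c′ , suc i′) = ≤-trans (≤-reflexive (Y-coin v c′ i′)) (≤-trans (⟦⟧≤1 (edge c′ i′ v)) 1≤KM)

        D : Fin V → ℚ
        D v = ∑₂ (λ c i → ⟦ edge c i v ⟧)
        D-nonneg : ∀ v → 0ℚ ≤ D v
        D-nonneg v = ∑₂-nonneg (λ c i → ⟦⟧-nonneg (edge c i v))
        αd≤1 : α * d ≤ 1ℚ
        αd≤1 = ≤-trans (*-monoˡ 0≤α d≤a) (≤-reflexive α*a)
        π≤ : ∀ c i → π c i ≤ θ * α * (r * d - N (inj₂ c) c i)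
        π≤ c i = ≤-trans (≤-reflexive (cong (_* ι (pad c i)) (trans inv-s (*-comm α θ)))) (*-monoˡ (*-nonneg 0≤θ 0≤α) (pad≤ c i))
        π≥ : ∀ c i → θ * α * (r * d - N (inj₂ c) c i - 1ℚ) ≤ π c i
        π≥ c i = ≤-trans (*-monoˡ (*-nonneg 0≤θ 0≤α) (≤-by _ (p≤q⇒0≤q-p (≤pad+1 c i)) (eq (r * d - N (inj₂ c) c i) (ι (pad c i))))) (≤-reflexive (cong (_* ι (pad c i)) (sym (trans inv-s (*-comm α θ)))))
          where
          eq : ∀ x p → p ≡ (x - 1ℚ) + ((1ℚ + p) - x)
          eq = solve-∀ ℚ-ring
        π≤θr : ∀ c i → π c i ≤ θ * r
        π≤θr c i = ≤-trans (≤-reflexive (cong (_* ι (pad c i)) (trans inv-s (*-comm α θ)))) (≤-trans (*-monoˡ (*-nonneg 0≤θ 0≤α) (pad≤rd c i))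
          (≤-trans (≤-reflexive (swap θ α r d)) (≤-trans (*-monoˡ (*-nonneg 0≤θ 0≤r) αd≤1) (≤-reflexive (*-identityʳ (θ * r))))))
          where
          swap : ∀ θ α r d → θ * α * (r * d) ≡ θ * r * (α * d)
          swap = solve-∀ ℚ-ring

        -- The padding cancels the meeting numbers: hits contribute at most `θ (α ∑ N + t)` and
        -- coins at most `θ α (a r d - ∑ N)`, so the sum is the same bound for every colour.
        mean-colour : ∀ c₀ → ∑ (λ j → avg (y (inj₁ c₀) j)) ≤ θ * (r * d + t)
        mean-colour c₀ = begin
          ∑ (λ j → avg (y (inj₁ c₀) j))
            ≡⟨ mean (inj₁ c₀) ⟩
          ∑ (λ c → x c * θ + ∑ (λ i → ⟦ c == c₀ ⟧ * π c i))
            ≡⟨ ∑-distrib-+ (λ c → x c * θ) (λ c → ∑ (λ i → ⟦ c == c₀ ⟧ * π c i)) ⟩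
          ∑ (λ c → x c * θ) + ∑₂ (λ c i → ⟦ c == c₀ ⟧ * π c i)
            ≡⟨ cong₂ _+_ (trans (sym (∑-* x θ)) (trans (*-comm (∑ x) θ) (cong (θ *_) (sym (∑-comm (λ i c → ⟦ clash c₀ i c (pk c) ⟧))))))
                         (trans (∑-cong (λ c → sym (*-∑ ⟦ c == c₀ ⟧ (π c)))) (∑-select c₀ (λ c → ∑ (π c)))) ⟩
          θ * ∑ (H pk (inj₂ c₀) c₀) + ∑ (π c₀)
            ≤⟨ +-mono-≤ (*-monoˡ 0≤θ (colour-upper c₀)) (∑-mono (π≤ c₀)) ⟩
          θ * (α * ∑ N₀ + t) + ∑ (λ i → θ * α * (r * d - N₀ i))
            ≡⟨ cong (θ * (α * ∑ N₀ + t) +_) (trans (sym (*-∑ (θ * α) (λ i → r * d - N₀ i))) (cong (θ * α *_) (trans (∑-- (λ _ → r * d) N₀) (cong (_- ∑ N₀) (∑-const a (r * d)))))) ⟩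
          θ * (α * ∑ N₀ + t) + θ * α * (ι a * (r * d) - ∑ N₀)
            ≡⟨ eq θ α (ι a) (∑ N₀) t (r * d) ⟩
          θ * (α * ι a * (r * d) + t)
            ≡⟨ cong (λ q → θ * (q + t)) (trans (cong (_* (r * d)) α*a) (*-identityˡ (r * d))) ⟩
          θ * (r * d + t) ∎
          where
          open ≤-Reasoning
          x : Fin C → ℚ
          x c = ∑ (λ i → ⟦ clash c₀ i c (pk c) ⟧)
          N₀ : Fin a → ℚ
          N₀ = N (inj₂ c₀) c₀
          eq : ∀ θ α a N t x → θ * (α * N + t) + θ * α * (a * x - N) ≡ θ * (α * a * x + t)
          eq = solve-∀ ℚ-ring

        mean-vertex : ∀ v → ∑ (λ j → avg (y (inj₂ v) j)) ≤ θ * d * M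
        mean-vertex v = begin
          ∑ (λ j → avg (y (inj₂ v) j))
            ≡⟨ mean (inj₂ v) ⟩
          ∑ (λ c → Y (inj₂ v) (c , zero) * θ + ∑ (λ i → Y (inj₂ v) (c , suc i) * π c i))
            ≡⟨ ∑-distrib-+ (λ c → Y (inj₂ v) (c , zero) * θ) (λ c → ∑ (λ i → Y (inj₂ v) (c , suc i) * π c i)) ⟩
          ∑ (λ c → Y (inj₂ v) (c , zero) * θ) + ∑₂ (λ c i → Y (inj₂ v) (c , suc i) * π c i)
            ≡⟨ cong₂ _+_ (trans (sym (∑-* (λ c → Y (inj₂ v) (c , zero)) θ)) (cong (_* θ) total)) (∑₂-cong (λ c i → cong (_* π c i) (Y-coin v c i))) ⟩
          ∑₂ (λ c i → ⟦ edge c i v ⟧ * x c i) * θ + ∑₂ (λ c i → ⟦ edge c i v ⟧ * π c i)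
            ≤⟨ +-mono-≤ (*-monoʳ 0≤θ (∑₂-mono (λ c i → *-monoˡ (⟦⟧-nonneg (edge c i v)) (x≤ c i)))) (∑₂-mono (λ c i → *-monoˡ (⟦⟧-nonneg (edge c i v)) (π≤θr c i))) ⟩
          ∑₂ (λ c i → ⟦ edge c i v ⟧ * (1ℚ + 3ℚ * (r * h))) * θ + ∑₂ (λ c i → ⟦ edge c i v ⟧ * (θ * r))
            ≡⟨ cong₂ _+_ (cong (_* θ) (sym (∑₂-* (λ c i → ⟦ edge c i v ⟧) (1ℚ + 3ℚ * (r * h))))) (sym (∑₂-* (λ c i → ⟦ edge c i v ⟧) (θ * r))) ⟩
          D v * (1ℚ + 3ℚ * (r * h)) * θ + D v * (θ * r)
            ≤⟨ ≤-by _ (*-nonneg 0≤θ (+-nonneg (*-nonneg (p≤q⇒0≤q-p (deg v)) 0≤M) (*-nonneg (D-nonneg v) 0≤r))) (eq θ d (D v) r (r * h)) ⟩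
          θ * d * M ∎
          where
          open ≤-Reasoning
          x : Fin C → Fin a → ℚ
          x c i = (H pk (inj₁ v) c i + 1ℚ) + (cl c + cl c)
          x≤ : ∀ c i → x c i ≤ 1ℚ + 3ℚ * (r * h)
          x≤ c i = ≤-trans (+-mono-≤ (+-monoˡ-≤ 1ℚ (H≤rh (inj₁ v) c i)) (+-mono-≤ (H≤rh (inj₂ c) c (pk c)) (H≤rh (inj₂ c) c (pk c)))) (≤-reflexive (e (r * h)))
            where
            e : ∀ x → (x + 1ℚ) + (x + x) ≡ 1ℚ + 3ℚ * x
            e = solve-∀ ℚ-ring
          eq : ∀ θ d D r x → θ * d * (1ℚ + 2ℚ * r + 3ℚ * x) ≡ (D * (1ℚ + 3ℚ * x) * θ + D * (θ * r)) + θ * ((d - D) * (1ℚ + 2ℚ * r + 3ℚ * x) + D * r)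
          eq = solve-∀ ℚ-ring
          total : ∑ (λ c′ → Y (inj₂ v) (c′ , zero)) ≡ ∑₂ (λ c i → ⟦ edge c i v ⟧ * x c i)
          total = trans (sym (∑₂-∑-comm (λ c i c′ → ⟦ edge c i v ⟧ * (m v c i (c′ , zero) + n c (c′ , zero)))))
            (∑₂-cong (λ c i → trans (sym (*-∑ ⟦ edge c i v ⟧ (λ c′ → m v c i (c′ , zero) + n c (c′ , zero)))) (cong (⟦ edge c i v ⟧ *_)
              (trans (∑-distrib-+ (λ c′ → m v c i (c′ , zero)) (λ c′ → n c (c′ , zero)))
                (cong₂ _+_ (trans (∑-distrib-+ (λ c′ → ⟦ meet (inj₁ v) c i c′ (pk c′) ⟧) (λ c′ → ⟦ c′ == c ⟧)) (cong (H pk (inj₁ v) c i +_) (one c)))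
                  (trans (∑-distrib-+ (λ c′ → cl c * ⟦ c′ == c ⟧) (λ c′ → ⟦ clash c (pk c) c′ (pk c′) ⟧)) (cong (_+ cl c) (trans (sym (*-∑ (cl c) (λ c′ → ⟦ c′ == c ⟧))) (trans (cong (cl c *_) (one c)) (*-identityʳ (cl c))))))))))) 
            where
            one : ∀ c → ∑ (λ c′ → ⟦ c′ == c ⟧) ≡ 1ℚ
            one c = trans (∑-cong (λ c′ → sym (*-identityʳ ⟦ c′ == c ⟧))) (∑-select c (λ _ → 1ℚ))

        mean≤μ : ∀ i → ∑ (λ j → avg (y i j)) ≤ θ * d * M
        mean≤μ (inj₂ v) = mean-vertex v
        mean≤μ (inj₁ c) = ≤-trans (mean-colour c) (≤-trans (*-monoˡ 0≤θ (≤-by _ (+-nonneg (p≤q⇒0≤q-p t≤d) (*-nonneg 0≤d (+-nonneg 0≤r (*-nonneg (0≤ 3) 0≤rh)))) (eq r d t (r * h)))) (≤-reflexive (sym (*-assoc θ d M))))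
          where
          eq : ∀ r d t x → d * (1ℚ + 2ℚ * r + 3ℚ * x) ≡ (r * d + t) + ((d - t) + d * (r + 3ℚ * x))
          eq = solve-∀ ℚ-ring

        Δ : ℚ
        Δ = reach r h d (ι a)
        Δ₁ = r * d + r * (r * d + ι a * (1ℚ + 2ℚ * (r * h)))
        0≤Δ₁ : 0ℚ ≤ Δ₁
        0≤Δ₁ = +-nonneg 0≤rd (*-nonneg 0≤r (+-nonneg 0≤rd (*-nonneg (ι-nonneg a) (+-nonneg 0≤1 (*-nonneg (0≤ 2) 0≤rh)))))
        ΣY≤Δ : ∀ p → ∑ (λ c → Y (inj₁ c) p) + ∑ (λ v → Y (inj₂ v) p) ≤ Δ
        ΣY≤Δ (c′ , zero) = ≤-trans (+-mono-≤ (N-column≤rd bounded 0≤d 0≤K (inj₂ c′) c′ (pk c′)) vertices) (≤-by (1ℚ + r) (+-nonneg 0≤1 0≤r) refl)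
          where
          X : Fin C → Fin a → ℚ
          X c i = ⟦ clash c i c′ (pk c′) ⟧ + (⟦ c′ == c ⟧ * (1ℚ + cl c) + ⟦ clash c (pk c) c′ (pk c′) ⟧)
          X-nonneg : ∀ c i → 0ℚ ≤ X c i
          X-nonneg c i = +-nonneg (⟦⟧-nonneg (clash c i c′ (pk c′))) (+-nonneg (*-nonneg (⟦⟧-nonneg (c′ == c)) (+-nonneg 0≤1 (cl-nonneg c))) (⟦⟧-nonneg (clash c (pk c) c′ (pk c′))))
          mn≤X : ∀ v c i → m v c i (c′ , zero) + n c (c′ , zero) ≤ X c i
          mn≤X v c i = ≤-trans (+-monoˡ-≤ (n c (c′ , zero)) (+-monoˡ-≤ ⟦ c′ == c ⟧ (meet⇒clash (inj₁ v) c i c′ (pk c′)))) (≤-reflexive (e ⟦ clash c i c′ (pk c′) ⟧ ⟦ c′ == c ⟧ (cl c) ⟦ clash c (pk c) c′ (pk c′) ⟧))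
            where
            e : ∀ x y G z → (x + y) + (G * y + z) ≡ x + (y * (1ℚ + G) + z)
            e = solve-∀ ℚ-ring
          ∑X : ∑₂ X ≤ r * d + ι a * (1ℚ + 2ℚ * (r * h))
          ∑X = ≤-trans (≤-reflexive (trans (∑₂-+ (λ c i → ⟦ clash c i c′ (pk c′) ⟧) (λ c i → ⟦ c′ == c ⟧ * (1ℚ + cl c) + ⟦ clash c (pk c) c′ (pk c′) ⟧))
              (cong (∑₂ (λ c i → ⟦ clash c i c′ (pk c′) ⟧) +_) (∑₂-+ {C} {a} (λ c i → ⟦ c′ == c ⟧ * (1ℚ + cl c)) (λ c i → ⟦ clash c (pk c) c′ (pk c′) ⟧)))))
            (≤-trans (+-mono-≤ (N-column≤rd bounded 0≤d 0≤K (inj₂ c′) c′ (pk c′)) (+-mono-≤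
              (≤-trans (≤-reflexive (trans (select-row c′ (λ c i → 1ℚ + cl c)) (∑-const a (1ℚ + cl c′)))) (*-monoˡ (ι-nonneg a) (+-monoʳ-≤ 1ℚ (H≤rh (inj₂ c′) c′ (pk c′)))))
              (≤-trans (≤-reflexive (trans (∑-cong (λ c → ∑-const a ⟦ clash c (pk c) c′ (pk c′) ⟧)) (sym (*-∑ (ι a) (λ c → ⟦ clash c (pk c) c′ (pk c′) ⟧))))) (*-monoˡ (ι-nonneg a) (clash-column≤rh c′)))))
              (≤-reflexive (e (r * d) (ι a) (r * h))))
            where
            e : ∀ x a y → x + (a * (1ℚ + y) + a * y) ≡ x + a * (1ℚ + 2ℚ * y)
            e = solve-∀ ℚ-ring
          vertices : ∑ (λ v → Y (inj₂ v) (c′ , zero)) ≤ r * (r * d + ι a * (1ℚ + 2ℚ * (r * h)))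
          vertices = ≤-trans (∑-mono (λ v → ∑₂-mono (λ c i → *-monoˡ (⟦⟧-nonneg (edge c i v)) (mn≤X v c i))))
            (≤-trans (≤-reflexive (trans (sym (∑₂-∑-comm (λ c i v → ⟦ edge c i v ⟧ * X c i))) (∑₂-cong (λ c i → sym (∑-* (λ v → ⟦ edge c i v ⟧) (X c i))))))
            (≤-trans (∑₂-mono (λ c i → *-monoʳ (X-nonneg c i) (size c i))) (≤-trans (≤-reflexive (sym (*-∑₂ r X))) (*-monoˡ 0≤r ∑X))))
        ΣY≤Δ (c′ , suc i′) = ≤-trans (+-mono-≤ (≤-reflexive (trans (∑-cong (λ c → sym (*-identityʳ ⟦ c′ == c ⟧))) (∑-select′ c′ (λ _ → 1ℚ)))) (≤-trans (≤-reflexive (∑-cong (λ v → Y-coin v c′ i′))) (size c′ i′)))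
          (≤-by Δ₁ 0≤Δ₁ (+-comm Δ₁ (1ℚ + r)))
        Σy≤Δ : ∀ j x → ∑ˡ all (λ i → y i j x) ≤ Δ
        Σy≤Δ j x = ≤-trans (∑ˡ-mono all (λ i → y≤Y i j x)) (≤-trans (≤-reflexive (∑ˡ-all (λ i → Y i (rq j)))) (ΣY≤Δ (rq j)))

        kill-rate : ∀ v c i → ∑ (λ j → m v c i (rq j) * prob (rq j)) ≡ θ * (H pk (inj₁ v) c i + 1ℚ) + π c i
        kill-rate v c i = begin
          ∑ (λ j → m v c i (rq j) * prob (rq j))
            ≡⟨ flatten (λ p → m v c i p * prob p) ⟩
          ∑ (λ c′ → m v c i (c′ , zero) * prob (c′ , zero) + ∑ (λ i′ → ⟦ c′ == c ⟧ * ⟦ i′ == i ⟧ * π c′ i′))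
            ≡⟨ ∑-distrib-+ (λ c′ → m v c i (c′ , zero) * prob (c′ , zero)) (λ c′ → ∑ (λ i′ → ⟦ c′ == c ⟧ * ⟦ i′ == i ⟧ * π c′ i′)) ⟩
          ∑ (λ c′ → m v c i (c′ , zero) * prob (c′ , zero)) + ∑₂ (λ c′ i′ → ⟦ c′ == c ⟧ * ⟦ i′ == i ⟧ * π c′ i′)
            ≡⟨ cong₂ _+_ (trans (∑-cong (λ c′ → cong (m v c i (c′ , zero) *_) (prob-act c′))) (trans (sym (∑-* (λ c′ → m v c i (c′ , zero)) θ)) (trans (*-comm _ θ) (cong (θ *_) activations)))) coins ⟩
          θ * (H pk (inj₁ v) c i + 1ℚ) + π c i ∎
          where
          open ≡-Reasoning
          activations : ∑ (λ c′ → m v c i (c′ , zero)) ≡ H pk (inj₁ v) c i + 1ℚ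
          activations = trans (∑-distrib-+ (λ c′ → ⟦ meet (inj₁ v) c i c′ (pk c′) ⟧) (λ c′ → ⟦ c′ == c ⟧)) (cong (H pk (inj₁ v) c i +_)
            (trans (∑-cong (λ c′ → sym (*-identityʳ ⟦ c′ == c ⟧))) (∑-select c (λ _ → 1ℚ))))
          coins : ∑₂ (λ c′ i′ → ⟦ c′ == c ⟧ * ⟦ i′ == i ⟧ * π c′ i′) ≡ π c i
          coins = trans (∑₂-cong (λ c′ i′ → *-assoc ⟦ c′ == c ⟧ ⟦ i′ == i ⟧ (π c′ i′))) (trans (∑-cong (λ c′ → sym (*-∑ ⟦ c′ == c ⟧ (λ i′ → ⟦ i′ == i ⟧ * π c′ i′))))
            (trans (∑-select c (λ c′ → ∑ (λ i′ → ⟦ i′ == i ⟧ * π c′ i′))) (∑-select i (π c))))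

        𝔼S₁≤ : ∀ v c i → 𝔼 (S₁ v c i) ≤ 1ℚ - (θ * (H pk (inj₁ v) c i + 1ℚ) + π c i) + θ * G * (θ * G)
        𝔼S₁≤ v c i = begin
          𝔼 (S₁ v c i)
            ≡⟨ 𝔼-∏ (λ j x → 1ℚ - m v c i (rq j) * ⟦ on (rq j) x ⟧) ⟩
          ∏ (λ j → avg (λ x → 1ℚ - m v c i (rq j) * ⟦ on (rq j) x ⟧))
            ≡⟨ ∏-cong (λ j → avg-factor (rq j)) ⟩
          ∏ (λ j → 1ℚ - p j)
            ≤⟨ ∏[1-p]≤ p (λ j → *-nonneg (m-nonneg v c i (rq j)) (prob-nonneg (rq j))) (λ j → *-mono {q′ = 1ℚ} 0≤1 (prob-nonneg (rq j)) (m≤1 v c i (rq j)) (prob≤1 (rq j))) ⟩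
          1ℚ - ∑ p + ∑ p * ∑ p
            ≤⟨ +-monoʳ-≤ (1ℚ - ∑ p) (*-mono 0≤θG 0≤∑p ∑p≤θG ∑p≤θG) ⟩
          1ℚ - ∑ p + θ * G * (θ * G)
            ≡⟨ cong (λ q → 1ℚ - q + θ * G * (θ * G)) (kill-rate v c i) ⟩
          1ℚ - (θ * (H pk (inj₁ v) c i + 1ℚ) + π c i) + θ * G * (θ * G) ∎
          where
          open ≤-Reasoning
          p : Fin (C ℕ.* suc a) → ℚ
          p j = m v c i (rq j) * prob (rq j)
          0≤θG : 0ℚ ≤ θ * G
          0≤θG = *-nonneg 0≤θ (+-nonneg (+-nonneg 0≤1 0≤r) 0≤rh)
          0≤∑p : 0ℚ ≤ ∑ p
          0≤∑p = ∑-nonneg (λ j → *-nonneg (m-nonneg v c i (rq j)) (prob-nonneg (rq j)))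
          ∑p≤θG : ∑ p ≤ θ * G
          ∑p≤θG = ≤-trans (≤-reflexive (kill-rate v c i)) (≤-trans (+-mono-≤ (*-monoˡ 0≤θ (+-monoˡ-≤ 1ℚ (H≤rh (inj₁ v) c i))) (π≤θr c i)) (≤-reflexive (e θ r (r * h))))
            where
            e : ∀ θ r x → θ * (x + 1ℚ) + θ * r ≡ θ * (1ℚ + r + x)
            e = solve-∀ ℚ-ring
          avg-factor : ∀ q → avg (λ x → 1ℚ - m v c i q * ⟦ on q x ⟧) ≡ 1ℚ - m v c i q * prob q
          avg-factor q = trans (avg-cong (λ x → e (m v c i q) ⟦ on q x ⟧)) (trans (avg-+ (λ _ → 1ℚ) (λ x → - m v c i q * ⟦ on q x ⟧)) (trans (cong₂ _+_ (avg-const 1ℚ) (trans (avg-* (- m v c i q) (λ x → ⟦ on q x ⟧)) (cong (- m v c i q *_) (avg-on q)))) (sym (e (m v c i q) (prob q)))))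
            where
            e : ∀ m o → 1ℚ - m * o ≡ 1ℚ + (- m) * o
            e = solve-∀ ℚ-ring

        -- Two different colours have to be activated, which has probability `θ²`, and a chosen edge
        -- clashes with at most `r h` others.
        𝔼S₂≤ : ∀ c → 𝔼 (S₂ c) ≤ θ * θ * (r * h)
        𝔼S₂≤ c = begin
          𝔼 (S₂ c)
            ≡⟨ 𝔼-cong (λ ω → trans (*-∑ (A c ω) (λ c′ → ⟦ clash c (pk c) c′ (pk c′) ⟧ * A c′ ω)) (∑-cong (λ c′ → swap (A c ω) ⟦ clash c (pk c) c′ (pk c′) ⟧ (A c′ ω)))) ⟩
          𝔼 (λ ω → ∑ (λ c′ → ⟦ clash c (pk c) c′ (pk c′) ⟧ * (A c ω * A c′ ω)))
            ≡⟨ trans (𝔼-∑ (λ c′ ω → ⟦ clash c (pk c) c′ (pk c′) ⟧ * (A c ω * A c′ ω))) (∑-cong (λ c′ → 𝔼-* ⟦ clash c (pk c) c′ (pk c′) ⟧ (λ ω → A c ω * A c′ ω))) ⟩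
          ∑ (λ c′ → ⟦ clash c (pk c) c′ (pk c′) ⟧ * 𝔼 (λ ω → A c ω * A c′ ω))
            ≡⟨ ∑-cong (λ c′ → term c′) ⟩
          ∑ (λ c′ → ⟦ clash c (pk c) c′ (pk c′) ⟧ * (θ * θ))
            ≡⟨ trans (sym (∑-* (λ c′ → ⟦ clash c (pk c) c′ (pk c′) ⟧) (θ * θ))) (*-comm (cl c) (θ * θ)) ⟩
          θ * θ * cl c
            ≤⟨ *-monoˡ (*-nonneg 0≤θ 0≤θ) (H≤rh (inj₂ c) c (pk c)) ⟩
          θ * θ * (r * h) ∎
          where
          open ≤-Reasoning
          swap : ∀ x y z → x * (y * z) ≡ y * (x * z)
          swap = solve-∀ ℚ-ring
          distinct : ∀ c′ → c ≢ c′ → cb (c , zero) ≢ cb (c′ , zero)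
          distinct c′ c≢c′ eq = c≢c′ (cong proj₁ (trans (sym (remQuot-combine {C} {suc a} c zero)) (trans (cong rq eq) (remQuot-combine {C} {suc a} c′ zero))))
          term : ∀ c′ → ⟦ clash c (pk c) c′ (pk c′) ⟧ * 𝔼 (λ ω → A c ω * A c′ ω) ≡ ⟦ clash c (pk c) c′ (pk c′) ⟧ * (θ * θ)
          term c′ = by-cases (c == c′) refl
            where
            by-cases : ∀ b → (c == c′) ≡ b → ⟦ clash c (pk c) c′ (pk c′) ⟧ * 𝔼 (λ ω → A c ω * A c′ ω) ≡ ⟦ clash c (pk c) c′ (pk c′) ⟧ * (θ * θ)
            by-cases true  eq = trans (trans (cong (_* 𝔼 (λ ω → A c ω * A c′ ω)) no-clash) (*-zeroˡ (𝔼 (λ ω → A c ω * A c′ ω)))) (sym (trans (cong (_* (θ * θ)) no-clash) (*-zeroˡ (θ * θ))))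
              where
              no-clash : ⟦ clash c (pk c) c′ (pk c′) ⟧ ≡ 0ℚ
              no-clash = cong (λ b → ⟦ not b ∧ any (λ u → true ∧ (edge c (pk c) u ∧ edge c′ (pk c′) u)) ⟧) eq
            by-cases false eq = cong (⟦ clash c (pk c) c′ (pk c′) ⟧ *_) (trans (𝔼-coordinates s (distinct c′ (==-sym-false c c′ eq)) (λ x → ⟦ on (c , zero) x ⟧) (λ x → ⟦ on (c′ , zero) x ⟧))
              (cong₂ _*_ (trans (avg-on (c , zero)) (prob-act c)) (trans (avg-on (c′ , zero)) (prob-act c′))))

        -- Summed over the edges at `v`, the main term is the true degree `D v` times the
        -- coefficient `X`. As `X` is nonnegative, `D v` may be replaced by `d`, so vertices of
        -- smaller degree do no harm. The three units `θ * t` come from `vertex-lower`, from the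
        -- second-order term `E`, and from the coins rounded down, which cost `θ * α * d` in total.
        𝔼F≤ : d * (θ * E) ≤ t → ∀ v → 𝔼 (f (inj₂ v)) ≤ d - θ * (d + α * (r * d - d) * d) + 3ℚ * (θ * t)
        𝔼F≤ dθE≤t v = begin
          𝔼 (f (inj₂ v))
            ≡⟨ trans (𝔼-∑ (λ c ω → ∑ (λ i → ⟦ edge c i v ⟧ * (S₁ v c i ω + S₂ c ω)))) (∑-cong (λ c → trans (𝔼-∑ (λ i ω → ⟦ edge c i v ⟧ * (S₁ v c i ω + S₂ c ω)))
                 (∑-cong (λ i → trans (𝔼-* ⟦ edge c i v ⟧ (λ ω → S₁ v c i ω + S₂ c ω)) (cong (⟦ edge c i v ⟧ *_) (𝔼-+ (S₁ v c i) (S₂ c))))))) ⟩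
          ∑₂ (λ c i → ⟦ edge c i v ⟧ * (𝔼 (S₁ v c i) + 𝔼 (S₂ c)))
            ≤⟨ ∑₂-mono (λ c i → ≤-trans (*-monoˡ (⟦⟧-nonneg (edge c i v)) (per-edge c i)) (≤-reflexive (dist ⟦ edge c i v ⟧ X θ (Hᵥ c i) (θ * α) (Nᵥ c i)))) ⟩
          ∑₂ (λ c i → ⟦ edge c i v ⟧ * X + (- θ * (⟦ edge c i v ⟧ * Hᵥ c i) + θ * α * (⟦ edge c i v ⟧ * Nᵥ c i)))
            ≡⟨ trans (∑₂-+ (λ c i → ⟦ edge c i v ⟧ * X) (λ c i → - θ * (⟦ edge c i v ⟧ * Hᵥ c i) + θ * α * (⟦ edge c i v ⟧ * Nᵥ c i)))
                 (cong₂ _+_ (sym (∑₂-* (λ c i → ⟦ edge c i v ⟧) X)) (trans (∑₂-+ (λ c i → - θ * (⟦ edge c i v ⟧ * Hᵥ c i)) (λ c i → θ * α * (⟦ edge c i v ⟧ * Nᵥ c i)))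
                   (cong₂ _+_ (sym (*-∑₂ (- θ) (λ c i → ⟦ edge c i v ⟧ * Hᵥ c i))) (sym (*-∑₂ (θ * α) (λ c i → ⟦ edge c i v ⟧ * Nᵥ c i)))))) ⟩
          D v * X + (- θ * ΣH + θ * α * ΣN)
            ≤⟨ ≤-by _ (+-nonneg (+-nonneg (*-nonneg (p≤q⇒0≤q-p (deg v)) 0≤X) (*-nonneg 0≤θ (p≤q⇒0≤q-p (vertex-lower v))))
                         (*-nonneg 0≤θ (+-nonneg (p≤q⇒0≤q-p dθE≤t) (p≤q⇒0≤q-p (≤-trans αd≤1 1≤t))))) (final d θ α r t E (D v) ΣH ΣN) ⟩
          d - θ * (d + α * (r * d - d) * d) + 3ℚ * (θ * t) ∎
          where
          open ≤-Reasoning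
          Hᵥ Nᵥ : Fin C → Fin a → ℚ
          Hᵥ = H pk (inj₁ v)
          Nᵥ = N (inj₁ v)
          ΣH = ∑₂ (λ c i → ⟦ edge c i v ⟧ * Hᵥ c i)
          ΣN = ∑₂ (λ c i → ⟦ edge c i v ⟧ * Nᵥ c i)
          X = 1ℚ + θ * θ * E - θ - θ * α * (r * d - d - 1ℚ)
          0≤X : 0ℚ ≤ X
          0≤X = subst (0ℚ ≤_) (sym (e θ α r d E)) (+-nonneg (+-nonneg (p≤q⇒0≤q-p θr≤1) (*-nonneg 0≤θ (*-nonneg (p≤q⇒0≤q-p 1≤r) (p≤q⇒0≤q-p αd≤1)))) (+-nonneg (*-nonneg (*-nonneg 0≤θ 0≤θ) 0≤E) (*-nonneg 0≤θ 0≤α)))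
            where
            θr≤1 : θ * r ≤ 1ℚ
            θr≤1 = ≤-trans (*-monoˡ 0≤θ r≤Θ) (≤-reflexive θ*Θ)
            0≤E : 0ℚ ≤ E
            0≤E = +-nonneg (sq-nonneg G) 0≤rh
            e : ∀ θ α r d E → 1ℚ + θ * θ * E - θ - θ * α * (r * d - d - 1ℚ) ≡ ((1ℚ - θ * r) + θ * ((r - 1ℚ) * (1ℚ - α * d))) + (θ * θ * E + θ * α)
            e = solve-∀ ℚ-ring
          per-edge : ∀ c i → 𝔼 (S₁ v c i) + 𝔼 (S₂ c) ≤ X + (- θ * Hᵥ c i + θ * α * Nᵥ c i)
          per-edge c i = ≤-trans (+-mono-≤ (𝔼S₁≤ v c i) (𝔼S₂≤ c)) (≤-by _ (+-nonneg (p≤q⇒0≤q-p (π≥ c i)) (*-nonneg (*-nonneg 0≤θ 0≤α) (p≤q⇒0≤q-p (N-clash≤ bounded 0≤d 0≤K v c i))))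
            (e θ α r d h (Hᵥ c i) (Nᵥ c i) (N (inj₂ c) c i) (π c i)))
            where
            e : ∀ θ α r d h H Nv N₂ π →
                1ℚ + θ * θ * ((1ℚ + r + r * h) * (1ℚ + r + r * h) + r * h) - θ - θ * α * (r * d - d - 1ℚ) + (- θ * H + θ * α * Nv)
                ≡ (1ℚ - (θ * (H + 1ℚ) + π) + θ * (1ℚ + r + r * h) * (θ * (1ℚ + r + r * h))) + θ * θ * (r * h)
                  + ((π - θ * α * (r * d - N₂ - 1ℚ)) + θ * α * ((Nv + d) - N₂))
            e = solve-∀ ℚ-ring
          dist : ∀ e X θ H β N → e * (X + (- θ * H + β * N)) ≡ e * X + (- θ * (e * H) + β * (e * N))
          dist = solve-∀ ℚ-ring
          final : ∀ d θ α r t E D H N → d - θ * (d + α * (r * d - d) * d) + 3ℚ * (θ * t)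
                  ≡ (D * (1ℚ + θ * θ * E - θ - θ * α * (r * d - d - 1ℚ)) + (- θ * H + θ * α * N))
                    + ((d - D) * (1ℚ + θ * θ * E - θ - θ * α * (r * d - d - 1ℚ)) + θ * ((H + t) - α * N) + θ * ((t - d * (θ * E)) + (t - α * d)))
          final = solve-∀ ℚ-ring

        -- A live edge has a silent coin and is not blocked. If its colour is inactive, all factors
        -- of `S₁` are 1. If its colour is active but not retained, the chosen edge of that colour
        -- clashes with another activated one, and `S₂` is at least 1.
        survives≤ : ∀ ω v c i → let act c = st ω (c , zero) ; coin c i = st ω (c , suc i) in
                    ⟦ alive act coin c i ∧ not (retained act c) ⟧ ≤ S₁ v c i ω + S₂ c ω
        survives≤ ω v c i = by-cases (alive act coin c i ∧ not (retained act c)) refl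
          where
          act : Fin C → Bool
          act c = st ω (c , zero)
          coin : Fin C → Fin a → Bool
          coin c i = st ω (c , suc i)
          0≤S₁ : 0ℚ ≤ S₁ v c i ω
          0≤S₁ = ∏-nonneg (λ j → p≤q⇒0≤q-p (*-mono {q′ = 1ℚ} 0≤1 (⟦⟧-nonneg (on (rq j) (lookup ω j))) (m≤1 v c i (rq j)) (⟦⟧≤1 (on (rq j) (lookup ω j)))))
          0≤S₂ : 0ℚ ≤ S₂ c ω
          0≤S₂ = *-nonneg (⟦⟧-nonneg (act c)) (g-nonneg c ω)
          not-true : ∀ {b} → not b ≡ true → b ≡ false
          not-true {false} _ = refl
          by-cases : ∀ b → alive act coin c i ∧ not (retained act c) ≡ b → ⟦ b ⟧ ≤ S₁ v c i ω + S₂ c ω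
          by-cases false _ = +-nonneg 0≤S₁ 0≤S₂
          by-cases true eq = split (act c) refl
            where
            both = ∧-true {alive act coin c i} eq
            quiet = ∧-true {not (coin c i)} (proj₁ both)
            unblocked : ∀ c′ → clash c i c′ (pk c′) ∧ act c′ ≡ false
            unblocked = any-false (λ c′ → clash c i c′ (pk c′) ∧ act c′) (not-true (proj₂ quiet))
            split : ∀ b → act c ≡ b → 1ℚ ≤ S₁ v c i ω + S₂ c ω
            split false off-c = ≤-by (S₂ c ω) 0≤S₂ (cong (_+ S₂ c ω) (∏≡1 (λ j → trans (cong (λ b → 1ℚ - m v c i (rq j) * ⟦ b ⟧) (on-lookup ω j)) (cong (λ q → 1ℚ - q) (silent (rq j))))))
              where
              silent : ∀ p → m v c i p * ⟦ st ω p ⟧ ≡ 0ℚ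
              silent (c′ , suc i′) = cases (c′ == c) (i′ == i) refl refl
                where
                cases : ∀ b₁ b₂ → (c′ == c) ≡ b₁ → (i′ == i) ≡ b₂ → ⟦ b₁ ⟧ * ⟦ b₂ ⟧ * ⟦ coin c′ i′ ⟧ ≡ 0ℚ
                cases false b₂    _  _  = trans (cong (_* ⟦ coin c′ i′ ⟧) (*-zeroˡ ⟦ b₂ ⟧)) (*-zeroˡ ⟦ coin c′ i′ ⟧)
                cases true  false _  _  = *-zeroˡ ⟦ coin c′ i′ ⟧
                cases true  true  e₁ e₂ = cong (λ b → 1ℚ * 1ℚ * ⟦ b ⟧) (trans (cong₂ coin (==⇒≡ c′ c e₁) (==⇒≡ i′ i e₂)) (not-true (proj₁ quiet)))
              silent (c′ , zero) = ≤-antisym (≤-trans (≤-reflexive (*-distribʳ-+ ⟦ act c′ ⟧ ⟦ meet (inj₁ v) c i c′ (pk c′) ⟧ ⟦ c′ == c ⟧)) (+-mono-≤ first second)) (*-nonneg (m-nonneg v c i (c′ , zero)) (⟦⟧-nonneg (act c′)))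
                where
                first : ⟦ meet (inj₁ v) c i c′ (pk c′) ⟧ * ⟦ act c′ ⟧ ≤ 0ℚ
                first = ≤-trans (*-monoʳ (⟦⟧-nonneg (act c′)) (meet⇒clash (inj₁ v) c i c′ (pk c′))) (≤-reflexive (trans (sym (⟦∧⟧ (clash c i c′ (pk c′)) (act c′))) (cong ⟦_⟧ (unblocked c′))))
                second : ⟦ c′ == c ⟧ * ⟦ act c′ ⟧ ≤ 0ℚ
                second = cases (c′ == c) refl
                  where
                  cases : ∀ b → (c′ == c) ≡ b → ⟦ b ⟧ * ⟦ act c′ ⟧ ≤ 0ℚ
                  cases false _ = ≤-reflexive (*-zeroˡ ⟦ act c′ ⟧)
                  cases true  e = ≤-reflexive (cong (λ b → 1ℚ * ⟦ b ⟧) (trans (cong act (==⇒≡ c′ c e)) off-c))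
            split true on-c = from-clash (any-elim (λ c′ → clash c (pk c) c′ (pk c′) ∧ act c′) (blocked-if-active (act c) (blocked act c (pk c)) on-c (proj₂ both)))
              where
              blocked-if-active : ∀ x b → x ≡ true → not (x ∧ not b) ≡ true → b ≡ true
              blocked-if-active true true _ _ = refl
              from-clash : (∃ λ c′ → clash c (pk c) c′ (pk c′) ∧ act c′ ≡ true) → 1ℚ ≤ S₁ v c i ω + S₂ c ω
              from-clash (c′ , h) = ≤-trans 1≤S₂ (≤-by (S₁ v c i ω) 0≤S₁ (+-comm (S₁ v c i ω) (S₂ c ω)))
                where
                1≤S₂ : 1ℚ ≤ S₂ c ω
                1≤S₂ = ≤-trans (≤-reflexive (sym (trans (sym (⟦∧⟧ (clash c (pk c) c′ (pk c′)) (act c′))) (cong ⟦_⟧ h))))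
                  (≤-trans (term≤∑ (λ c″ → *-nonneg (⟦⟧-nonneg (clash c (pk c) c″ (pk c″))) (⟦⟧-nonneg (act c″))) c′)
                    (≤-reflexive (sym (trans (cong (λ b → ⟦ b ⟧ * g c ω) on-c) (*-identityˡ (g c ω))))))

        dead≤ : ∀ ω c → let act c = st ω (c , zero) ; coin c i = st ω (c , suc i) in
                ∑ (λ i → ⟦ not (alive act coin c i) ⟧) ≤ linear (y (inj₁ c)) ω
        dead≤ ω c = begin
          ∑ (λ i → ⟦ not (alive act coin c i) ⟧)
            ≤⟨ ∑-mono (λ i → ≤-trans (de-morgan (coin c i) (blocked act c i)) (+-monoˡ-≤ ⟦ coin c i ⟧ (≤-trans (⟦any⟧≤∑ (λ c′ → clash c i c′ (pk c′) ∧ act c′)) (≤-reflexive (∑-cong (λ c′ → ⟦∧⟧ (clash c i c′ (pk c′)) (act c′))))))) ⟩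
          ∑ (λ i → ∑ (λ c′ → ⟦ clash c i c′ (pk c′) ⟧ * ⟦ act c′ ⟧) + ⟦ coin c i ⟧)
            ≡⟨ ∑-distrib-+ (λ i → ∑ (λ c′ → ⟦ clash c i c′ (pk c′) ⟧ * ⟦ act c′ ⟧)) (λ i → ⟦ coin c i ⟧) ⟩
          ∑ (λ i → ∑ (λ c′ → ⟦ clash c i c′ (pk c′) ⟧ * ⟦ act c′ ⟧)) + ∑ (λ i → ⟦ coin c i ⟧)
            ≡⟨ cong₂ _+_ (trans (∑-comm (λ i c′ → ⟦ clash c i c′ (pk c′) ⟧ * ⟦ act c′ ⟧)) (∑-cong (λ c′ → sym (∑-* (λ i → ⟦ clash c i c′ (pk c′) ⟧) ⟦ act c′ ⟧))))
                         (sym (trans (∑-cong (λ c′ → sym (*-∑ ⟦ c′ == c ⟧ (λ i → ⟦ coin c′ i ⟧)))) (∑-select c (λ c′ → ∑ (λ i → ⟦ coin c′ i ⟧))))) ⟩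
          ∑ (λ c′ → Y (inj₁ c) (c′ , zero) * ⟦ act c′ ⟧) + ∑₂ (λ c′ i → ⟦ c′ == c ⟧ * ⟦ coin c′ i ⟧)
            ≡⟨ ∑-distrib-+ (λ c′ → Y (inj₁ c) (c′ , zero) * ⟦ act c′ ⟧) (λ c′ → ∑ (λ i → ⟦ c′ == c ⟧ * ⟦ coin c′ i ⟧)) ⟨
          ∑ (λ c′ → Y (inj₁ c) (c′ , zero) * ⟦ st ω (c′ , zero) ⟧ + ∑ (λ i → Y (inj₁ c) (c′ , suc i) * ⟦ st ω (c′ , suc i) ⟧))
            ≡⟨ flatten (λ p → Y (inj₁ c) p * ⟦ st ω p ⟧) ⟨
          ∑ (λ j → Y (inj₁ c) (rq j) * ⟦ st ω (rq j) ⟧)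
            ≡⟨ ∑-cong (λ j → cong (λ b → Y (inj₁ c) (rq j) * ⟦ b ⟧) (sym (on-lookup ω j))) ⟩
          linear (y (inj₁ c)) ω ∎
          where
          open ≤-Reasoning
          act : Fin C → Bool
          act c = st ω (c , zero)
          coin : Fin C → Fin a → Bool
          coin c i = st ω (c , suc i)
          de-morgan : ∀ x b → ⟦ not (not x ∧ not b) ⟧ ≤ ⟦ b ⟧ + ⟦ x ⟧
          de-morgan true  b     = ≤-by ⟦ b ⟧ (⟦⟧-nonneg b) (+-comm ⟦ b ⟧ 1ℚ)
          de-morgan false true  = ≤-refl
          de-morgan false false = ≤-refl

      -- Colours and vertices are given the same price bound `K * M`, mean bound `θ * d * M` and
      -- tolerance `θ * t`; the hypotheses are what `concentrate` and `𝔼F≤` ask for at these values.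
      trim : d * (θ * crowding r h) ≤ t → K ≤ θ * d →
             ℤ.+ 44 / 1 * (ι (suc k) * ι (suc k)) * (K * influence r h) * (θ * d * influence r h) * L ≤ θ * t * (θ * t) →
             4ℚ * (ι (a ℕ.* Θ) * (θ * d * influence r h) * (ι (a ℕ.* Θ) * reach r h d (ι a))) ≤ L ^ suc k →
             Trimmed r d t
      trim dθE≤t K≤θd t-large k-large =
        conclude (concentrate k all f y (λ _ → K * M) (λ _ → θ * d * M) (λ _ → θ * t) L (θ * d * M) Δ
          f-lipschitz y-nonneg (λ i j x → natural⇒1≤ (y-natural i j x)) (λ i j x → ≤-trans (y≤Y i j x) (Y≤KM i (rq j)))
          (λ _ → <-≤-trans 0<1 1≤KM) (λ _ → *-monoʳ 0≤M K≤θd) mean≤μ (λ _ → ≤-refl) (λ _ → 0<θt) (λ _ → t-large)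
          Σy≤Δ (≤-trans 0≤1 1≤Δ) (<⇒≤ 0<L) 1≤degree k-large)
        where
        0<θt : 0ℚ < θ * t
        0<θt = *-pos 0<θ (<-≤-trans 0<1 1≤t)
        1≤Δ : 1ℚ ≤ Δ
        1≤Δ = ≤-by _ (+-nonneg 0≤Δ₁ 0≤r) (e Δ₁ r)
          where
          e : ∀ x r → x + (1ℚ + r) ≡ 1ℚ + (x + r)
          e = solve-∀ ℚ-ring
        1≤ιs : 1ℚ ≤ ι s
        1≤ιs = 1≤ι-nonZero s
        1≤degree : 1ℚ ≤ ι s * (θ * d * M) * (ι s * Δ)
        1≤degree = one* (subst (1ℚ ≤_) (sym factor) (one* (one* (1≤ι-nonZero a) 1≤d) 1≤M)) (one* 1≤ιs 1≤Δ)
          where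
          one* : ∀ {x y} → 1ℚ ≤ x → 1ℚ ≤ y → 1ℚ ≤ x * y
          one* {x} 1≤x 1≤y = *-mono {1ℚ} {x} {1ℚ} (≤-trans 0≤1 1≤x) 0≤1 1≤x 1≤y
          factor : ι s * (θ * d * M) ≡ ι a * d * M
          factor = trans (cong (_* (θ * d * M)) (ι-* a Θ)) (trans (regroup (ι a) (ι Θ) θ d M) (trans (cong (λ q → ι a * q * d * M) (ι*inv Θ)) (cong (λ q → q * d * M) (*-identityʳ (ι a)))))
            where
            regroup : ∀ a T θ d M → a * T * (θ * d * M) ≡ a * (T * θ) * d * M
            regroup = solve-∀ ℚ-ring
        conclude : (∃ λ ω → ∀ i → i ∈ all → (f i ω - 𝔼 (f i)) * (f i ω - 𝔼 (f i)) < θ * t * (θ * t)) → Trimmed r d t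
        conclude (ω , close) = record
          { act    = λ c → st ω (c , zero)
          ; coin   = λ c i → st ω (c , suc i)
          ; loss   = λ c → ≤-trans (dead≤ ω c) (≤-trans (deviation-upper 0<θt (close (inj₁ c) (∈-all _)))
                       (≤-trans (+-monoˡ-≤ (θ * t) (≤-trans (≤-reflexive (𝔼-linear (y (inj₁ c)))) (mean-colour c))) (≤-reflexive (e₁ θ (r * d) t))))
          ; degree = λ v → ≤-trans (∑₂-mono (λ c i → *-monoˡ (⟦⟧-nonneg (edge c i v)) (survives≤ ω v c i)))
                       (≤-trans (deviation-upper 0<θt (close (inj₂ v) (∈-all _))) (≤-trans (+-monoˡ-≤ (θ * t) (𝔼F≤ dθE≤t v)) (≤-reflexive (e₂ (d - θ * (d + α * (r * d - d) * d)) (θ * t)))))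
          }
          where
          e₁ : ∀ θ x t → θ * (x + t) + θ * t ≡ θ * (x + 2ℚ * t)
          e₁ = solve-∀ ℚ-ring
          e₂ : ∀ x y → x + 3ℚ * y + y ≡ x + 4ℚ * y
          e₂ = solve-∀ ℚ-ring

  -- The bound on sums stands in for injectivity of `sub`: it is the form in which degrees of the
  -- smaller family are compared with the larger.
  selection : ∀ {n} (p : Fin n → Bool) m → ι m ≤ ∑ (λ i → ⟦ p i ⟧) →
              Σ (Fin m → Fin n) λ sub → (∀ i → p (sub i) ≡ true) × ((g : Fin n → ℚ) → (∀ i → 0ℚ ≤ g i) → ∑ (λ i → g (sub i)) ≤ ∑ (λ i → ⟦ p i ⟧ * g i))
  selection p zero _ = (λ ()) , (λ ()) , λ g 0≤g → ∑-nonneg (λ i → *-nonneg (⟦⟧-nonneg (p i)) (0≤g i))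
  selection {zero} p (suc m) h = ⊥-elim (<-irrefl refl (<-≤-trans (0<ι m) h))
  selection {suc n} p (suc m) h with p zero in eq
  ... | false = let (sub , hit , sum) = selection (λ i → p (suc i)) (suc m) (≤-trans h (≤-reflexive (+-identityˡ (∑ (λ i → ⟦ p (suc i) ⟧))))) in
    (λ i → suc (sub i)) , hit , λ g 0≤g → ≤-trans (sum (λ i → g (suc i)) (λ i → 0≤g (suc i))) (≤-by (0ℚ * g zero) (*-nonneg ≤-refl (0≤g zero)) (+-comm (0ℚ * g zero) (∑ (λ i → ⟦ p (suc i) ⟧ * g (suc i)))))
  ... | true = let (sub , hit , sum) = selection (λ i → p (suc i)) m (≤-by-cancel h) in
    (λ { zero → zero ; (suc i) → suc (sub i) }) , (λ { zero → eq ; (suc i) → hit i }) , λ g 0≤g → +-mono-≤ (≤-reflexive (sym (*-identityˡ (g zero)))) (sum (λ i → g (suc i)) (λ i → 0≤g (suc i)))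
    where
    ≤-by-cancel : ∀ {x y} → 1ℚ + x ≤ 1ℚ + y → x ≤ y
    ≤-by-cancel {x} {y} h = ≤-by _ (p≤q⇒0≤q-p h) (e x y)
      where
      e : ∀ x y → y ≡ x + ((1ℚ + y) - (1ℚ + x))
      e = solve-∀ ℚ-ring

  module _ {C a V} .{{_ : ℕ.NonZero a}} (edge : Family C a V) (Θ : ℕ) .{{_ : ℕ.NonZero Θ}} (pk : Fin C → Fin a) where
    open Incidence edge
    open Trimming edge Θ pk

    -- Retained colours keep their chosen edges and the others use the transversal supplied by
    -- `rest` on exactly `a′` live edges per colour. Retained chosen edges and live edges alike are
    -- unblocked, that is, disjoint from the chosen edges of all other activated colours; this
    -- settles every pair with a retained colour, and `rest` settles the others.
    trimmed⇒transversal : ∀ {r d K t} → Bounded edge r d K → Trimmed r d t → ∀ a′ → ι a′ ≤ ι a - θ * (r * d + 2ℚ * t) →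
      ((edge′ : Family C a′ V) → Bounded edge′ r (d - θ * (d + α * (r * d - d) * d) + 4ℚ * (θ * t)) K → Transversal edge′) → Transversal edge
    trimmed⇒transversal {r} {d} {K} {t} bounded trimmed a′ a′≤ rest = pick , λ c c′ c≢c′ v → disjoint c c′ c≢c′ v (ret c) (ret c′) refl refl
      where
      open Bounded bounded
      open Trimmed trimmed
      ret : Fin C → Bool
      ret = retained act
      live : Fin C → Fin a → Bool
      live = alive act coin
      enough : ∀ c → ι a′ ≤ ∑ (λ i → ⟦ live c i ⟧)
      enough c = ≤-trans a′≤ (≤-trans (+-monoʳ-≤ (ι a) (neg-antimono-≤ (loss c))) (≤-reflexive complement))
        where
        complement : ι a - ∑ (λ i → ⟦ not (live c i) ⟧) ≡ ∑ (λ i → ⟦ live c i ⟧)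
        complement = trans (cong (λ q → ι a - q) (trans (∑-cong (λ i → ⟦not⟧ (live c i))) (trans (∑-- (λ _ → 1ℚ) (λ i → ⟦ live c i ⟧)) (cong (_- ∑ (λ i → ⟦ live c i ⟧)) (trans (∑-const a 1ℚ) (*-identityʳ (ι a))))))) (e (ι a) (∑ (λ i → ⟦ live c i ⟧)))
          where
          e : ∀ x y → x - (x - y) ≡ y
          e = solve-∀ ℚ-ring
      sub : Fin C → Fin a′ → Fin a
      sub c = proj₁ (selection (live c) a′ (enough c))
      sub-live : ∀ c i → live c (sub c i) ≡ true
      sub-live c = proj₁ (proj₂ (selection (live c) a′ (enough c)))
      sub-∑ : ∀ c (g : Fin a → ℚ) → (∀ i → 0ℚ ≤ g i) → ∑ (λ i → g (sub c i)) ≤ ∑ (λ i → ⟦ live c i ⟧ * g i)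
      sub-∑ c = proj₂ (proj₂ (selection (live c) a′ (enough c)))
      sub-∑′ : ∀ c (g : Fin a → ℚ) → (∀ i → 0ℚ ≤ g i) → ∑ (λ i → g (sub c i)) ≤ ∑ g
      sub-∑′ c g 0≤g = ≤-trans (sub-∑ c g 0≤g) (∑-mono (λ i → ≤-trans (*-monoʳ (0≤g i) (⟦⟧≤1 (live c i))) (≤-reflexive (*-identityˡ (g i)))))
      -- Matched colours stay in the family, with empty edges.
      edge′ : Family C a′ V
      edge′ c i v = not (ret c) ∧ edge c (sub c i) v
      edge′≤ : ∀ c i v → ⟦ edge′ c i v ⟧ ≤ ⟦ edge c (sub c i) v ⟧
      edge′≤ c i v = ⟦⟧-mono {edge′ c i v} {edge c (sub c i) v} (λ h → proj₂ (∧-true {not (ret c)} h))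
      bounded′ : Bounded edge′ r (d - θ * (d + α * (r * d - d) * d) + 4ℚ * (θ * t)) K
      bounded′ = record
        { size   = λ c i → ≤-trans (∑-mono (edge′≤ c i)) (size c (sub c i))
        ; deg    = λ v → ≤-trans (∑-mono (λ c → ≤-trans (≤-reflexive (∑-cong (λ i → ⟦∧⟧ (not (ret c)) (edge c (sub c i) v))))
                     (sub-∑ c (λ i → ⟦ not (ret c) ⟧ * ⟦ edge c i v ⟧) (λ i → *-nonneg (⟦⟧-nonneg (not (ret c))) (⟦⟧-nonneg (edge c i v))))))
                     (≤-trans (≤-reflexive (∑₂-cong (λ c i → trans (rotate ⟦ live c i ⟧ ⟦ not (ret c) ⟧ ⟦ edge c i v ⟧) (cong (⟦ edge c i v ⟧ *_) (sym (⟦∧⟧ (live c i) (not (ret c)))))))) (degree v))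
        ; codeg  = λ u v u≢v → ≤-trans (∑-mono (λ c → ≤-trans (∑-mono (λ i → *-mono (⟦⟧-nonneg (edge c (sub c i) u)) (⟦⟧-nonneg (edge′ c i v)) (edge′≤ c i u) (edge′≤ c i v)))
                     (sub-∑′ c (λ i → ⟦ edge c i u ⟧ * ⟦ edge c i v ⟧) (λ i → *-nonneg (⟦⟧-nonneg (edge c i u)) (⟦⟧-nonneg (edge c i v)))))) (codeg u v u≢v)
        ; coldeg = λ v c → ≤-trans (∑-mono (λ i → edge′≤ c i v)) (≤-trans (sub-∑′ c (λ i → ⟦ edge c i v ⟧) (λ i → ⟦⟧-nonneg (edge c i v))) (coldeg v c))
        }
        where
        rotate : ∀ x y z → x * (y * z) ≡ z * (x * y)
        rotate = solve-∀ ℚ-ring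
      pick′ : Fin C → Fin a′
      pick′ = proj₁ (rest edge′ bounded′)
      pick′-disjoint : ∀ c c′ → c ≢ c′ → ∀ v → edge′ c (pick′ c) v ≡ true → edge′ c′ (pick′ c′) v ≡ false
      pick′-disjoint = proj₂ (rest edge′ bounded′)
      choose : Bool → Fin C → Fin a
      choose true  c = pk c
      choose false c = sub c (pick′ c)
      pick : Fin C → Fin a
      pick c = choose (ret c) c
      not-blocked : ∀ {c i c′ v} → c ≢ c′ → blocked act c i ≡ false → act c′ ≡ true → edge c i v ≡ true → edge c′ (pk c′) v ≡ false
      not-blocked {c} {i} {c′} {v} c≢c′ free active h = cases (edge c′ (pk c′) v) refl
        where
        cases : ∀ b → edge c′ (pk c′) v ≡ b → b ≡ false
        cases false _  = refl
        cases true  h′ = ⊥-elim (false≢true (trans (sym (any-false (λ c″ → clash c i c″ (pk c″) ∧ act c″) free c′)) (cong₂ _∧_ (clash-intro c≢c′ h h′) active)))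
      not-true : ∀ {b} → not b ≡ true → b ≡ false
      not-true {false} _ = refl
      ret-act : ∀ {c} → ret c ≡ true → act c ≡ true
      ret-act {c} h = proj₁ (∧-true {act c} h)
      ret-free : ∀ {c} → ret c ≡ true → blocked act c (pk c) ≡ false
      ret-free {c} h = not-true (proj₂ (∧-true {act c} h))
      live-free : ∀ c i → blocked act c (sub c i) ≡ false
      live-free c i = not-true (proj₂ (∧-true {not (coin c (sub c i))} (sub-live c i)))
      flip : ∀ {x y : Bool} → (y ≡ true → x ≡ false) → x ≡ true → y ≡ false
      flip {true} {false} h _ = refl
      flip {true} {true}  h _ = h refl
      disjoint : ∀ c c′ → c ≢ c′ → ∀ v b b′ → ret c ≡ b → ret c′ ≡ b′ → edge c (choose b c) v ≡ true → edge c′ (choose b′ c′) v ≡ false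
      disjoint c c′ c≢c′ v true  true  eq eq′ = not-blocked c≢c′ (ret-free eq) (ret-act eq′)
      disjoint c c′ c≢c′ v true  false eq eq′ = flip (not-blocked (λ e → c≢c′ (sym e)) (live-free c′ (pick′ c′)) (ret-act eq))
      disjoint c c′ c≢c′ v false true  eq eq′ = not-blocked c≢c′ (live-free c (pick′ c)) (ret-act eq′)
      disjoint c c′ c≢c′ v false false eq eq′ h =
        trans (cong (λ b → not b ∧ edge c′ (sub c′ (pick′ c′)) v) (sym eq′)) (pick′-disjoint c c′ c≢c′ v (trans (cong (λ b → not b ∧ edge c (sub c (pick′ c)) v) eq) h))

  -- Iterating the step

  *-mono′ : ∀ {p p′ q q′} → 0ℚ ≤ p → 0ℚ ≤ q → p ≤ p′ → q ≤ q′ → p * q ≤ p′ * q′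
  *-mono′ 0≤p 0≤q p≤p′ q≤q′ = *-mono (≤-trans 0≤p p≤p′) 0≤q p≤p′ q≤q′

  1≤* : ∀ {x y} → 1ℚ ≤ x → 1ℚ ≤ y → 1ℚ ≤ x * y
  1≤* {x} 1≤x 1≤y = *-mono {1ℚ} {x} {1ℚ} (≤-trans 0≤1 1≤x) 0≤1 1≤x 1≤y

  -- Bernoulli's inequality in reciprocal form: it trades an `n`-th power close to 1 for a rational
  -- factor that can be compared with `β`.
  bernoulli : ∀ n x → 0ℚ ≤ x → x ≤ 1ℚ → (1ℚ - x) ^ n * (1ℚ + ι n * x) ≤ 1ℚ
  bernoulli zero x 0≤x x≤1 = ≤-reflexive (e x)
    where
    e : ∀ x → 1ℚ * (1ℚ + 0ℚ * x) ≡ 1ℚ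
    e = solve-∀ ℚ-ring
  bernoulli (suc n) x 0≤x x≤1 = ≤-trans (≤-by _ (*-nonneg (^-nonneg n (p≤q⇒0≤q-p x≤1)) (*-nonneg (+-nonneg 0≤1 (ι-nonneg n)) (sq-nonneg x))) (e ((1ℚ - x) ^ n) x (ι n))) (bernoulli n x 0≤x x≤1)
    where
    e : ∀ q x n → q * (1ℚ + n * x) ≡ (1ℚ - x) * q * (1ℚ + (1ℚ + n) * x) + q * ((1ℚ + n) * (x * x))
    e = solve-∀ ℚ-ring

  -- One step multiplies the surplus y = a − d by at least β and the degree d by at most β (1 − θ/2),
  -- so that d ^ n / y ^ (n + 1) does not grow once (1 − θ/2) ^ n ≤ β.
  potential-step : ∀ n (θ β r d d′ y y′ D ℓ⁺ : ℚ) → 0ℚ ≤ θ → θ ≤ 1ℚ → ι n ≡ 1ℚ + 2ℚ * r → 0ℚ ≤ r → r * ι n * θ ≤ 1ℚ → 1ℚ - r * θ ≤ β → β ≤ 1ℚ → 0ℚ ≤ β →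
    0ℚ ≤ d′ → 0ℚ ≤ d → d′ ≤ d * (β * (1ℚ - ½ * θ)) → y * β ≤ y′ → 0ℚ ≤ y → 0ℚ ≤ D → 0ℚ ≤ ℓ⁺ →
    d ^ n * D ≤ (ℓ⁺ * y) ^ suc n → d′ ^ n * D ≤ (ℓ⁺ * y′) ^ suc n
  potential-step n θ β r d d′ y y′ D ℓ⁺ 0≤θ θ≤1 n≡ 0≤r rnθ≤1 β≥ β≤1 0≤β 0≤d′ 0≤d d′≤ y′≥ 0≤y 0≤D 0≤ℓ⁺ I = begin
    d′ ^ n * D                              ≤⟨ *-monoʳ 0≤D (^-mono-≤ n 0≤d′ d′≤) ⟩
    (d * (β * z)) ^ n * D                   ≡⟨ cong (_* D) (trans (^-distrib-* d (β * z) n) (cong (d ^ n *_) (^-distrib-* β z n))) ⟩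
    d ^ n * (β ^ n * z ^ n) * D             ≡⟨ e₁ (d ^ n) (β ^ n) (z ^ n) D ⟩
    d ^ n * D * (β ^ n * z ^ n)             ≤⟨ *-mono′ (*-nonneg (^-nonneg n 0≤d) 0≤D) (*-nonneg (^-nonneg n 0≤β) (^-nonneg n 0≤z)) I (*-monoˡ (^-nonneg n 0≤β) zⁿ≤β) ⟩
    (ℓ⁺ * y) ^ suc n * (β ^ n * β)          ≡⟨ cong ((ℓ⁺ * y) ^ suc n *_) (*-comm (β ^ n) β) ⟩
    (ℓ⁺ * y) ^ suc n * β ^ suc n            ≡⟨ ^-distrib-* (ℓ⁺ * y) β (suc n) ⟨
    (ℓ⁺ * y * β) ^ suc n                    ≤⟨ ^-mono-≤ (suc n) (*-nonneg (*-nonneg 0≤ℓ⁺ 0≤y) 0≤β) (≤-trans (≤-reflexive (*-assoc ℓ⁺ y β)) (*-monoˡ 0≤ℓ⁺ y′≥)) ⟩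
    (ℓ⁺ * y′) ^ suc n                       ∎
    where
    open ≤-Reasoning
    x = ½ * θ
    z = 1ℚ - x
    0≤½ = nonNegative⁻¹ ½
    0≤x = *-nonneg 0≤½ 0≤θ
    x≤1 : x ≤ 1ℚ
    x≤1 = ≤-by _ (+-nonneg 0≤½ (*-nonneg 0≤½ (p≤q⇒0≤q-p θ≤1))) (e θ)
      where
      e : ∀ θ → 1ℚ ≡ ½ * θ + (½ + ½ * (1ℚ - θ))
      e = solve-∀ ℚ-ring
    0≤z = p≤q⇒0≤q-p x≤1
    e₁ : ∀ a b c d → a * (b * c) * d ≡ a * d * (b * c)
    e₁ = solve-∀ ℚ-ring
    -- Here `n = 1 + 2 r` is chosen so that `n θ / 2` exceeds `r θ` by `θ / 2`; this excess covers
    -- the cross term as long as `r n θ ≤ 1`.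
    1≤[1+nx]β : 1ℚ ≤ (1ℚ + ι n * x) * β
    1≤[1+nx]β = ≤-trans (≤-by _ (*-nonneg 0≤x (p≤q⇒0≤q-p rnθ≤1)) (e r θ (ι n) n≡)) (*-monoˡ (+-nonneg 0≤1 (*-nonneg (ι-nonneg n) 0≤x)) β≥)
      where
      e′ : ∀ r θ → (1ℚ + (1ℚ + 2ℚ * r) * (½ * θ)) * (1ℚ - r * θ) ≡ 1ℚ + ½ * θ * (1ℚ - r * (1ℚ + 2ℚ * r) * θ)
      e′ = solve-∀ ℚ-ring
      e : ∀ r θ m → m ≡ 1ℚ + 2ℚ * r → (1ℚ + m * (½ * θ)) * (1ℚ - r * θ) ≡ 1ℚ + ½ * θ * (1ℚ - r * m * θ)
      e r θ m refl = e′ r θ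
    zⁿ≤β : z ^ n ≤ β
    zⁿ≤β = begin
      z ^ n                             ≡⟨ *-identityʳ (z ^ n) ⟨
      z ^ n * 1ℚ                        ≤⟨ *-monoˡ (^-nonneg n 0≤z) 1≤[1+nx]β ⟩
      z ^ n * ((1ℚ + ι n * x) * β)      ≡⟨ *-assoc (z ^ n) (1ℚ + ι n * x) β ⟨
      z ^ n * (1ℚ + ι n * x) * β        ≤⟨ *-monoʳ 0≤β (bernoulli n x 0≤x x≤1) ⟩
      1ℚ * β                            ≡⟨ *-identityˡ β ⟩
      β                                 ∎

  module Nibble (ρ L k : ℕ) .{{_ : ℕ.NonZero L}} (1≤ρ : 1 ℕ.≤ ρ) {A D K : ℚ}
    (L-large : ℤ.+ 44 / 1 * (ι (suc k) * ι (suc k)) * ((3ℚ * ι ρ + 1ℚ) * (3ℚ * ι ρ + 1ℚ)) ≤ ι L)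
    (1≤A : 1ℚ ≤ A) (k-large : ι L ^ 17 * A ^ 4 ≤ ι L ^ suc k)
    (1≤K : 1ℚ ≤ K) (K-small : K * ι L ^ (14 ℕ.+ 2 ℕ.* suc (1 ℕ.+ 2 ℕ.* ρ)) ≤ D) where

    private
      r ℓ κ² u : ℚ
      r = ι ρ
      ℓ = ι L
      κ² = ι (suc k) * ι (suc k)
      u = 3ℚ * r + 1ℚ
      n = 1 ℕ.+ 2 ℕ.* ρ
      n≡ : ι n ≡ 1ℚ + 2ℚ * r
      n≡ = cong (1ℚ +_) (ι-* 2 ρ)
      1≤r : 1ℚ ≤ r
      1≤r = ι-mono 1≤ρ
      0≤r = ι-nonneg ρ
      0≤ℓ = ι-nonneg L
      1≤ℓ : 1ℚ ≤ ℓ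
      1≤ℓ = 1≤ι-nonZero L
      0<ℓ = <-≤-trans 0<1 1≤ℓ
      0≤K = ≤-trans 0≤1 1≤K
      0≤A = ≤-trans 0≤1 1≤A
      1≤κ² : 1ℚ ≤ κ²
      1≤κ² = 1≤* (1≤ι k) (1≤ι k)
      0≤κ² = ≤-trans 0≤1 1≤κ²
      0≤44 = 0≤ 44
      4≤u : 4ℚ ≤ u
      4≤u = ≤-by _ (*-nonneg (0≤ 3) (p≤q⇒0≤q-p 1≤r)) (e r)
        where
        e : ∀ r → 3ℚ * r + 1ℚ ≡ 4ℚ + 3ℚ * (r - 1ℚ)
        e = solve-∀ ℚ-ring
      0≤u = ≤-trans (0≤ 4) 4≤u
      r≤u : r ≤ u
      r≤u = ≤-by _ (+-nonneg (*-nonneg (0≤ 2) 0≤r) 0≤1) (e r)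
        where
        e : ∀ r → 3ℚ * r + 1ℚ ≡ r + (2ℚ * r + 1ℚ)
        e = solve-∀ ℚ-ring
      0≤u² = *-nonneg 0≤u 0≤u
      44u²≤ℓ : ℤ.+ 44 / 1 * (u * u) ≤ ℓ
      44u²≤ℓ = ≤-trans (≤-by _ (*-nonneg 0≤44 (*-nonneg (p≤q⇒0≤q-p 1≤κ²) 0≤u²)) (e κ² (u * u))) L-large
        where
        e : ∀ κ x → ℤ.+ 44 / 1 * κ * x ≡ ℤ.+ 44 / 1 * x + ℤ.+ 44 / 1 * ((κ - 1ℚ) * x)
        e = solve-∀ ℚ-ring
      44u≤ℓ : ℤ.+ 44 / 1 * u ≤ ℓ
      44u≤ℓ = ≤-trans (≤-by _ (*-nonneg 0≤44 (*-nonneg 0≤u (p≤q⇒0≤q-p (≤-trans (≤-by {1ℚ} {4ℚ} 3ℚ (0≤ 3) refl) 4≤u)))) (e u)) 44u²≤ℓ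
        where
        e : ∀ u → ℤ.+ 44 / 1 * (u * u) ≡ ℤ.+ 44 / 1 * u + ℤ.+ 44 / 1 * (u * (u - 1ℚ))
        e = solve-∀ ℚ-ring
      below-ℓ : ∀ {x} → x ≤ ℤ.+ 44 / 1 * u → x ≤ ℓ
      below-ℓ h = ≤-trans h 44u≤ℓ
      u≤ℓ : u ≤ ℓ
      u≤ℓ = below-ℓ (≤-by _ (*-nonneg (0≤ 43) 0≤u) (e u))
        where
        e : ∀ u → ℤ.+ 44 / 1 * u ≡ u + ℤ.+ 43 / 1 * u
        e = solve-∀ ℚ-ring
      r≤ℓ = ≤-trans r≤u u≤ℓ
      36≤ℓ : ℤ.+ 36 / 1 ≤ ℓ
      36≤ℓ = below-ℓ (≤-trans (≤-by (ℤ.+ 140 / 1) (0≤ 140) refl) (*-monoˡ 0≤44 4≤u))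
      4≤ℓ : 4ℚ ≤ ℓ
      4≤ℓ = ≤-trans 4≤u u≤ℓ
      44κ²≤ℓ : ℤ.+ 44 / 1 * κ² ≤ ℓ
      44κ²≤ℓ = ≤-trans (≤-by _ (*-nonneg (*-nonneg 0≤44 0≤κ²) (p≤q⇒0≤q-p (1≤* 1≤u 1≤u))) (e κ² (u * u))) L-large
        where
        1≤u : 1ℚ ≤ u
        1≤u = ≤-trans 1≤r r≤u
        e : ∀ κ x → ℤ.+ 44 / 1 * κ * x ≡ ℤ.+ 44 / 1 * κ + ℤ.+ 44 / 1 * κ * (x - 1ℚ)
        e = solve-∀ ℚ-ring
      44κ²r²≤ℓ : ℤ.+ 44 / 1 * κ² * (r * r) ≤ ℓ
      44κ²r²≤ℓ = ≤-trans (*-monoˡ (*-nonneg 0≤44 0≤κ²) (*-mono′ 0≤r 0≤r r≤u r≤u)) L-large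
      h = 1ℚ + ℓ
      0≤h = +-nonneg 0≤1 0≤ℓ
      crowding≤ℓ³ : crowding r h ≤ ℓ * (ℓ * ℓ)
      crowding≤ℓ³ = ≤-trans (+-mono-≤ (*-mono′ 0≤G 0≤G G≤uℓ G≤uℓ) (≤-trans rh≤uℓ (≤-trans (≤-reflexive (sym (*-identityˡ (u * ℓ)))) (*-monoʳ (*-nonneg 0≤u 0≤ℓ) 1≤uℓ))))
        (≤-trans (≤-reflexive (e₁ u ℓ)) (≤-trans (*-monoʳ (*-nonneg 0≤ℓ 0≤ℓ) 2u²≤ℓ) (≤-reflexive refl)))
        where
        0≤G : 0ℚ ≤ 1ℚ + r + r * h
        0≤G = +-nonneg (+-nonneg 0≤1 0≤r) (*-nonneg 0≤r 0≤h)
        G≤uℓ : 1ℚ + r + r * h ≤ u * ℓ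
        G≤uℓ = ≤-by _ (*-nonneg (+-nonneg (*-nonneg (0≤ 2) 0≤r) 0≤1) (p≤q⇒0≤q-p 1≤ℓ)) (e r ℓ)
          where
          e : ∀ r ℓ → (3ℚ * r + 1ℚ) * ℓ ≡ (1ℚ + r + r * (1ℚ + ℓ)) + (2ℚ * r + 1ℚ) * (ℓ - 1ℚ)
          e = solve-∀ ℚ-ring
        rh≤uℓ : r * h ≤ u * ℓ
        rh≤uℓ = ≤-trans (≤-by _ (+-nonneg 0≤1 0≤r) (+-comm (1ℚ + r) (r * h))) G≤uℓ
        1≤uℓ : 1ℚ ≤ u * ℓ
        1≤uℓ = 1≤* (≤-trans 1≤r r≤u) 1≤ℓ
        e₁ : ∀ u ℓ → u * ℓ * (u * ℓ) + u * ℓ * (u * ℓ) ≡ 2ℚ * (u * u) * (ℓ * ℓ)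
        e₁ = solve-∀ ℚ-ring
        2u²≤ℓ : 2ℚ * (u * u) ≤ ℓ
        2u²≤ℓ = ≤-trans (≤-by _ (*-nonneg (0≤ 42) 0≤u²) (e (u * u))) 44u²≤ℓ
          where
          e : ∀ x → ℤ.+ 44 / 1 * x ≡ 2ℚ * x + ℤ.+ 42 / 1 * x
          e = solve-∀ ℚ-ring
      M = influence r h
      0≤M : 0ℚ ≤ M
      0≤M = +-nonneg (+-nonneg 0≤1 (*-nonneg (0≤ 2) 0≤r)) (*-nonneg (0≤ 3) (*-nonneg 0≤r 0≤h))
      M≤2uℓ : M ≤ 2ℚ * u * ℓ
      M≤2uℓ = ≤-by _ (+-nonneg (*-nonneg (*-nonneg (0≤ 3) 0≤r) (p≤q⇒0≤q-p (≤-trans (≤-by {2ℚ} {4ℚ} 2ℚ (0≤ 2) refl) 4≤ℓ))) (+-nonneg (*-nonneg (0≤ 2) (p≤q⇒0≤q-p 1≤ℓ)) (+-nonneg 0≤r 0≤1))) (e r ℓ)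
        where
        e : ∀ r ℓ → 2ℚ * (3ℚ * r + 1ℚ) * ℓ ≡ (1ℚ + 2ℚ * r + 3ℚ * (r * (1ℚ + ℓ))) + (3ℚ * r * (ℓ - 2ℚ) + (2ℚ * (ℓ - 1ℚ) + (r + 1ℚ)))
        e = solve-∀ ℚ-ring
      44κ²M²≤ℓ⁴ : ℤ.+ 44 / 1 * κ² * (M * M) ≤ ℓ * ℓ * (ℓ * ℓ)
      44κ²M²≤ℓ⁴ = ≤-trans (*-monoˡ (*-nonneg 0≤44 0≤κ²) (*-mono′ 0≤M 0≤M M≤2uℓ M≤2uℓ)) (≤-trans (≤-reflexive (e κ² u ℓ))
        (*-mono′ (*-nonneg (0≤ 4) (*-nonneg (*-nonneg 0≤44 0≤κ²) 0≤u²)) (*-nonneg 0≤ℓ 0≤ℓ) (*-mono′ (0≤ 4) (*-nonneg (*-nonneg 0≤44 0≤κ²) 0≤u²) 4≤ℓ L-large) ≤-refl))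
        where
        e : ∀ κ u ℓ → ℤ.+ 44 / 1 * κ * (2ℚ * u * ℓ * (2ℚ * u * ℓ)) ≡ 4ℚ * (ℤ.+ 44 / 1 * κ * (u * u)) * (ℓ * ℓ)
        e = solve-∀ ℚ-ring
      M≤ℓ² : M ≤ ℓ * ℓ
      M≤ℓ² = ≤-trans M≤2uℓ (*-monoʳ 0≤ℓ (below-ℓ {2ℚ * u} (≤-by _ (*-nonneg (0≤ 42) 0≤u) (e u))))
        where
        e : ∀ u → ℤ.+ 44 / 1 * u ≡ 2ℚ * u + ℤ.+ 42 / 1 * u
        e = solve-∀ ℚ-ring

      -- The crowding coefficient is at most `ℓ³` and the tolerance is `d / ℓ²`. Second-order terms
      -- `d * θ * crowding` thus fit into the tolerance for `θ = 1 / ℓ⁵`.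
      Θ = L ℕ.^ 5
      instance
        Θ≢0 : ℕ.NonZero Θ
        Θ≢0 = ℕ.m^n≢0 L 5
      θ = inv Θ
      0<θ = 0<inv Θ
      0≤θ = <⇒≤ 0<θ
      ℓ⁵ = ℓ * (ℓ * (ℓ * (ℓ * ℓ)))
      ιΘ : ι Θ ≡ ℓ⁵
      ιΘ = trans (ι-^ L 5) (e ℓ)
        where
        e : ∀ ℓ → ℓ * (ℓ * (ℓ * (ℓ * (ℓ * 1ℚ)))) ≡ ℓ * (ℓ * (ℓ * (ℓ * ℓ)))
        e = solve-∀ ℚ-ring
      θℓ⁵ : θ * ℓ⁵ ≡ 1ℚ
      θℓ⁵ = trans (cong (θ *_) (sym ιΘ)) (trans (*-comm θ (ι Θ)) (ι*inv Θ))
      1≤ℓ⁴ : 1ℚ ≤ ℓ * (ℓ * (ℓ * ℓ))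
      1≤ℓ⁴ = 1≤* 1≤ℓ (1≤* 1≤ℓ (1≤* 1≤ℓ 1≤ℓ))
      ℓ≤Θ : ℓ ≤ ι Θ
      ℓ≤Θ = ≤-trans (≤-reflexive (sym (*-identityʳ ℓ))) (≤-trans (*-monoˡ 0≤ℓ 1≤ℓ⁴) (≤-reflexive (sym ιΘ)))
      θ*≤1 : ∀ {x} → x ≤ ℓ → θ * x ≤ 1ℚ
      θ*≤1 h = ≤-trans (*-monoˡ 0≤θ (≤-trans h ℓ≤Θ)) (≤-reflexive (trans (*-comm θ (ι Θ)) (ι*inv Θ)))
      θ≤1 : θ ≤ 1ℚ
      θ≤1 = ≤-trans (≤-reflexive (sym (*-identityʳ θ))) (θ*≤1 1≤ℓ)

      1+2rh≤ℓ² : 1ℚ + 2ℚ * (r * h) ≤ ℓ * ℓ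
      1+2rh≤ℓ² = ≤-trans (≤-by _ (+-nonneg (*-nonneg (0≤ 2) 0≤r) (*-nonneg 0≤r 0≤h)) (e r (r * h))) M≤ℓ²
        where
        e : ∀ r x → 1ℚ + 2ℚ * r + 3ℚ * x ≡ 1ℚ + 2ℚ * x + (2ℚ * r + x)
        e = solve-∀ ℚ-ring
      1+r≤ℓ : 1ℚ + r ≤ ℓ
      1+r≤ℓ = ≤-trans (≤-by _ (*-nonneg (0≤ 2) 0≤r) (e r)) u≤ℓ
        where
        e : ∀ r → 3ℚ * r + 1ℚ ≡ 1ℚ + r + 2ℚ * r
        e = solve-∀ ℚ-ring
      2r≤ℓ : 2ℚ * r ≤ ℓ
      2r≤ℓ = ≤-trans (≤-by _ (+-nonneg 0≤r 0≤1) (e r)) u≤ℓ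
        where
        e : ∀ r → 3ℚ * r + 1ℚ ≡ 2ℚ * r + (r + 1ℚ)
        e = solve-∀ ℚ-ring
      r+2≤ℓ : r + 2ℚ ≤ ℓ
      r+2≤ℓ = ≤-trans (≤-by _ (+-nonneg (p≤q⇒0≤q-p 1≤r) 0≤r) (e r)) u≤ℓ
        where
        e : ∀ r → 3ℚ * r + 1ℚ ≡ r + 2ℚ + ((r - 1ℚ) + r)
        e = solve-∀ ℚ-ring
      rn≤ℓ : r * ι n ≤ ℓ
      rn≤ℓ = ≤-trans (≤-by _ (+-nonneg (*-nonneg (0≤ 43) 0≤u²) (+-nonneg (*-nonneg (0≤ 7) (*-nonneg 0≤r 0≤r)) (+-nonneg (*-nonneg (0≤ 5) 0≤r) 0≤1))) (e r (ι n) n≡)) 44u²≤ℓ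
        where
        e′ : ∀ r → ℤ.+ 44 / 1 * ((3ℚ * r + 1ℚ) * (3ℚ * r + 1ℚ)) ≡ r * (1ℚ + 2ℚ * r) + (ℤ.+ 43 / 1 * ((3ℚ * r + 1ℚ) * (3ℚ * r + 1ℚ)) + (7ℚ * (r * r) + (5ℚ * r + 1ℚ)))
        e′ = solve-∀ ℚ-ring
        e : ∀ r m → m ≡ 1ℚ + 2ℚ * r → ℤ.+ 44 / 1 * ((3ℚ * r + 1ℚ) * (3ℚ * r + 1ℚ)) ≡ r * m + (ℤ.+ 43 / 1 * ((3ℚ * r + 1ℚ) * (3ℚ * r + 1ℚ)) + (7ℚ * (r * r) + (5ℚ * r + 1ℚ)))
        e r m refl = e′ r
      16rh≤ℓ² : ℤ.+ 16 / 1 * r * h ≤ ℓ * ℓ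
      16rh≤ℓ² = ≤-trans (≤-by _ (+-nonneg (*-nonneg (*-nonneg (0≤ 16) 0≤r) (p≤q⇒0≤q-p 1≤ℓ)) (*-nonneg (+-nonneg (*-nonneg (0≤ 100) 0≤r) 0≤44) 0≤ℓ)) (e r ℓ)) (*-monoʳ 0≤ℓ 44u≤ℓ)
        where
        e : ∀ r ℓ → ℤ.+ 44 / 1 * (3ℚ * r + 1ℚ) * ℓ ≡ ℤ.+ 16 / 1 * r * (1ℚ + ℓ) + (ℤ.+ 16 / 1 * r * (ℓ - 1ℚ) + (ℤ.+ 100 / 1 * r + ℤ.+ 44 / 1) * ℓ)
        e = solve-∀ ℚ-ring
      λ′ : ℚ
      λ′ = inv L
      0≤λ : 0ℚ ≤ λ′
      0≤λ = <⇒≤ (0<inv L)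
      ℓλ : ℓ * λ′ ≡ 1ℚ
      ℓλ = ι*inv L
      36λ≤1 : ℤ.+ 36 / 1 * λ′ ≤ 1ℚ
      36λ≤1 = ≤-trans (*-monoʳ 0≤λ 36≤ℓ) (≤-reflexive ℓλ)
      λ≤1 : λ′ ≤ 1ℚ
      λ≤1 = ≤-trans (≤-by _ (*-nonneg (0≤ 35) 0≤λ) (e λ′)) 36λ≤1
        where
        e : ∀ x → ℤ.+ 36 / 1 * x ≡ x + ℤ.+ 35 / 1 * x
        e = solve-∀ ℚ-ring
      ℓ^-mono : ∀ {i j} → i ℕ.≤ j → ℓ ^ i ≤ ℓ ^ j
      ℓ^-mono {j = j} ℕ.z≤n = 1≤^ j 1≤ℓ
      ℓ^-mono (ℕ.s≤s i≤j)  = *-monoˡ 0≤ℓ (ℓ^-mono i≤j)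

    module _ {a : ℕ} {d : ℚ} (a≤A : ι a ≤ A) (1≤d : 1ℚ ≤ d) (d≤D : d ≤ D) (d<a : d < ι a)
             (invariant : d ^ n * D ≤ (h * (ι a - d)) ^ suc n) (dense : ι a ≤ ℤ.+ 16 / 1 * (r * d)) where
      private
        d≤a = <⇒≤ d<a
        0<d = <-≤-trans 0<1 1≤d
        0≤d = <⇒≤ 0<d
        0≤rd = *-nonneg 0≤r 0≤d
        d≤A = ≤-trans d≤a a≤A
        y = ι a - d
        0<y : 0ℚ < y
        0<y = p<q⇒0<q-p d<a
        0≤y = <⇒≤ 0<y
        instance
          a≢0 : ℕ.NonZero a
          a≢0 = ℕ.>-nonZero (ι-cancel-< {0} (≤-<-trans 0≤d d<a))
        α = inv a
        0≤α = <⇒≤ (0<inv a)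
        α*a : α * ι a ≡ 1ℚ
        α*a = trans (*-comm α (ι a)) (ι*inv a)
        αd≤1 : α * d ≤ 1ℚ
        αd≤1 = ≤-trans (*-monoˡ 0≤α d≤a) (≤-reflexive α*a)
        -- The tolerance `d / L²` is smaller by a factor of order `1 / L` than the surplus, which is
        -- at least `d / (L + 1)`, and still far above `K`.
        t = d * (λ′ * λ′)
        d≡tℓ² : d ≡ t * (ℓ * ℓ)
        d≡tℓ² = sym (trans (e d λ′ ℓ) (trans (cong (λ q → d * (q * q)) ℓλ) (*-identityʳ d)))
          where
          e : ∀ d λ′ ℓ → d * (λ′ * λ′) * (ℓ * ℓ) ≡ d * ((ℓ * λ′) * (ℓ * λ′))
          e = solve-∀ ℚ-ring
        0≤t : 0ℚ ≤ t
        0≤t = *-nonneg 0≤d (*-nonneg 0≤λ 0≤λ)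

        -- In the dense case the surplus is at most `16 r d`. Cancelling `d ^ n` in the invariant
        -- then shows that `d` has lost at most the factor `L ^ (2 (n + 1))` since the start.
        D≤ : D ≤ (ℓ * ℓ) ^ suc n * d
        D≤ = *-cancelˡ-≤ (^-pos n 0<d) (begin
          d ^ n * D                                       ≤⟨ invariant ⟩
          (h * y) ^ suc n                                 ≤⟨ ^-mono-≤ (suc n) (*-nonneg 0≤h 0≤y) (*-monoˡ 0≤h (≤-trans (≤-by d 0≤d (back (ι a) d)) dense)) ⟩
          (h * (ℤ.+ 16 / 1 * (r * d))) ^ suc n            ≡⟨ cong (_^ suc n) (regroup h r d) ⟩
          (ℤ.+ 16 / 1 * r * h * d) ^ suc n                ≤⟨ ^-mono-≤ (suc n) (*-nonneg (*-nonneg (*-nonneg (0≤ 16) 0≤r) 0≤h) 0≤d) (*-monoʳ 0≤d 16rh≤ℓ²) ⟩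
          (ℓ * ℓ * d) ^ suc n                             ≡⟨ ^-distrib-* (ℓ * ℓ) d (suc n) ⟩
          (ℓ * ℓ) ^ suc n * (d * d ^ n)                   ≡⟨ rotate ((ℓ * ℓ) ^ suc n) d (d ^ n) ⟩
          d ^ n * ((ℓ * ℓ) ^ suc n * d)                   ∎)
          where
          open ≤-Reasoning
          back : ∀ a d → a ≡ (a - d) + d
          back = solve-∀ ℚ-ring
          regroup : ∀ h r d → h * (ℤ.+ 16 / 1 * (r * d)) ≡ ℤ.+ 16 / 1 * r * h * d
          regroup = solve-∀ ℚ-ring
          rotate : ∀ x y z → x * (y * z) ≡ z * (x * y)
          rotate = solve-∀ ℚ-ring

        -- Of the 14 spare powers in `K-small`, two are spent between `d` and `t`. The other 12 are
        -- needed by `trim-large`: seven for its constants and `d / t`, five for `θ`.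
        Kℓ¹²≤t : K * ℓ ^ 12 ≤ t
        Kℓ¹²≤t = *-cancelʳ-≤ (*-pos 0<ℓ 0<ℓ) (≤-trans (≤-reflexive (e K (ℓ ^ 12) ℓ)) (≤-trans Kℓ¹⁴≤d (≤-reflexive d≡tℓ²)))
          where
          e : ∀ K p ℓ → K * p * (ℓ * ℓ) ≡ K * (ℓ * (ℓ * p))
          e = solve-∀ ℚ-ring
          Kℓ¹⁴≤d : K * ℓ ^ 14 ≤ d
          Kℓ¹⁴≤d = *-cancelʳ-≤ (^-pos (suc n) (*-pos 0<ℓ 0<ℓ)) (begin
            K * ℓ ^ 14 * (ℓ * ℓ) ^ suc n        ≡⟨ *-assoc K (ℓ ^ 14) _ ⟩
            K * (ℓ ^ 14 * (ℓ * ℓ) ^ suc n)      ≡⟨ cong (λ q → K * (ℓ ^ 14 * q)) (trans (cong (λ q → (ℓ * q) ^ suc n) (sym (*-identityʳ ℓ))) (^-assocʳ ℓ 2 (suc n))) ⟩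
            K * (ℓ ^ 14 * ℓ ^ (2 ℕ.* suc n))    ≡⟨ cong (K *_) (^-homo-* ℓ 14 (2 ℕ.* suc n)) ⟨
            K * ℓ ^ (14 ℕ.+ 2 ℕ.* suc n)        ≤⟨ K-small ⟩
            D                                   ≤⟨ D≤ ⟩
            (ℓ * ℓ) ^ suc n * d                 ≡⟨ *-comm ((ℓ * ℓ) ^ suc n) d ⟩
            d * (ℓ * ℓ) ^ suc n                 ∎)
            where open ≤-Reasoning
        K*≤t : ∀ i → i ℕ.≤ 12 → K * ℓ ^ i ≤ t
        K*≤t i i≤12 = ≤-trans (*-monoˡ 0≤K (ℓ^-mono i≤12)) Kℓ¹²≤t
        K≤t : K ≤ t
        K≤t = ≤-trans (≤-reflexive (sym (*-identityʳ K))) (K*≤t 0 ℕ.z≤n)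
        1≤t = ≤-trans 1≤K K≤t
        1≤ℓ² : 1ℚ ≤ ℓ * ℓ
        1≤ℓ² = 1≤* 1≤ℓ 1≤ℓ
        t≤d : t ≤ d
        t≤d = ≤-trans (≤-reflexive (sym (*-identityʳ t))) (≤-trans (*-monoˡ 0≤t 1≤ℓ²) (≤-reflexive (sym d≡tℓ²)))
        K≤d = ≤-trans K≤t t≤d
        θ-scale : ∀ {x} z → x * ℓ⁵ ≤ z → x ≤ θ * z
        θ-scale {x} z h = ≤-trans (≤-reflexive (sym (trans (e θ x ℓ⁵) (trans (cong (x *_) θℓ⁵) (*-identityʳ x))))) (*-monoˡ 0≤θ h)
          where
          e : ∀ θ x l → θ * (x * l) ≡ x * (θ * l)
          e = solve-∀ ℚ-ring
        Kℓ⁵≤t : K * ℓ⁵ ≤ t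
        Kℓ⁵≤t = ≤-trans (≤-reflexive (e K ℓ)) (K*≤t 5 (ℕ.s≤s (ℕ.s≤s (ℕ.s≤s (ℕ.s≤s (ℕ.s≤s ℕ.z≤n))))))
          where
          e : ∀ K ℓ → K * (ℓ * (ℓ * (ℓ * (ℓ * ℓ)))) ≡ K * (ℓ * (ℓ * (ℓ * (ℓ * (ℓ * 1ℚ)))))
          e = solve-∀ ℚ-ring
        K≤θt : K ≤ θ * t
        K≤θt = θ-scale {K} t Kℓ⁵≤t
        1≤θt = ≤-trans 1≤K K≤θt
        K≤θd : K ≤ θ * d
        K≤θd = ≤-trans K≤θt (*-monoˡ 0≤θ t≤d)

        spread-large : ℤ.+ 44 / 1 * κ² * (r * K) * (r * d) * ℓ ≤ t * t
        spread-large = begin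
          ℤ.+ 44 / 1 * κ² * (r * K) * (r * d) * ℓ                  ≡⟨ cong (λ q → ℤ.+ 44 / 1 * κ² * (r * K) * (r * q) * ℓ) d≡tℓ² ⟩
          ℤ.+ 44 / 1 * κ² * (r * K) * (r * (t * (ℓ * ℓ))) * ℓ      ≡⟨ e₁ κ² r K t ℓ ⟩
          ℤ.+ 44 / 1 * κ² * (r * r) * (K * t * (ℓ * (ℓ * ℓ)))      ≤⟨ *-monoʳ (*-nonneg (*-nonneg 0≤K 0≤t) (*-nonneg 0≤ℓ (*-nonneg 0≤ℓ 0≤ℓ))) 44κ²r²≤ℓ ⟩
          ℓ * (K * t * (ℓ * (ℓ * ℓ)))                              ≡⟨ e₂ K t ℓ ⟩
          K * ℓ ^ 4 * t                                            ≤⟨ *-monoʳ 0≤t (K*≤t 4 (ℕ.s≤s (ℕ.s≤s (ℕ.s≤s (ℕ.s≤s ℕ.z≤n))))) ⟩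
          t * t                                                    ∎
          where
          open ≤-Reasoning
          e₁ : ∀ κ r K t ℓ → ℤ.+ 44 / 1 * κ * (r * K) * (r * (t * (ℓ * ℓ))) * ℓ ≡ ℤ.+ 44 / 1 * κ * (r * r) * (K * t * (ℓ * (ℓ * ℓ)))
          e₁ = solve-∀ ℚ-ring
          e₂ : ∀ K t ℓ → ℓ * (K * t * (ℓ * (ℓ * ℓ))) ≡ K * (ℓ * (ℓ * (ℓ * (ℓ * 1ℚ)))) * t
          e₂ = solve-∀ ℚ-ring
        hits-large : ℤ.+ 44 / 1 * κ² * 1ℚ * 1ℚ * ℓ ≤ ℓ * ℓ
        hits-large = *-monoʳ 0≤ℓ (≤-trans (≤-reflexive (trans (*-identityʳ _) (*-identityʳ _))) 44κ²≤ℓ)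
        crowding-small : d * (θ * crowding r h) ≤ t
        crowding-small = begin
          d * (θ * crowding r h)                   ≤⟨ *-monoˡ 0≤d (*-monoˡ 0≤θ crowding≤ℓ³) ⟩
          d * (θ * (ℓ * (ℓ * ℓ)))                  ≡⟨ cong (_* (θ * (ℓ * (ℓ * ℓ)))) d≡tℓ² ⟩
          t * (ℓ * ℓ) * (θ * (ℓ * (ℓ * ℓ)))        ≡⟨ e t θ ℓ ⟩
          t * (θ * ℓ⁵)                             ≡⟨ trans (cong (t *_) θℓ⁵) (*-identityʳ t) ⟩
          t                                        ∎
          where
          open ≤-Reasoning
          e : ∀ t θ ℓ → t * (ℓ * ℓ) * (θ * (ℓ * (ℓ * ℓ))) ≡ t * (θ * (ℓ * (ℓ * (ℓ * (ℓ * ℓ)))))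
          e = solve-∀ ℚ-ring
        trim-large : ℤ.+ 44 / 1 * κ² * (K * M) * (θ * d * M) * ℓ ≤ θ * t * (θ * t)
        trim-large = begin
          ℤ.+ 44 / 1 * κ² * (K * M) * (θ * d * M) * ℓ                  ≡⟨ cong (λ q → ℤ.+ 44 / 1 * κ² * (K * M) * (θ * q * M) * ℓ) d≡tℓ² ⟩
          ℤ.+ 44 / 1 * κ² * (K * M) * (θ * (t * (ℓ * ℓ)) * M) * ℓ      ≡⟨ e₁ κ² K M θ t ℓ ⟩
          ℤ.+ 44 / 1 * κ² * (M * M) * (K * (θ * t) * (ℓ * (ℓ * ℓ)))    ≤⟨ *-monoʳ (*-nonneg (*-nonneg 0≤K (*-nonneg 0≤θ 0≤t)) (*-nonneg 0≤ℓ (*-nonneg 0≤ℓ 0≤ℓ))) 44κ²M²≤ℓ⁴ ⟩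
          ℓ * ℓ * (ℓ * ℓ) * (K * (θ * t) * (ℓ * (ℓ * ℓ)))              ≡⟨ e₂ K (θ * t) ℓ ⟩
          K * ℓ ^ 7 * (θ * t)                                          ≤⟨ *-monoʳ (*-nonneg 0≤θ 0≤t) (θ-scale {K * ℓ ^ 7} t (≤-trans (≤-reflexive (e₃ K ℓ)) Kℓ¹²≤t)) ⟩
          θ * t * (θ * t)                                              ∎
          where
          open ≤-Reasoning
          e₁ : ∀ κ K M θ t ℓ → ℤ.+ 44 / 1 * κ * (K * M) * (θ * (t * (ℓ * ℓ)) * M) * ℓ ≡ ℤ.+ 44 / 1 * κ * (M * M) * (K * (θ * t) * (ℓ * (ℓ * ℓ)))
          e₁ = solve-∀ ℚ-ring
          e₂ : ∀ K x ℓ → ℓ * ℓ * (ℓ * ℓ) * (K * x * (ℓ * (ℓ * ℓ))) ≡ K * (ℓ * (ℓ * (ℓ * (ℓ * (ℓ * (ℓ * (ℓ * 1ℚ))))))) * x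
          e₂ = solve-∀ ℚ-ring
          e₃ : ∀ K ℓ → K * (ℓ * (ℓ * (ℓ * (ℓ * (ℓ * (ℓ * (ℓ * 1ℚ))))))) * (ℓ * (ℓ * (ℓ * (ℓ * ℓ)))) ≡ K * (ℓ * (ℓ * (ℓ * (ℓ * (ℓ * (ℓ * (ℓ * (ℓ * (ℓ * (ℓ * (ℓ * (ℓ * 1ℚ))))))))))))
          e₃ = solve-∀ ℚ-ring
        rd≤ℓA : r * d ≤ ℓ * A
        rd≤ℓA = *-mono′ 0≤r 0≤d r≤ℓ d≤A
        0≤a = ι-nonneg a
        0≤ℓA = *-nonneg 0≤ℓ 0≤A
        spread-k : 4ℚ * (ι a * (r * d) * (ι a * (r * (r * d) + r * d + r))) ≤ ℓ ^ suc k
        spread-k = ≤-trans (*-mono′ (0≤ 4) (*-nonneg (*-nonneg 0≤a 0≤rd) (*-nonneg 0≤a 0≤sum)) 4≤ℓ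
            (*-mono′ (*-nonneg 0≤a 0≤rd) (*-nonneg 0≤a 0≤sum) (*-mono′ 0≤a 0≤rd a≤A rd≤ℓA) (*-mono′ 0≤a 0≤sum a≤A sum≤)))
          (≤-trans (≤-reflexive (e ℓ A)) (≤-trans (*-monoʳ (^-nonneg 4 0≤A) (ℓ^-mono {5} {17} (ℕ.m≤m+n 5 12))) k-large))
          where
          0≤sum : 0ℚ ≤ r * (r * d) + r * d + r
          0≤sum = +-nonneg (+-nonneg (*-nonneg 0≤r 0≤rd) 0≤rd) 0≤r
          sum≤ : r * (r * d) + r * d + r ≤ ℓ * (ℓ * (ℓ * A))
          sum≤ = ≤-trans (+-mono-≤ (+-mono-≤ (*-mono′ 0≤r 0≤rd r≤ℓ rd≤ℓA) rd≤ℓA) r≤ℓ)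
            (≤-by _ (*-nonneg 0≤ℓ (+-nonneg (*-nonneg 0≤ℓA (p≤q⇒0≤q-p (≤-trans (≤-by {3ℚ} {4ℚ} 1ℚ 0≤1 refl) 4≤ℓ))) (+-nonneg (*-nonneg (*-nonneg (0≤ 2) 0≤A) (p≤q⇒0≤q-p 1≤ℓ)) (p≤q⇒0≤q-p 1≤A)))) (e₀ ℓ A))
            where
            e₀ : ∀ ℓ A → ℓ * (ℓ * (ℓ * A)) ≡ ℓ * (ℓ * A) + ℓ * A + ℓ + ℓ * (ℓ * A * (ℓ - 3ℚ) + (2ℚ * A * (ℓ - 1ℚ) + (A - 1ℚ)))
            e₀ = solve-∀ ℚ-ring
          e : ∀ ℓ A → ℓ * (A * (ℓ * A) * (A * (ℓ * (ℓ * (ℓ * A))))) ≡ ℓ * (ℓ * (ℓ * (ℓ * (ℓ * 1ℚ)))) * (A * (A * (A * (A * 1ℚ))))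
          e = solve-∀ ℚ-ring

        -- The powers of `ℓ` are 1 for the factor 4, 5 for each of the two denominators `s`, 2 for
        -- `M` and 4 for `reach`, in total 17; each of the four factors also carries one `A`.
        trim-k : 4ℚ * (ι (a ℕ.* Θ) * (θ * d * M) * (ι (a ℕ.* Θ) * reach r h d (ι a))) ≤ ℓ ^ suc k
        trim-k = ≤-trans (*-mono′ (0≤ 4) (*-nonneg (*-nonneg 0≤s 0≤θdM) (*-nonneg 0≤s 0≤reach)) 4≤ℓ
            (*-mono′ (*-nonneg 0≤s 0≤θdM) (*-nonneg 0≤s 0≤reach) (*-mono′ 0≤s 0≤θdM s≤ θdM≤) (*-mono′ 0≤s 0≤reach s≤ reach≤)))
          (≤-trans (≤-reflexive (e ℓ A)) k-large)
          where
          0≤s = ι-nonneg (a ℕ.* Θ)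
          0≤ℓ² = *-nonneg 0≤ℓ 0≤ℓ
          s≤ : ι (a ℕ.* Θ) ≤ A * ℓ⁵
          s≤ = ≤-trans (≤-reflexive (trans (ι-* a Θ) (cong (ι a *_) ιΘ))) (*-monoʳ (≤-trans (ι-nonneg Θ) (≤-reflexive ιΘ)) a≤A)
          0≤θdM : 0ℚ ≤ θ * d * M
          0≤θdM = *-nonneg (*-nonneg 0≤θ 0≤d) 0≤M
          θdM≤ : θ * d * M ≤ A * (ℓ * ℓ)
          θdM≤ = *-mono′ (*-nonneg 0≤θ 0≤d) 0≤M (≤-trans (*-monoʳ 0≤d θ≤1) (≤-trans (≤-reflexive (*-identityˡ d)) d≤A)) M≤ℓ²
          0≤1+2rh : 0ℚ ≤ 1ℚ + 2ℚ * (r * h)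
          0≤1+2rh = +-nonneg 0≤1 (*-nonneg (0≤ 2) (*-nonneg 0≤r 0≤h))
          0≤inner : 0ℚ ≤ r * d + ι a * (1ℚ + 2ℚ * (r * h))
          0≤inner = +-nonneg 0≤rd (*-nonneg 0≤a 0≤1+2rh)
          0≤reach : 0ℚ ≤ reach r h d (ι a)
          0≤reach = +-nonneg (+-nonneg 0≤rd (*-nonneg 0≤r 0≤inner)) (+-nonneg 0≤1 0≤r)
          reach≤ : reach r h d (ι a) ≤ ℓ * (ℓ * (ℓ * (ℓ * A)))
          reach≤ = ≤-trans (+-mono-≤ (+-mono-≤ rd≤ℓA (*-mono′ 0≤r 0≤inner r≤ℓ (+-mono-≤ rd≤ℓA (*-mono′ 0≤a 0≤1+2rh a≤A 1+2rh≤ℓ²)))) 1+r≤ℓ)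
            (≤-by _ (+-nonneg (+-nonneg (*-nonneg (*-nonneg 0≤ℓA 0≤ℓ²) (p≤q⇒0≤q-p 4≤ℓ)) (*-nonneg (*-nonneg 0≤ℓA (+-nonneg 0≤ℓ (+-nonneg 0≤1 0≤1))) (p≤q⇒0≤q-p 1≤ℓ)))
                              (+-nonneg (*-nonneg (*-nonneg (0≤ 2) (*-nonneg 0≤ℓA 0≤ℓ)) (p≤q⇒0≤q-p 1≤ℓ)) (*-nonneg 0≤ℓ (p≤q⇒0≤q-p 1≤A)))) (e₀ ℓ A))
            where
            e₀ : ∀ ℓ A → ℓ * (ℓ * (ℓ * (ℓ * A))) ≡ ℓ * A + ℓ * (ℓ * A + A * (ℓ * ℓ)) + ℓ
                 + ((ℓ * A * (ℓ * ℓ) * (ℓ - 4ℚ) + ℓ * A * (ℓ + (1ℚ + 1ℚ)) * (ℓ - 1ℚ)) + (2ℚ * (ℓ * A * ℓ) * (ℓ - 1ℚ) + ℓ * (A - 1ℚ)))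
            e₀ = solve-∀ ℚ-ring
          e : ∀ ℓ A → ℓ * (A * (ℓ * (ℓ * (ℓ * (ℓ * ℓ)))) * (A * (ℓ * ℓ)) * (A * (ℓ * (ℓ * (ℓ * (ℓ * ℓ)))) * (ℓ * (ℓ * (ℓ * (ℓ * A))))))
              ≡ ℓ * (ℓ * (ℓ * (ℓ * (ℓ * (ℓ * (ℓ * (ℓ * (ℓ * (ℓ * (ℓ * (ℓ * (ℓ * (ℓ * (ℓ * (ℓ * (ℓ * 1ℚ)))))))))))))))) * (A * (A * (A * (A * 1ℚ))))
          e = solve-∀ ℚ-ring

        d′ X : ℚ
        d′ = d - θ * (d + α * (r * d - d) * d) + 4ℚ * (θ * t)
        X = ι a - θ * (r * d + 2ℚ * t)
        0≤X : 0ℚ ≤ X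
        0≤X = p≤q⇒0≤q-p (≤-trans (*-monoˡ 0≤θ (≤-by _ (*-nonneg (0≤ 2) (p≤q⇒0≤q-p t≤d)) (e₁ r d t))) (≤-trans (≤-reflexive (sym (*-assoc θ (r + 2ℚ) d)))
                (≤-trans (*-monoʳ 0≤d (θ*≤1 r+2≤ℓ)) (≤-trans (≤-reflexive (*-identityˡ d)) d≤a))))
          where
          e₁ : ∀ r d t → (r + 2ℚ) * d ≡ r * d + 2ℚ * t + 2ℚ * (d - t)
          e₁ = solve-∀ ℚ-ring
        a′ : ℕ
        a′ = proj₁ (floor X 0≤X)
        a′≤X : ι a′ ≤ X
        a′≤X = proj₁ (proj₂ (floor X 0≤X))
        X<a′+1 : X < 1ℚ + ι a′
        X<a′+1 = proj₂ (proj₂ (floor X 0≤X))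
        X<a : X < ι a
        X<a = <-by _ (*-pos 0<θ (<-≤-trans 0<d (≤-trans (≤-by _ (*-nonneg (p≤q⇒0≤q-p 1≤r) 0≤d) (e₁ r d)) (≤-by _ (*-nonneg (0≤ 2) 0≤t) refl)))) (e₂ (ι a) (θ * (r * d + 2ℚ * t)))
          where
          e₁ : ∀ r d → r * d ≡ d + (r - 1ℚ) * d
          e₁ = solve-∀ ℚ-ring
          e₂ : ∀ a x → a ≡ (a - x) + x
          e₂ = solve-∀ ℚ-ring
        a′<a : a′ ℕ.< a
        a′<a = ι-cancel-< (≤-<-trans a′≤X X<a)

        -- Up to errors the new surplus is `y - θ (r - 1) d (1 - α d)`, and `1 - α d = α y`. It is
        -- therefore `y` times `1 - θ (r - 1) α d`; the term with 14 covers the errors.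
        σ β y′ : ℚ
        σ = θ * ((r - 1ℚ) * (α * d) + ℤ.+ 14 / 1 * λ′)
        β = 1ℚ - σ
        y′ = ι a′ - d′
        0≤r-1 = p≤q⇒0≤q-p 1≤r
        0≤αd = *-nonneg 0≤α 0≤d
        0≤σ : 0ℚ ≤ σ
        0≤σ = *-nonneg 0≤θ (+-nonneg (*-nonneg 0≤r-1 0≤αd) (*-nonneg (0≤ 14) 0≤λ))
        β≤1 : β ≤ 1ℚ
        β≤1 = ≤-by σ 0≤σ (e σ)
          where
          e : ∀ σ → 1ℚ ≡ (1ℚ - σ) + σ
          e = solve-∀ ℚ-ring
        β≥ : 1ℚ - r * θ ≤ β
        β≥ = ≤-by _ (*-nonneg 0≤θ (+-nonneg (*-nonneg 0≤r-1 (p≤q⇒0≤q-p αd≤1)) (p≤q⇒0≤q-p 14λ≤1))) (e r θ (α * d) λ′)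
          where
          14λ≤1 : ℤ.+ 14 / 1 * λ′ ≤ 1ℚ
          14λ≤1 = ≤-trans (*-monoʳ 0≤λ (≤-by {ℤ.+ 14 / 1} {ℤ.+ 36 / 1} (ℤ.+ 22 / 1) (0≤ 22) refl)) 36λ≤1
          e : ∀ r θ x λ′ → 1ℚ - θ * ((r - 1ℚ) * x + ℤ.+ 14 / 1 * λ′) ≡ 1ℚ - r * θ + θ * ((r - 1ℚ) * (1ℚ - x) + (1ℚ - ℤ.+ 14 / 1 * λ′))
          e = solve-∀ ℚ-ring
        2rθ≤1 : θ * (2ℚ * r) ≤ 1ℚ
        2rθ≤1 = θ*≤1 2r≤ℓ
        0<β : 0ℚ < β
        0<β = <-≤-trans (<-≤-trans (positive⁻¹ ½) (≤-by _ (*-nonneg (nonNegative⁻¹ ½) (p≤q⇒0≤q-p 2rθ≤1)) (e r θ))) β≥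
          where
          e : ∀ r θ → 1ℚ - r * θ ≡ ½ + ½ * (1ℚ - θ * (2ℚ * r))
          e = solve-∀ ℚ-ring
        0≤β = <⇒≤ 0<β

        -- The degree shrinks by a relative `θ` more than the surplus. Half of this advantage is
        -- given up for the errors, for which `36 λ ≤ 1` is sufficient.
        d′≤ : d′ ≤ d * (β * (1ℚ - ½ * θ))
        d′≤ = ≤-by _ (+-nonneg (*-nonneg (*-nonneg 0≤d 0≤θ) (+-nonneg (p≤q⇒0≤q-p 18λ≤½) (*-nonneg (*-nonneg (0≤ 4) 0≤λ) (p≤q⇒0≤q-p λ≤1)))) (*-nonneg 0≤d (*-nonneg (nonNegative⁻¹ ½) (*-nonneg 0≤σ 0≤θ)))) (e d θ α r λ′)
          where
          18λ≤½ : ℤ.+ 18 / 1 * λ′ ≤ ½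
          18λ≤½ = *-cancelˡ-≤ (positive⁻¹ 2ℚ) (≤-trans (≤-reflexive (e₀ λ′)) 36λ≤1)
            where
            e₀ : ∀ x → 2ℚ * (ℤ.+ 18 / 1 * x) ≡ ℤ.+ 36 / 1 * x
            e₀ = solve-∀ ℚ-ring
          e : ∀ d θ α r λ′ → d * ((1ℚ - θ * ((r - 1ℚ) * (α * d) + ℤ.+ 14 / 1 * λ′)) * (1ℚ - ½ * θ))
              ≡ d - θ * (d + α * (r * d - d) * d) + 4ℚ * (θ * (d * (λ′ * λ′)))
                + (d * θ * ((½ - ℤ.+ 18 / 1 * λ′) + 4ℚ * λ′ * (1ℚ - λ′)) + d * (½ * (θ * ((r - 1ℚ) * (α * d) + ℤ.+ 14 / 1 * λ′) * θ)))
          e = solve-∀ ℚ-ring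
        d′≤d : d′ ≤ d
        d′≤d = ≤-trans d′≤ (≤-trans (*-monoˡ 0≤d (*-mono′ 0≤β 0≤1-½θ β≤1 1-½θ≤1)) (≤-reflexive (*-identityʳ d)))
          where
          0≤½θ = *-nonneg (nonNegative⁻¹ ½) 0≤θ
          1-½θ≤1 : 1ℚ - ½ * θ ≤ 1ℚ
          1-½θ≤1 = ≤-by (½ * θ) 0≤½θ (e (½ * θ))
            where
            e : ∀ x → 1ℚ ≡ (1ℚ - x) + x
            e = solve-∀ ℚ-ring
          0≤1-½θ : 0ℚ ≤ 1ℚ - ½ * θ
          0≤1-½θ = subst (0ℚ ≤_) (e θ) (+-nonneg (nonNegative⁻¹ ½) (*-nonneg (nonNegative⁻¹ ½) (p≤q⇒0≤q-p θ≤1)))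
            where
            e : ∀ θ → ½ + ½ * (1ℚ - θ) ≡ 1ℚ - ½ * θ
            e = solve-∀ ℚ-ring
        1≤d′ : 1ℚ ≤ d′
        1≤d′ = ≤-trans 1≤½d (≤-by _ (+-nonneg (+-nonneg (*-nonneg (*-nonneg (nonNegative⁻¹ ½) 0≤d) (p≤q⇒0≤q-p 2rθ≤1)) (*-nonneg (*-nonneg 0≤θ (*-nonneg 0≤r-1 0≤d)) (p≤q⇒0≤q-p αd≤1))) (*-nonneg (0≤ 4) (*-nonneg 0≤θ 0≤t))) (e d θ α r t))
          where
          1≤½d : 1ℚ ≤ ½ * d
          1≤½d = *-cancelˡ-≤ (positive⁻¹ 2ℚ) (≤-trans (≤-trans (≤-by {2ℚ} {4ℚ} 2ℚ (0≤ 2) refl) 4≤ℓ) (≤-trans (≤-trans (≤-reflexive (sym (*-identityʳ ℓ))) (*-monoˡ 0≤ℓ 1≤ℓ))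
            (≤-trans (≤-reflexive (sym (*-identityˡ (ℓ * ℓ)))) (≤-trans (*-monoʳ (*-nonneg 0≤ℓ 0≤ℓ) 1≤t) (≤-reflexive (trans (sym d≡tℓ²) (e₀ d)))))))
            where
            e₀ : ∀ d → d ≡ 2ℚ * (½ * d)
            e₀ = solve-∀ ℚ-ring
          e : ∀ d θ α r t → d - θ * (d + α * (r * d - d) * d) + 4ℚ * (θ * t)
              ≡ ½ * d + (½ * d * (1ℚ - θ * (2ℚ * r)) + θ * ((r - 1ℚ) * d) * (1ℚ - α * d) + 4ℚ * (θ * t))
          e = solve-∀ ℚ-ring

        -- Since `d ≤ D`, the invariant bounds `d ^ suc n`, and a root can be taken.
        d≤hy : d ≤ h * y
        d≤hy = ^-cancel-≤ n (*-nonneg 0≤h 0≤y) (≤-trans (≤-reflexive (*-comm d (d ^ n))) (≤-trans (*-monoˡ (^-nonneg n 0≤d) d≤D) invariant))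
        -- The second-order losses are absorbed by the surplus: t = d / L² ≤ 2 y / L.
        t≤2λy : t ≤ 2ℚ * λ′ * y
        t≤2λy = begin
          d * (λ′ * λ′)                 ≤⟨ *-monoʳ (*-nonneg 0≤λ 0≤λ) (≤-trans d≤hy (*-monoʳ 0≤y (+-monoˡ-≤ ℓ 1≤ℓ))) ⟩
          (ℓ + ℓ) * y * (λ′ * λ′)       ≡⟨ e ℓ y λ′ ⟩
          2ℚ * (ℓ * λ′) * λ′ * y        ≡⟨ cong (λ q → 2ℚ * q * λ′ * y) ℓλ ⟩
          2ℚ * 1ℚ * λ′ * y              ∎
          where
          open ≤-Reasoning
          e : ∀ ℓ y λ′ → (ℓ + ℓ) * y * (λ′ * λ′) ≡ 2ℚ * (ℓ * λ′) * λ′ * y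
          e = solve-∀ ℚ-ring
        -- Seven units `θ t` are lost: two in `X`, four in `d′`, and one for rounding `X` down to an
        -- integer. As `t ≤ 2 λ y`, they amount to `14 θ λ y`. The last term of the identity
        -- vanishes because `α a = 1`.
        y′≥ : y * β ≤ y′
        y′≥ = ≤-by _ (+-nonneg (+-nonneg (<⇒≤ (p<q⇒0<q-p X<a′+1)) (p≤q⇒0≤q-p 1≤θt)) (*-nonneg (*-nonneg (0≤ 7) 0≤θ) (p≤q⇒0≤q-p t≤2λy)))
                (trans (e₁ (ι a′) d θ α r t (ι a) λ′) (trans (cong (λ q → gain + θ * (r - 1ℚ) * d * q) (cong (_- 1ℚ) α*a)) (e₂ gain (θ * (r - 1ℚ) * d))))
          where
          gain = (ι a - d) * β + ((1ℚ + ι a′ - X) + (θ * t - 1ℚ) + 7ℚ * θ * (2ℚ * λ′ * (ι a - d) - t))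
          e₂ : ∀ x c → x + c * 0ℚ ≡ x
          e₂ = solve-∀ ℚ-ring
          e₁ : ∀ a′ d θ α r t a λ′ → a′ - (d - θ * (d + α * (r * d - d) * d) + 4ℚ * (θ * t))
               ≡ (a - d) * (1ℚ - θ * ((r - 1ℚ) * (α * d) + ℤ.+ 14 / 1 * λ′))
                 + ((1ℚ + a′ - (a - θ * (r * d + 2ℚ * t))) + (θ * t - 1ℚ) + 7ℚ * θ * (2ℚ * λ′ * (a - d) - t))
                 + θ * (r - 1ℚ) * d * (α * a - 1ℚ)
          e₁ = solve-∀ ℚ-ring
        0<y′ : 0ℚ < y′
        0<y′ = <-≤-trans (*-pos 0<y 0<β) y′≥
        invariant′ : d′ ^ n * D ≤ (h * y′) ^ suc n
        invariant′ = potential-step n θ β r d d′ y y′ D h 0≤θ θ≤1 n≡ 0≤r (≤-trans (≤-reflexive (*-comm (r * ι n) θ)) (θ*≤1 rn≤ℓ)) β≥ β≤1 0≤β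
          (≤-trans 0≤1 1≤d′) 0≤d d′≤ y′≥ 0≤y (≤-trans 0≤d d≤D) 0≤h invariant

      step : ∀ {C V} (edge : Family C a V) → Bounded edge r d K →
             (∀ a″ d″ → a″ ℕ.< a → ι a″ ≤ A → 1ℚ ≤ d″ → d″ ≤ D → d″ < ι a″ → d″ ^ n * D ≤ (h * (ι a″ - d″)) ^ suc n →
               (edge″ : Family C a″ V) → Bounded edge″ r d″ K → Transversal edge″) → Transversal edge
      step {C} edge bounded rest = with-picks (spread-picks bounded 1≤r 1≤d 1≤K K≤d d≤a k 0<ℓ (<-≤-trans 0<1 1≤t) spread-large hits-large spread-k)
        where
        open Picks edge
        with-picks : Σ (Fin C → Fin a) (Spread d t h) → Transversal edge
        with-picks (pk , spread) = trimmed⇒transversal edge Θ pk bounded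
          (Trimming.trim edge Θ pk bounded spread 1≤r 1≤d 1≤K d≤a (≤-by ℓ 0≤ℓ refl) 1≤t t≤d (≤-trans r≤ℓ ℓ≤Θ) k 0<ℓ crowding-small K≤θd trim-large trim-k)
          a′ a′≤X (rest a′ d′ a′<a (≤-trans (≤-trans a′≤X (<⇒≤ X<a)) a≤A) 1≤d′ (≤-trans d′≤d d≤D) d′<a′ invariant′)
          where
          d′<a′ : d′ < ι a′
          d′<a′ = <-by y′ 0<y′ (p+[q-p]≡q d′ (ι a′))

    -- The fuel only exploits that `a` strictly decreases. `A`, `D` and `K` keep their initial
    -- values throughout, so one choice of `L` and `k` serves all steps.
    nibble : ∀ fuel a d → a ℕ.≤ fuel → ι a ≤ A → 1ℚ ≤ d → d ≤ D → d < ι a → d ^ n * D ≤ (h * (ι a - d)) ^ suc n →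
             ∀ {C V} (edge : Family C a V) → Bounded edge r d K → Transversal edge
    nibble zero a d a≤0 a≤A 1≤d d≤D d<a inv _ _ = ⊥-elim (ℕ.n≮0 (ℕ.<-≤-trans (ι-cancel-< {0} (<-trans (<-≤-trans 0<1 1≤d) d<a)) a≤0))
    nibble (suc fuel) a d a≤fuel a≤A 1≤d d≤D d<a inv {C} {V} edge bounded = by-density (ℤ.+ 16 / 1 * (r * d) ≤? ι a)
      where
      0≤d = ≤-trans 0≤1 1≤d
      by-density : Dec (ℤ.+ 16 / 1 * (r * d) ≤ ι a) → Transversal edge
      by-density (yes sparse) = sparse⇒transversal {{ℕ.>-nonZero (ι-cancel-< {0} (≤-<-trans 0≤d d<a))}} edge bounded 0≤d 0≤K (1≤* 1≤r 1≤d) sparse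
      by-density (no dense)   = step a≤A 1≤d d≤D d<a inv (<⇒≤ (≰⇒> dense)) edge bounded
        (λ a″ d″ a″<a a″≤A 1≤d″ d″≤D d″<a″ inv″ → nibble fuel a″ d″ (ℕ.≤-pred (ℕ.<-≤-trans a″<a a≤fuel)) a″≤A 1≤d″ d″≤D d″<a″ inv″)

  -- From edge colourings to families, and the product construction

  module Classes {m C} (colour : Fin m → Fin C) where

    at : (Fin m → Bool) → Maybe (Fin m) → Bool
    at g (just e) = g e
    at g nothing  = false

    -- A colour with at least `a` edges is cut down to exactly `a` of them. Any other index, such as
    -- a number below the bound on the colours that colours no edge, gets empty slots and so becomes
    -- a colour with empty edges.
    record Enumeration (a : ℕ) : Set where
      field
        slot        : Fin C → Fin a → Maybe (Fin m)
        slot-colour : ∀ c i e → slot c i ≡ just e → colour e ≡ c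
        slot-full   : ∀ c i → ι a ≤ ∑ (λ e → ⟦ colour e == c ⟧) → ∃ λ e → slot c i ≡ just e
        slot-∑      : ∀ c g → ∑ (λ i → ⟦ at g (slot c i) ⟧) ≤ ∑ (λ e → ⟦ colour e == c ⟧ * ⟦ g e ⟧)

    enumerate : ∀ a → Enumeration a
    enumerate a = record
      { slot        = λ c → slot c (size? c)
      ; slot-colour = λ c → slot-colour c (size? c)
      ; slot-full   = λ c → slot-full c (size? c)
      ; slot-∑      = λ c → slot-∑ c (size? c)
      }
      where
      Large : Fin C → Set
      Large c = ι a ≤ ∑ (λ e → ⟦ colour e == c ⟧)
      size? : ∀ c → Dec (Large c)
      size? c = ι a ≤? ∑ (λ e → ⟦ colour e == c ⟧)
      sub : ∀ c → Large c → Fin a → Fin m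
      sub c h = proj₁ (selection (λ e → colour e == c) a h)
      slot : ∀ c → Dec (Large c) → Fin a → Maybe (Fin m)
      slot c (yes h) i = just (sub c h i)
      slot c (no _)  i = nothing
      slot-colour : ∀ c d i e → slot c d i ≡ just e → colour e ≡ c
      slot-colour c (yes h) i .(sub c h i) refl = ==⇒≡ (colour (sub c h i)) c (proj₁ (proj₂ (selection (λ e → colour e == c) a h)) i)
      slot-full : ∀ c d i → Large c → ∃ λ e → slot c d i ≡ just e
      slot-full c (yes h) i _ = sub c h i , refl
      slot-full c (no ¬h) i h = ⊥-elim (¬h h)
      slot-∑ : ∀ c d g → ∑ (λ i → ⟦ at g (slot c d i) ⟧) ≤ ∑ (λ e → ⟦ colour e == c ⟧ * ⟦ g e ⟧)
      slot-∑ c (yes h) g = proj₂ (proj₂ (selection (λ e → colour e == c) a h)) (λ e → ⟦ g e ⟧) (λ e → ⟦⟧-nonneg (g e))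
      slot-∑ c (no _)  g = ≤-trans (≤-reflexive (∑-zero {a} (λ _ → refl))) (∑-nonneg (λ e → *-nonneg (⟦⟧-nonneg (colour e == c)) (⟦⟧-nonneg (g e))))

    module _ {a} (enum : Enumeration a) where
      open Enumeration enum

      ∑-slots : ∀ g → ∑₂ (λ c i → ⟦ at g (slot c i) ⟧) ≤ ∑ (λ e → ⟦ g e ⟧)
      ∑-slots g = ≤-trans (∑-mono (λ c → slot-∑ c g)) (≤-reflexive (trans (∑-comm (λ c e → ⟦ colour e == c ⟧ * ⟦ g e ⟧)) (∑-cong (λ e → ∑-select′ (colour e) (λ _ → ⟦ g e ⟧)))))

      ∑-slots-colour : ∀ c g → ∑ (λ i → ⟦ at g (slot c i) ⟧) ≤ ∑ (λ e → ⟦ g e ⟧)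
      ∑-slots-colour c g = ≤-trans (slot-∑ c g) (∑-mono (λ e → ≤-trans (*-monoʳ (⟦⟧-nonneg (g e)) (⟦⟧≤1 (colour e == c))) (≤-reflexive (*-identityˡ ⟦ g e ⟧))))

  -- D edge-disjoint full rainbow matchings are one full rainbow matching of the D-fold product: the k-th copy of the edge e
  -- lives on the k-th copies of its vertices, has the k-th copy of its colour, and all copies of e share the extra vertex e.
  module Product {n m C} (D : ℕ) (inc : Fin m → Fin n → Bool) (colour : Fin m → Fin C) {a : ℕ} (enum : Classes.Enumeration colour a) where
    open Classes colour
    open Enumeration enum

    V : Set
    V = (Fin n × Fin D) ⊎ Fin m

    unfold : Fin (n ℕ.* D) ⊎ Fin m → V
    unfold (inj₁ w) = inj₁ (remQuot D w)
    unfold (inj₂ e) = inj₂ e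

    toV : Fin (n ℕ.* D ℕ.+ m) → V
    toV z = unfold (splitAt (n ℕ.* D) z)

    fromV : V → Fin (n ℕ.* D ℕ.+ m)
    fromV (inj₁ (v , k)) = combine v k ↑ˡ m
    fromV (inj₂ e)       = (n ℕ.* D) ↑ʳ e

    toV-fromV : ∀ z → toV (fromV z) ≡ z
    toV-fromV (inj₁ (v , k)) rewrite splitAt-↑ˡ (n ℕ.* D) (combine v k) m = cong inj₁ (remQuot-combine v k)
    toV-fromV (inj₂ e) rewrite splitAt-↑ʳ (n ℕ.* D) m e = refl

    fromV-toV : ∀ z → fromV (toV z) ≡ z
    fromV-toV z = trans (go (splitAt (n ℕ.* D) z)) (join-splitAt (n ℕ.* D) m z)
      where
      go : ∀ w → fromV (unfold w) ≡ join (n ℕ.* D) m w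
      go (inj₁ w) = cong (_↑ˡ m) (combine-remQuot {n} D w)
      go (inj₂ e) = refl

    copy : Fin C → Fin D → Fin a → V → Bool
    copy c k i (inj₁ (v , k′)) = (k′ == k) ∧ at (λ e → inc e v) (slot c i)
    copy c k i (inj₂ e)        = at (λ e′ → e′ == e) (slot c i)

    family : Family (C ℕ.* D) a (n ℕ.* D ℕ.+ m)
    family x i z = copy (proj₁ (remQuot {C} D x)) (proj₂ (remQuot {C} D x)) i (toV z)

    family-copy : ∀ c k i z → family (combine c k) i (fromV z) ≡ copy c k i z
    family-copy c k i z = cong₂ (λ p → copy (proj₁ p) (proj₂ p) i) (remQuot-combine c k) (toV-fromV z)

    ∑-family : ∀ (f : Fin C → Fin D → ℚ) → ∑ (λ x → f (proj₁ (remQuot {C} D x)) (proj₂ (remQuot {C} D x))) ≡ ∑₂ f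
    ∑-family f = trans (∑-combine C (λ x → f (proj₁ (remQuot {C} D x)) (proj₂ (remQuot {C} D x)))) (∑₂-cong (λ c k → cong (λ p → f (proj₁ p) (proj₂ p)) (remQuot-combine c k)))

    ∑-V : ∀ (f : V → ℚ) → ∑ (λ z → f (toV z)) ≡ ∑₂ (λ v k → f (inj₁ (v , k))) + ∑ (λ e → f (inj₂ e))
    ∑-V f = trans (∑-++ (n ℕ.* D) (λ z → f (toV z))) (cong₂ _+_
      (trans (∑-combine n (λ w → f (toV (w ↑ˡ m)))) (∑₂-cong (λ v k → cong f (toV-fromV (inj₁ (v , k))))))
      (∑-cong (λ e → cong f (toV-fromV (inj₂ e)))))

    module _ {r K : ℚ} (0≤r : 0ℚ ≤ r) (1≤K : 1ℚ ≤ K)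
             (size : ∀ e → ∑ (λ v → ⟦ inc e v ⟧) ≤ r) (deg : ∀ v → ∑ (λ e → ⟦ inc e v ⟧) ≤ ι D)
             (codeg : ∀ u v → u ≢ v → ∑ (λ e → ⟦ inc e u ⟧ * ⟦ inc e v ⟧) ≤ K)
             (coldeg : ∀ v c → ∑ (λ e → ⟦ colour e == c ⟧ * ⟦ inc e v ⟧) ≤ K) where

      private
        0≤K = ≤-trans 0≤1 1≤K
        ∑-one : ∀ {k} (j : Fin k) → ∑ (λ i → ⟦ i == j ⟧) ≡ 1ℚ
        ∑-one j = trans (∑-cong (λ i → sym (*-identityʳ ⟦ i == j ⟧))) (∑-select j (λ _ → 1ℚ))
        through : Fin n → Fin C → Fin a → ℚ
        through v c i = ⟦ at (λ e → inc e v) (slot c i) ⟧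
        named : Fin m → Fin C → Fin a → ℚ
        named e c i = ⟦ at (λ e′ → e′ == e) (slot c i) ⟧
        named≤1 : ∀ e → ∑₂ (named e) ≤ 1ℚ
        named≤1 e = ≤-trans (∑-slots enum (λ e′ → e′ == e)) (≤-reflexive (∑-one e))
        through≥0 : ∀ v c i → 0ℚ ≤ through v c i
        through≥0 v c i = ⟦⟧-nonneg (at (λ e → inc e v) (slot c i))
        named≥0 : ∀ e c i → 0ℚ ≤ named e c i
        named≥0 e c i = ⟦⟧-nonneg (at (λ e′ → e′ == e) (slot c i))
        copy-vertex : ∀ c k i v k′ → ⟦ copy c k i (inj₁ (v , k′)) ⟧ ≡ ⟦ k′ == k ⟧ * through v c i
        copy-vertex c k i v k′ = ⟦∧⟧ (k′ == k) (at (λ e → inc e v) (slot c i))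
        copy≤through : ∀ c k i v k′ → ⟦ copy c k i (inj₁ (v , k′)) ⟧ ≤ through v c i
        copy≤through c k i v k′ = ≤-trans (≤-reflexive (copy-vertex c k i v k′)) (≤-trans (*-monoʳ (through≥0 v c i) (⟦⟧≤1 (k′ == k))) (≤-reflexive (*-identityˡ (through v c i))))
        select-copy : ∀ k′ (f : Fin C → Fin a → ℚ) → ∑₂ {C} {D} (λ c k → ∑ {a} (λ i → ⟦ k′ == k ⟧ * f c i)) ≡ ∑₂ f
        select-copy k′ f = ∑-cong (λ c → trans (∑-cong (λ k → sym (*-∑ ⟦ k′ == k ⟧ (f c)))) (∑-select′ k′ (λ _ → ∑ (f c))))

        size′ : ∀ c k i → ∑₂ (λ v k′ → ⟦ copy c k i (inj₁ (v , k′)) ⟧) + ∑ (λ e → ⟦ copy c k i (inj₂ e) ⟧) ≤ 1ℚ + r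
        size′ c k i = ≤-trans (+-monoˡ-≤ (∑ (λ e → named e c i)) (≤-reflexive (∑-cong (λ v → trans (∑-cong (λ k′ → copy-vertex c k i v k′)) (∑-select k (λ _ → through v c i))))))
          (≤-trans (by-slot (slot c i)) (≤-reflexive (+-comm r 1ℚ)))
          where
          by-slot : ∀ s → ∑ (λ v → ⟦ at (λ e → inc e v) s ⟧) + ∑ (λ e → ⟦ at (λ e′ → e′ == e) s ⟧) ≤ r + 1ℚ
          by-slot (just e) = +-mono-≤ (size e) (≤-reflexive (trans (∑-cong (λ e′ → cong ⟦_⟧ (==-comm e e′))) (∑-one e)))
          by-slot nothing  = ≤-trans (≤-reflexive (cong₂ _+_ (∑-zero {n} (λ _ → refl)) (∑-zero {m} (λ _ → refl)))) (+-nonneg 0≤r 0≤1)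

        -- The extra vertex of an edge lies on its `D` copies and on nothing else. Its degree is
        -- thus within the old bound, which is why as many as `D` disjoint matchings come at no
        -- cost.
        deg′ : ∀ z → ∑₂ (λ c k → ∑ (λ i → ⟦ copy c k i z ⟧)) ≤ ι D
        deg′ (inj₁ (v , k′)) = ≤-trans (≤-reflexive (trans (∑₂-cong (λ c k → ∑-cong (λ i → copy-vertex c k i v k′))) (select-copy k′ (through v))))
          (≤-trans (∑-slots enum (λ e → inc e v)) (deg v))
        deg′ (inj₂ e) = ≤-trans (≤-reflexive (trans (∑-cong (λ c → ∑-const D (∑ (named e c)))) (sym (*-∑ (ι D) (λ c → ∑ (named e c))))))
          (≤-trans (*-monoˡ (ι-nonneg D) (named≤1 e)) (≤-reflexive (*-identityʳ (ι D))))

        -- An edge fills at most one slot, and the copy index is fixed by `k′`; so at most one edge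
        -- of the product contains both vertices.
        vertex-name : ∀ v k′ e → ∑₂ (λ c k → ∑ (λ i → ⟦ copy c k i (inj₁ (v , k′)) ⟧ * ⟦ copy c k i (inj₂ e) ⟧)) ≤ K
        vertex-name v k′ e = ≤-trans (∑₂-mono (λ c k → ∑-mono (λ i → ≤-trans (*-monoʳ (named≥0 e c i) (≤-reflexive (copy-vertex c k i v k′)))
            (≤-trans (≤-reflexive (*-assoc ⟦ k′ == k ⟧ (through v c i) (named e c i))) (*-monoˡ (⟦⟧-nonneg (k′ == k)) (≤-trans (*-monoʳ (named≥0 e c i) (⟦⟧≤1 (at (λ e → inc e v) (slot c i)))) (≤-reflexive (*-identityˡ (named e c i)))))))))
          (≤-trans (≤-reflexive (select-copy k′ (named e))) (≤-trans (named≤1 e) 1≤K))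

        codeg′ : ∀ z z′ → z ≢ z′ → ∑₂ (λ c k → ∑ (λ i → ⟦ copy c k i z ⟧ * ⟦ copy c k i z′ ⟧)) ≤ K
        codeg′ (inj₁ (u , k₁)) (inj₂ e) _ = vertex-name u k₁ e
        codeg′ (inj₂ e) (inj₁ (u , k₁)) _ = ≤-trans (≤-reflexive (∑₂-cong {C} {D} (λ c k → ∑-cong {a} (λ i → *-comm ⟦ copy c k i (inj₂ e) ⟧ ⟦ copy c k i (inj₁ (u , k₁)) ⟧)))) (vertex-name u k₁ e)
        codeg′ (inj₂ e) (inj₂ e′) e≢e′ = ≤-trans (≤-reflexive (∑-zero {C} (λ c → ∑-zero {D} (λ k → ∑-zero {a} (λ i → by-slot (slot c i)))))) 0≤K
          where
          by-slot : ∀ s → ⟦ at (λ e″ → e″ == e) s ⟧ * ⟦ at (λ e″ → e″ == e′) s ⟧ ≡ 0ℚ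
          by-slot nothing   = refl
          by-slot (just e″) = cases (e″ == e) (e″ == e′) refl refl
            where
            cases : ∀ b b′ → (e″ == e) ≡ b → (e″ == e′) ≡ b′ → ⟦ b ⟧ * ⟦ b′ ⟧ ≡ 0ℚ
            cases false b′    _ _ = *-zeroˡ ⟦ b′ ⟧
            cases true  false _ _ = refl
            cases true  true  p q = ⊥-elim (e≢e′ (cong inj₂ (trans (sym (==⇒≡ e″ e p)) (==⇒≡ e″ e′ q))))
        codeg′ (inj₁ (u , k₁)) (inj₁ (v , k₂)) uk≢vk = cases (k₁ == k₂) refl
          where
          product : ∀ c k i → ⟦ copy c k i (inj₁ (u , k₁)) ⟧ * ⟦ copy c k i (inj₁ (v , k₂)) ⟧ ≡ ⟦ k₁ == k ⟧ * (⟦ k₂ == k ⟧ * (through u c i * through v c i))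
          product c k i = trans (cong₂ _*_ (copy-vertex c k i u k₁) (copy-vertex c k i v k₂)) (regroup ⟦ k₁ == k ⟧ (through u c i) ⟦ k₂ == k ⟧ (through v c i))
            where
            regroup : ∀ x y z w → x * y * (z * w) ≡ x * (z * (y * w))
            regroup = solve-∀ ℚ-ring
          both : ∀ c i → through u c i * through v c i ≤ ⟦ at (λ e → inc e u ∧ inc e v) (slot c i) ⟧
          both c i = by-slot (slot c i)
            where
            by-slot : ∀ s → ⟦ at (λ e → inc e u) s ⟧ * ⟦ at (λ e → inc e v) s ⟧ ≤ ⟦ at (λ e → inc e u ∧ inc e v) s ⟧
            by-slot (just e) = ≤-reflexive (sym (⟦∧⟧ (inc e u) (inc e v)))
            by-slot nothing  = ≤-refl
          cases : ∀ b → (k₁ == k₂) ≡ b → ∑₂ (λ c k → ∑ (λ i → ⟦ copy c k i (inj₁ (u , k₁)) ⟧ * ⟦ copy c k i (inj₁ (v , k₂)) ⟧)) ≤ K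
          cases false k₁≢k₂ = ≤-trans (≤-reflexive (∑-zero (λ c → ∑-zero (λ k → ∑-zero (λ i → trans (product c k i) (vanish c i k (k₁ == k) refl)))))) 0≤K
            where
            vanish : ∀ c i k b → (k₁ == k) ≡ b → ⟦ b ⟧ * (⟦ k₂ == k ⟧ * (through u c i * through v c i)) ≡ 0ℚ
            vanish c i k false _ = *-zeroˡ (⟦ k₂ == k ⟧ * (through u c i * through v c i))
            vanish c i k true  p = trans (*-identityˡ _) (trans (cong (λ b → ⟦ b ⟧ * (through u c i * through v c i)) k₂≢k) (*-zeroˡ (through u c i * through v c i)))
              where
              k₂≢k : (k₂ == k) ≡ false
              k₂≢k = trans (cong (k₂ ==_) (sym (==⇒≡ k₁ k p))) (trans (==-comm k₂ k₁) k₁≢k₂)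
          cases true k₁≡k₂ = ≤-trans (∑₂-mono (λ c k → ∑-mono (λ i → ≤-trans (≤-reflexive (product c k i)) (*-monoˡ (⟦⟧-nonneg (k₁ == k))
              (≤-trans (*-monoʳ (*-nonneg (through≥0 u c i) (through≥0 v c i)) (⟦⟧≤1 (k₂ == k))) (≤-trans (≤-reflexive (*-identityˡ _)) (both c i)))))))
            (≤-trans (≤-reflexive (select-copy k₁ (λ c i → ⟦ at (λ e → inc e u ∧ inc e v) (slot c i) ⟧))) (≤-trans (∑-slots enum (λ e → inc e u ∧ inc e v))
              (≤-trans (≤-reflexive (∑-cong (λ e → ⟦∧⟧ (inc e u) (inc e v)))) (codeg u v (λ u≡v → uk≢vk (cong inj₁ (cong₂ _,_ u≡v (==⇒≡ k₁ k₂ k₁≡k₂))))))))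

        coldeg′ : ∀ z c k → ∑ (λ i → ⟦ copy c k i z ⟧) ≤ K
        coldeg′ (inj₁ (v , k′)) c k = ≤-trans (∑-mono (λ i → copy≤through c k i v k′)) (≤-trans (slot-∑ c (λ e → inc e v)) (coldeg v c))
        coldeg′ (inj₂ e) c k = ≤-trans (∑-slots-colour enum c (λ e′ → e′ == e)) (≤-trans (≤-reflexive (∑-one e)) 1≤K)

      family-bounded : Bounded family (1ℚ + r) (ι D) K
      family-bounded = record
        { size   = λ x i → ≤-trans (≤-reflexive (∑-V (λ z → ⟦ copy (proj₁ (remQuot {C} D x)) (proj₂ (remQuot {C} D x)) i z ⟧))) (size′ (proj₁ (remQuot {C} D x)) (proj₂ (remQuot {C} D x)) i)
        ; deg    = λ z → ≤-trans (≤-reflexive (∑-family (λ c k → ∑ (λ i → ⟦ copy c k i (toV z) ⟧)))) (deg′ (toV z))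
        ; codeg  = λ z z′ z≢z′ → ≤-trans (≤-reflexive (∑-family (λ c k → ∑ (λ i → ⟦ copy c k i (toV z) ⟧ * ⟦ copy c k i (toV z′) ⟧))))
                     (codeg′ (toV z) (toV z′) (λ eq → z≢z′ (trans (sym (fromV-toV z)) (trans (cong fromV eq) (fromV-toV z′)))))
        ; coldeg = λ z x → coldeg′ (toV z) (proj₁ (remQuot {C} D x)) (proj₂ (remQuot {C} D x))
        }

    module _ (transversal : Transversal family) where
      private
        pick = proj₁ transversal

      chosen : Fin D → Fin m → Bool
      chosen k e = any (λ c → at (λ e′ → e′ == e) (slot c (pick (combine c k))))

      copies-disjoint : ∀ c k c′ k′ z → (c , k) ≢ (c′ , k′) → copy c k (pick (combine c k)) z ≡ true → copy c′ k′ (pick (combine c′ k′)) z ≡ true → ⊥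
      copies-disjoint c k c′ k′ z distinct h h′ = false≢true (trans (sym (proj₂ transversal (combine c k) (combine c′ k′) x≢x′ (fromV z) (trans (family-copy c k _ z) h))) (trans (family-copy c′ k′ _ z) h′))
        where
        x≢x′ : combine c k ≢ combine c′ k′
        x≢x′ eq = distinct (trans (sym (remQuot-combine c k)) (trans (cong (remQuot D) eq) (remQuot-combine c′ k′)))

      chosen-slot : ∀ k e → chosen k e ≡ true → ∃ λ c → slot c (pick (combine c k)) ≡ just e
      chosen-slot k e h = from-any (any-elim (λ c → at (λ e′ → e′ == e) (slot c (pick (combine c k)))) h)
        where
        from-at : ∀ s → at (λ e′ → e′ == e) s ≡ true → s ≡ just e
        from-at (just e′) h = cong just (==⇒≡ e′ e h)
        from-any : (∃ λ c → at (λ e′ → e′ == e) (slot c (pick (combine c k))) ≡ true) → ∃ λ c → slot c (pick (combine c k)) ≡ just e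
        from-any (c , h) = c , from-at (slot c (pick (combine c k))) h

      at-slot : ∀ {c k e} (g : Fin m → Bool) → slot c (pick (combine c k)) ≡ just e → g e ≡ true → at g (slot c (pick (combine c k))) ≡ true
      at-slot g eq h = trans (cong (at g) eq) h

      just-injective′ : ∀ {x y : Fin m} → just x ≡ just y → x ≡ y
      just-injective′ refl = refl

      chosen-colour : ∀ k e f → chosen k e ≡ true → chosen k f ≡ true → colour e ≡ colour f → e ≡ f
      chosen-colour k e f he hf same with chosen-slot k e he | chosen-slot k f hf
      ... | c , p | c′ , q = just-injective′ (trans (sym p) (trans (cong (λ c → slot c (pick (combine c k))) (trans (sym (slot-colour c _ e p)) (trans same (slot-colour c′ _ f q)))) q))

      chosen-matching : ∀ k e f v → chosen k e ≡ true → chosen k f ≡ true → e ≢ f → inc e v ≡ true → inc f v ≡ true → ⊥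
      chosen-matching k e f v he hf e≢f ve vf with chosen-slot k e he | chosen-slot k f hf
      ... | c , p | c′ , q = copies-disjoint c k c′ k (inj₁ (v , k)) (λ eq → e≢f (just-injective′ (trans (sym p) (trans (cong (λ x → slot (proj₁ x) (pick (combine (proj₁ x) k))) eq) q))))
                               (cong₂ _∧_ (==-refl k) (at-slot {c} {k} (λ e → inc e v) p ve)) (cong₂ _∧_ (==-refl k) (at-slot {c′} {k} (λ e → inc e v) q vf))

      chosen-disjoint : ∀ k k′ e → k ≢ k′ → chosen k e ≡ true → chosen k′ e ≡ true → ⊥
      chosen-disjoint k k′ e k≢k′ h h′ with chosen-slot k e h | chosen-slot k′ e h′
      ... | c , p | c′ , q = copies-disjoint c k c′ k′ (inj₂ e) (λ eq → k≢k′ (cong proj₂ eq)) (at-slot {c} {k} (λ e′ → e′ == e) p (==-refl e)) (at-slot {c′} {k′} (λ e′ → e′ == e) q (==-refl e))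

      chosen-full : ∀ k c → ι a ≤ ∑ (λ e → ⟦ colour e == c ⟧) → ∃ λ e → chosen k e ≡ true × colour e ≡ c
      chosen-full k c large with slot-full c (pick (combine c k)) large
      ... | e , p = e , any-intro (λ c → at (λ e′ → e′ == e) (slot c (pick (combine c k)))) c (at-slot {c} {k} (λ e′ → e′ == e) p (==-refl e)) , slot-colour c _ e p

open HypergraphNibble hiding (_^_)

open import Defs
open import Data.Bool using (Bool; true; _∧_)
open import Data.Empty using (⊥-elim)
open import Data.Fin using (Fin; zero; suc; toℕ; fromℕ<)
open import Data.Fin.Properties using (toℕ-fromℕ<)
open import Data.Fin.Subset using (Subset; _∈_; ∣_∣; inside; outside)
open import Data.Fin.Subset.Properties using (_∈?_)
import Data.Integer as ℤ
open import Data.Nat using (ℕ; zero; suc; NonZero; _+_; _*_; _∸_; _^_; _≤_; _<_; z≤n; s≤s; _≤?_; _≟_; >-nonZero)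
import Data.Nat.DivMod as ℕ
import Data.Nat.Properties as ℕ
open import Data.Product using (Σ; ∃; _×_; _,_; proj₁; proj₂)
open import Data.Rational as ℚ using (ℚ; 0ℚ; 1ℚ)
import Data.Rational.Properties as ℚ
open import Data.Vec using ([]; _∷_; tabulate)
open import Data.Vec.Properties using ([]=⇒lookup; lookup⇒[]=; lookup∘tabulate)
open import Relation.Nullary using (¬_; Dec; yes; no; does)
open import Relation.Nullary.Decidable using (_×-dec_)
open import Relation.Binary.PropositionalEquality using (_≡_; _≢_; refl; sym; trans; cong; cong₂; subst; subst₂)

-- Integer parameters and the theorem

^-cancel-≤-ℕ : ∀ n {x y} → x ^ suc n ≤ y ^ suc n → x ≤ y
^-cancel-≤-ℕ n {x} {y} h = ι-cancel-≤ (^-cancel-≤ n (ι-nonneg y) (subst₂ ℚ._≤_ (ι-^ x (suc n)) (ι-^ y (suc n)) (ι-mono h)))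

^-cancel-<-suc : ∀ n {x y} → x ^ n < suc y ^ n → x ≤ y
^-cancel-<-suc n {x} {y} h with x ≤? y
... | yes x≤y = x≤y
... | no x≰y  = ⊥-elim (ℕ.<-irrefl refl (ℕ.<-≤-trans h (ℕ.^-monoˡ-≤ n (ℕ.≰⇒> x≰y))))

-- The condition `1 ≤ m` rules out that the subtraction was truncated.
m≤o∸n⇒n+m≤o : ∀ {m n o} → 1 ≤ m → m ≤ o ∸ n → n + m ≤ o
m≤o∸n⇒n+m≤o {m} {n} {o} 1≤m h with n ≤? o
... | yes n≤o = ℕ.≤-trans (ℕ.+-monoʳ-≤ n h) (ℕ.≤-reflexive (ℕ.m+[n∸m]≡n n≤o))
... | no n≰o  = ⊥-elim (ℕ.n≮0 (ℕ.<-≤-trans 1≤m (ℕ.≤-trans h (ℕ.≤-reflexive (ℕ.m≤n⇒m∸n≡0 (ℕ.<⇒≤ (ℕ.≰⇒> n≰o)))))))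

^-distribʳ-* : ∀ x y n → (x * y) ^ n ≡ x ^ n * y ^ n
^-distribʳ-* x y zero    = refl
^-distribʳ-* x y (suc n) = trans (cong (x * y *_) (^-distribʳ-* x y n)) (ℕ.[m*n]*[o*p]≡[m*o]*[n*p] x y (x ^ n) (y ^ n))

integer-root : ∀ q D → ∃ λ L → L ^ suc q ≤ D × D < suc L ^ suc q
integer-root q D = search D (ℕ.<-≤-trans (ℕ.n<1+n D) (ℕ.m≤m*n (suc D) (suc D ^ q) {{ℕ.m^n≢0 (suc D) q}}))
  where
  search : ∀ n → D < suc n ^ suc q → ∃ λ L → L ^ suc q ≤ D × D < suc L ^ suc q
  search zero    h = 0 , z≤n , h
  search (suc n) h with suc n ^ suc q ≤? D
  ... | yes ≤D = suc n , ≤D , h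
  ... | no ≰D  = search n (ℕ.≰⇒> ≰D)

ι-count : ∀ {m} {P : Fin m → Set} (P? : ∀ i → Dec (P i)) → ι (count P?) ≡ ∑ (λ i → ⟦ does (P? i) ⟧)
ι-count {zero}  P? = refl
ι-count {suc m} P? with P? zero
... | yes _ = cong (1ℚ ℚ.+_) (ι-count (λ i → P? (suc i)))
... | no  _ = trans (ι-count (λ i → P? (suc i))) (sym (ℚ.+-identityˡ _))

ι-∣∣ : ∀ {n} (S : Subset n) → ι ∣ S ∣ ≡ ∑ (λ v → ⟦ does (v ∈? S) ⟧)
ι-∣∣ []            = refl
ι-∣∣ (inside ∷ S)  = cong (1ℚ ℚ.+_) (ι-∣∣ S)
ι-∣∣ (outside ∷ S) = trans (ι-∣∣ S) (sym (ℚ.+-identityˡ _))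

does-true : ∀ {A : Set} (d : Dec A) → A → does d ≡ true
does-true (yes _) _ = refl
does-true (no ¬a) a = ⊥-elim (¬a a)

true-does : ∀ {A : Set} (d : Dec A) → does d ≡ true → A
true-does (yes a) _ = a

bounded-colours : ∀ {m} (f : Fin m → ℕ) → ∃ λ C → ∀ i → f i < C
bounded-colours {zero}  f = 0 , λ ()
bounded-colours {suc m} f with bounded-colours (λ i → f (suc i))
... | C , h = suc (f zero) + C , λ { zero → ℕ.m≤m+n (suc (f zero)) C ; (suc i) → ℕ.<-≤-trans (h i) (ℕ.m≤n+m C (suc (f zero))) }

module Parameters (r a b : ℕ) where

  -- `ρ` allows for the extra vertex that the product adds to every edge. `Q` unfolds to
  -- `j * suc b`, so `L ^ Q ≤ D` makes `L ^ j` at most the root of `D` of order `suc b`. `L ^ M`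
  -- bounds the initial number of edges per colour, and `k` is such that `L ^ suc k` is
  -- `L ^ 17 * (L ^ M) ^ 4`. Since `k` does not involve `L`, the threshold `L₀` may depend on it.
  ρ n j Q q M k L₀ : ℕ
  ρ = suc r
  n = 1 + 2 * ρ
  j = 14 + 2 * suc n
  q = b + (13 + 2 * suc n) * suc b
  Q = suc q
  M = suc (2 * Q)
  k = 16 + M * 4
  L₀ = 2 + 44 * (suc k * suc k) * ((3 * ρ + 1) * (3 * ρ + 1))

  module _ {D L x₀ K : ℕ} (L₀≤L : L₀ ≤ L) (1≤D : 1 ≤ D) (D<Lᑫ : D < suc L ^ Q)
           (D≤x₀ : D ≤ x₀ * suc L) (x₀≤D : x₀ ≤ D) (1≤K : 1 ≤ K) (K≤ : K * L ^ j ≤ D) where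

    private
      2≤L : 2 ≤ L
      2≤L = ℕ.≤-trans (ℕ.m≤m+n 2 _) L₀≤L
      instance
        L≢0 : NonZero L
        L≢0 = >-nonZero (ℕ.<-trans (s≤s z≤n) 2≤L)
      infixr 8 _^ℚ_
      _^ℚ_ : ℚ → ℕ → ℚ
      _^ℚ_ = HypergraphNibble._^_

      L-large : (ℤ.+ 44 ℚ./ 1) ℚ.* (ι (suc k) ℚ.* ι (suc k)) ℚ.* ((3ℚ ℚ.* ι ρ ℚ.+ 1ℚ) ℚ.* (3ℚ ℚ.* ι ρ ℚ.+ 1ℚ)) ℚ.≤ ι L
      L-large = subst (ℚ._≤ ι L) expand (ι-mono (ℕ.≤-trans (ℕ.m≤n+m _ 2) L₀≤L))
        where
        u≡ : ι (3 * ρ + 1) ≡ 3ℚ ℚ.* ι ρ ℚ.+ 1ℚ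
        u≡ = trans (ι-+ (3 * ρ) 1) (cong (ℚ._+ 1ℚ) (trans (ι-* 3 ρ) (cong (ℚ._* ι ρ) (ι≡/1 3))))
        expand : ι (44 * (suc k * suc k) * ((3 * ρ + 1) * (3 * ρ + 1))) ≡ (ℤ.+ 44 ℚ./ 1) ℚ.* (ι (suc k) ℚ.* ι (suc k)) ℚ.* ((3ℚ ℚ.* ι ρ ℚ.+ 1ℚ) ℚ.* (3ℚ ℚ.* ι ρ ℚ.+ 1ℚ))
        expand = trans (ι-* (44 * (suc k * suc k)) ((3 * ρ + 1) * (3 * ρ + 1))) (cong₂ ℚ._*_
          (trans (ι-* 44 (suc k * suc k)) (cong₂ ℚ._*_ (ι≡/1 44) (ι-* (suc k) (suc k)))) (trans (ι-* (3 * ρ + 1) (3 * ρ + 1)) (cong₂ ℚ._*_ u≡ u≡)))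
      1≤A : 1ℚ ℚ.≤ ι L ^ℚ M
      1≤A = 1≤^ M (1≤ι-nonZero L)
      k-large : ι L ^ℚ 17 ℚ.* (ι L ^ℚ M) ^ℚ 4 ℚ.≤ ι L ^ℚ suc k
      k-large = ℚ.≤-reflexive (trans (cong (ι L ^ℚ 17 ℚ.*_) (^-assocʳ (ι L) M 4)) (sym (^-homo-* (ι L) 17 (M * 4))))
      K-small : ι K ℚ.* ι L ^ℚ j ℚ.≤ ι D
      K-small = subst (ℚ._≤ ι D) (trans (ι-* K (L ^ j)) (cong (ι K ℚ.*_) (ι-^ L j))) (ι-mono K≤)
      1≤x₀ : 1 ≤ x₀
      1≤x₀ = ℕ.n≢0⇒n>0 λ { refl → ℕ.n≮0 (ℕ.<-≤-trans 1≤D D≤x₀) }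
      -- `L + 1 ≤ L²` replaces the bound in `L + 1` by a power of `L`. The additional 1 in `M` then
      -- pays for `D + x₀` being up to twice as large.
      D≤L²ᑫ : D ≤ L ^ (2 * Q)
      D≤L²ᑫ = ℕ.≤-trans (ℕ.<⇒≤ D<Lᑫ) (ℕ.≤-trans (ℕ.^-monoˡ-≤ Q L+1≤L²) (ℕ.≤-reflexive (ℕ.^-*-assoc L 2 Q)))
        where
        L+1≤L² : suc L ≤ L ^ 2
        L+1≤L² = ℕ.≤-trans (ℕ.+-monoˡ-≤ L (ℕ.≤-trans (s≤s z≤n) 2≤L)) (ℕ.≤-trans (ℕ.≤-reflexive (cong (L +_) (sym (ℕ.+-identityʳ L))))
          (ℕ.≤-trans (ℕ.*-monoˡ-≤ L 2≤L) (ℕ.≤-reflexive (cong (L *_) (sym (ℕ.*-identityʳ L))))))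
      a≤A : ι (D + x₀) ℚ.≤ ι L ^ℚ M
      a≤A = subst (ι (D + x₀) ℚ.≤_) (ι-^ L M) (ι-mono (ℕ.≤-trans (ℕ.+-mono-≤ D≤L²ᑫ (ℕ.≤-trans x₀≤D D≤L²ᑫ))
        (ℕ.≤-trans (ℕ.≤-reflexive (cong (L ^ (2 * Q) +_) (sym (ℕ.+-identityʳ _)))) (ℕ.*-monoˡ-≤ (L ^ (2 * Q)) 2≤L))))
      surplus : ι (D + x₀) ℚ.- ι D ≡ ι x₀
      surplus = trans (cong (ℚ._- ι D) (ι-+ D x₀)) (trans (cong (ℚ._- ι D) (ℚ.+-comm (ι D) (ι x₀))) (trans (ℚ.+-assoc (ι x₀) (ι D) (ℚ.- ι D))
        (trans (cong (ι x₀ ℚ.+_) (ℚ.+-inverseʳ (ι D))) (ℚ.+-identityʳ (ι x₀)))))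
      -- At the start `d = D` and the surplus is `x₀`, so the invariant is a power of
      -- `D ≤ x₀ * suc L`.
      invariant : ι D ^ℚ n ℚ.* ι D ℚ.≤ ((1ℚ ℚ.+ ι L) ℚ.* (ι (D + x₀) ℚ.- ι D)) ^ℚ suc n
      invariant = ℚ.≤-trans (ℚ.≤-reflexive (ℚ.*-comm (ι D ^ℚ n) (ι D))) (^-mono-≤ (suc n) (ι-nonneg D)
        (subst (ι D ℚ.≤_) (trans (ι-* x₀ (suc L)) (trans (ℚ.*-comm (ι x₀) (ι (suc L))) (cong (ι (suc L) ℚ.*_) (sym surplus)))) (ι-mono D≤x₀)))

    nibble-transversal : ∀ {C V} (edge : Family C (D + x₀) V) → Bounded edge (1ℚ ℚ.+ ι r) (ι D) (ι K) → Transversal edge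
    nibble-transversal = Nibble.nibble ρ L k (s≤s z≤n) L-large 1≤A k-large (ι-mono 1≤K) K-small (D + x₀) (D + x₀) (ι D) ℕ.≤-refl a≤A (ι-mono 1≤D) ℚ.≤-refl
      (subst (ℚ._< ι (D + x₀)) (ℚ.+-identityʳ (ι D)) (subst (ι D ℚ.+ 0ℚ ℚ.<_) (sym (ι-+ D x₀)) (ℚ.+-monoʳ-< (ι D) (ℚ.<-≤-trans 0<1 (ι-mono 1≤x₀))))) invariant

module FullMatchings {n m D a K r : ℕ} (G : ColHyp n m) (1≤K : 1 ≤ K) (r-bounded : RBounded r G) (Δ≤D : MaxDegLe G D)
  (large : ∀ c → UsedColor G c → a ≤ colCount G c)
  (codeg≤ : ∀ u v → u ≢ v → codeg G u v ≤ K) (coldeg≤ : ∀ v c → colDeg G v c ≤ K)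
  (transversal : ∀ {C V} (edge : Family C a V) → Bounded edge (1ℚ ℚ.+ ι r) (ι D) (ι K) → Transversal edge) where

  private
    C : ℕ
    C = proj₁ (bounded-colours (color G))
    colour : Fin m → Fin C
    colour e = fromℕ< (proj₂ (bounded-colours (color G)) e)
    toℕ-colour : ∀ e → toℕ (colour e) ≡ color G e
    toℕ-colour e = toℕ-fromℕ< (proj₂ (bounded-colours (color G)) e)
    inc : Fin m → Fin n → Bool
    inc e v = does (v ∈? edge G e)

    open Classes colour using (enumerate)
    open Product D inc colour (enumerate a)

    colour≡ : ∀ {e f} → color G e ≡ color G f → colour e ≡ colour f
    colour≡ {e} {f} eq = Data.Fin.Properties.toℕ-injective (trans (toℕ-colour e) (trans eq (sym (toℕ-colour f))))
      where import Data.Fin.Properties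
    bounded : Bounded family (1ℚ ℚ.+ ι r) (ι D) (ι K)
    bounded = family-bounded (ι-nonneg r) (ι-mono 1≤K)
      (λ e → subst (ℚ._≤ ι r) (ι-∣∣ (edge G e)) (ι-mono (r-bounded e)))
      (λ v → subst (ℚ._≤ ι D) (ι-count (λ e → v ∈? edge G e)) (ι-mono (Δ≤D v)))
      (λ u v u≢v → subst (ℚ._≤ ι K) (trans (ι-count (λ e → (u ∈? edge G e) ×-dec (v ∈? edge G e))) (∑-cong {m} (λ e → ⟦∧⟧ (inc e u) (inc e v)))) (ι-mono (codeg≤ u v u≢v)))
      (λ v c → ℚ.≤-trans (∑-mono (λ e → subst (ℚ._≤ ⟦ inc e v ∧ does (color G e ≟ toℕ c) ⟧) (⟦∧⟧ (colour e == c) (inc e v)) (⟦⟧-mono {(colour e == c) ∧ inc e v} (same-colour e v c))))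
        (subst (ℚ._≤ ι K) (ι-count (λ e → (v ∈? edge G e) ×-dec (color G e ≟ toℕ c))) (ι-mono (coldeg≤ v (toℕ c)))))
      where
      same-colour : ∀ e v c → (colour e == c) ∧ inc e v ≡ true → inc e v ∧ does (color G e ≟ toℕ c) ≡ true
      same-colour e v c h with ∧-true {colour e == c} h
      ... | p , q = cong₂ _∧_ q (does-true (color G e ≟ toℕ c) (trans (sym (toℕ-colour e)) (cong toℕ (==⇒≡ (colour e) c p))))
    T : Transversal family
    T = transversal family bounded

  matchings : Fin D → Subset m
  matchings i = tabulate (chosen T i)

  private
    member : ∀ {i e} → e ∈ matchings i → chosen T i e ≡ true
    member {i} {e} e∈ = trans (sym (lookup∘tabulate (chosen T i) e)) ([]=⇒lookup e∈)
    class-large : ∀ e → ι a ℚ.≤ ∑ (λ f → ⟦ colour f == colour e ⟧)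
    class-large e = ℚ.≤-trans (ι-mono (large (color G e) (e , refl))) (ℚ.≤-trans (ℚ.≤-reflexive (ι-count (λ f → color G f ≟ color G e)))
      (∑-mono (λ f → ⟦⟧-mono {does (color G f ≟ color G e)} (λ h → subst (λ c → (colour f == c) ≡ true) (colour≡ (true-does (color G f ≟ color G e) h)) (==-refl (colour f))))))

  full-rainbow : ∀ i → IsFullRainbowMatching G (matchings i)
  full-rainbow i =
    (λ e f e∈ f∈ e≢f v v∈e v∈f → chosen-matching T i e f v (member e∈) (member f∈) e≢f (does-true (v ∈? edge G e) v∈e) (does-true (v ∈? edge G f) v∈f)) ,
    (λ e f e∈ f∈ e≢f same → e≢f (chosen-colour T i e f (member e∈) (member f∈) (colour≡ same))) ,
    full
    where
    full : IsFull G (matchings i)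
    full c (e , refl) with chosen-full T i (colour e) (class-large e)
    ... | f , fᵢ , same = f , lookup⇒[]= f (matchings i) (trans (lookup∘tabulate (chosen T i) f) fᵢ) , trans (sym (toℕ-colour f)) (trans (cong toℕ same) (toℕ-colour e))

  disjoint-matchings : ∀ i j → i ≢ j → ∀ e → e ∈ matchings i → ¬ (e ∈ matchings j)
  disjoint-matchings i j i≢j e e∈i e∈j = chosen-disjoint T i j e i≢j (member e∈i) (member e∈j)

theorem2p7 : (r : ℕ) → 2 ≤ r → (a b : ℕ) →
    Σ ℕ λ Dβ → Σ ℕ λ p → Σ ℕ λ q →
    ∀ (D : ℕ) → Dβ ≤ D → 1 ≤ D →
    ∀ {n m : ℕ} (G : ColHyp n m) →
    RBounded r G →
    MaxDegLe G D →
    (∀ c → UsedColor G c → GeqPow1Minus (colCount G c ∸ D) D (suc p) (suc q)) →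
    (∀ u v → u ≢ v → LeqPow1Minus (codeg G u v) D (suc a) (suc b)) →
    (∀ v c → LeqPow1Minus (colDeg G v c) D (suc a) (suc b)) →
    Σ (Fin D → Subset m) λ Ms →
    (∀ i → IsFullRainbowMatching G (Ms i)) ×
    (∀ i j → i ≢ j → ∀ e → e ∈ Ms i → ¬ (e ∈ Ms j))
-- The exponent is `α = 1 / Q`. The threshold `L₀ ^ Q` ensures that the integer root `L` of `D` of
-- order `Q` is at least `L₀`.
theorem2p7 r _ a b = L₀ ^ Q , 0 , q , λ D Dβ≤D 1≤D G r-bounded Δ≤D colours codegrees coldegrees →
  from-root D Dβ≤D 1≤D G r-bounded Δ≤D colours codegrees coldegrees (integer-root q D)
  where
  open Parameters r a b
  from-root : ∀ D → L₀ ^ Q ≤ D → 1 ≤ D → ∀ {n m} (G : ColHyp n m) → RBounded r G → MaxDegLe G D →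
    (∀ c → UsedColor G c → GeqPow1Minus (colCount G c ∸ D) D 1 Q) →
    (∀ u v → u ≢ v → LeqPow1Minus (codeg G u v) D (suc a) (suc b)) → (∀ v c → LeqPow1Minus (colDeg G v c) D (suc a) (suc b)) →
    (∃ λ L → L ^ Q ≤ D × D < suc L ^ Q) →
    Σ (Fin D → Subset m) λ Ms → (∀ i → IsFullRainbowMatching G (Ms i)) × (∀ i j → i ≢ j → ∀ e → e ∈ Ms i → ¬ (e ∈ Ms j))
  from-root D Dβ≤D 1≤D G r-bounded Δ≤D colours codegrees coldegrees (L , Lᑫ≤D , D<L+1ᑫ) = matchings , full-rainbow , disjoint-matchings
    where
    L₀≤L : L₀ ≤ L
    L₀≤L = ^-cancel-<-suc Q (ℕ.≤-<-trans Dβ≤D D<L+1ᑫ)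
    instance
      L≢0 : NonZero L
      L≢0 = >-nonZero (ℕ.≤-trans (s≤s z≤n) L₀≤L)
      Lʲ≢0 : NonZero (L ^ j)
      Lʲ≢0 = ℕ.m^n≢0 L j
      D≢0 : NonZero D
      D≢0 = >-nonZero 1≤D
    K x₀ : ℕ
    -- `K` is rounded down and `x₀` up: integers that are at most `D / L ^ j`, or at least
    -- `D / (L + 1)`, also satisfy these bounds.
    K  = D ℕ./ L ^ j
    x₀ = (D + L) ℕ./ suc L
    ≤K : ∀ {x} → x * L ^ j ≤ D → x ≤ K
    ≤K {x} h = ℕ.≤-trans (ℕ.≤-reflexive (sym (ℕ.m*n/n≡m x (L ^ j)))) (ℕ./-monoˡ-≤ (L ^ j) h)
    Lʲᵇ≤D : (L ^ j) ^ suc b ≤ D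
    Lʲᵇ≤D = ℕ.≤-trans (ℕ.≤-reflexive (ℕ.^-*-assoc L j (suc b))) Lᑫ≤D
    1≤K : 1 ≤ K
    1≤K = ≤K (ℕ.≤-trans (ℕ.≤-reflexive (ℕ.*-identityˡ (L ^ j))) (ℕ.≤-trans (ℕ.m≤m*n (L ^ j) ((L ^ j) ^ b) {{ℕ.m^n≢0 (L ^ j) b}}) Lʲᵇ≤D))
    -- From `L ^ (j * suc b) ≤ D ≤ D ^ suc a` one gets that `x * L ^ j`, raised to `suc b`, is at
    -- most `D ^ suc b`; so every positive `β` is treated as if it were `1 / suc b`.
    small : ∀ {x} → LeqPow1Minus x D (suc a) (suc b) → x ≤ K
    small {x} h = ≤K (^-cancel-≤-ℕ b (ℕ.≤-trans (ℕ.≤-reflexive (^-distribʳ-* x (L ^ j) (suc b))) (ℕ.≤-trans (ℕ.*-monoʳ-≤ (x ^ suc b) (ℕ.≤-trans Lʲᵇ≤D (ℕ.m≤m*n D (D ^ a) {{ℕ.m^n≢0 D a}}))) h)))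
    x₀≤ : ∀ {x} → D ≤ x * suc L → x₀ ≤ x
    x₀≤ {x} h = ℕ.≤-pred (ℕ.m<n*o⇒m/o<n {D + L} {suc x} {suc L} (s≤s (ℕ.≤-trans (ℕ.+-monoˡ-≤ L h) (ℕ.≤-reflexive (ℕ.+-comm (x * suc L) L)))))
    D≤x₀ : D ≤ x₀ * suc L
    D≤x₀ = ℕ.+-cancelʳ-≤ L D (x₀ * suc L) (ℕ.≤-trans (ℕ.≤-reflexive (ℕ.m≡m%n+[m/n]*n (D + L) (suc L)))
      (ℕ.≤-trans (ℕ.+-monoˡ-≤ (x₀ * suc L) (ℕ.≤-pred (ℕ.m%n<n (D + L) (suc L)))) (ℕ.≤-reflexive (ℕ.+-comm L (x₀ * suc L)))))
    -- The hypothesis with exponent `1 / Q` and `D < suc L ^ Q` give `D ^ Q ≤ (x * suc L) ^ Q`;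
    -- taking roots yields a surplus of at least `x₀`.
    large : ∀ c → UsedColor G c → D + x₀ ≤ colCount G c
    large c used = m≤o∸n⇒n+m≤o 1≤x₀ (x₀≤ (^-cancel-≤-ℕ q (ℕ.≤-trans (colours c used) (ℕ.≤-trans (ℕ.*-monoʳ-≤ (x ^ Q) (ℕ.≤-trans (ℕ.≤-reflexive (ℕ.*-identityʳ D)) (ℕ.<⇒≤ D<L+1ᑫ)))
        (ℕ.≤-reflexive (sym (^-distribʳ-* x (suc L) Q)))))))
      where
      x = colCount G c ∸ D
      1≤x₀ : 1 ≤ x₀
      1≤x₀ = ℕ.n≢0⇒n>0 λ eq → ℕ.n≮0 (ℕ.<-≤-trans 1≤D (subst (λ z → D ≤ z * suc L) eq D≤x₀))
    open FullMatchings G 1≤K r-bounded Δ≤D large (λ u v u≢v → small (codegrees u v u≢v)) (λ v c → small (coldegrees v c))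
      (nibble-transversal {D} {L} {x₀} {K} L₀≤L 1≤D D<L+1ᑫ D≤x₀ (x₀≤ (ℕ.m≤m*n D (suc L))) 1≤K (ℕ.m/n*n≤m D (L ^ j)))
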